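{- (1) Parameterized by $k+s_{\max}+o_{\max}$, \textsc{Set Cover with Capacities and Prices} is solvable in $\mathcal{O}\Big((n\cdot m)\cdot \big(s_{\max}\cdot o_{\max}\big)^k\Big)$ time. (2) Parameterized by $k+(n-s_{\min})+(m-o_{\min})$, \textsc{Set Cover with Demands and Prices} is solvable in $\mathcal{O}\Big((n\cdot m)\cdot \big((n-s_{\min})\cdot(m-o_{\min})\big)^k\Big)$ time.
   Context: Write $[n]=\{1,\dots,n\}$. An instance of \textsc{Set Cover with Demands (respectively Capacities) and Prices} consists of a universe $U=[n]$, a list of demands $d_1,\dots,d_n\in[m]$ (respectively capacities $c_1,\dots,c_n\in[m]$), a family of subsets $\mathcal{F}=\{F_1,\dots,F_m\}$ over $U$, a list of prices $p_1,\dots,p_m\in\mathbb{N}$ (where $p_j$ is the price of $F_j$), and two integers $k\in\mathbb{N}$ and $t\in\mathbb{N}$. The question is whether there exists a subset $\mathcal{S}\subseteq\mathcal{F}$ with $|\mathcal{S}|=k$ and $\sum_{F_j\in\mathcal{S}}p_j\le t$ such that each element $i\in U$ is included in at least $d_i$ (respectively at most $c_i$) sets from $\mathcal{S}$. For $i\in U$ let $\mathcal{F}(i)$ denote the subfamily of sets of $\mathcal{F}$ containing $i$. Then $s_{\max}=\max_{j\in[m]}|F_j|$ and $s_{\min}=\min_{j\in[m]}|F_j|$ are the maximum and minimum size of a set from the family, and $o_{\max}=\max_{i\in[n]}|\mathcal{F}(i)|$ and $o_{\min}=\min_{i\in[n]}|\mathcal{F}(i)|$ are the maximum and minimum number of occurrences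 of an element in sets from the family.
   Formalization: The base of the power is read as max(1, s_max·o_max), respectively max(1, (n−s_min)(m−o_min)), because the literal bound is 0 when k ≥ 1 and all sets are empty (respectively equal to U), which no algorithm meets. -}

module Defs where

open import Data.Bool using (Bool; if_then_else_)
open import Data.Fin using (Fin)
open import Data.Fin.Subset using (Subset; ∣_∣; _∩_)
open import Data.Fin.Subset.Properties using (_∈?_)
open import Data.List using (List; []; _∷_; _++_; map; filter; length; allFin; concatMap)
open import Data.List.Extrema.Nat using (max; min)
open import Data.Nat using (ℕ; zero; suc; _+_; _*_; _∸_; _^_; _≤_; _≡ᵇ_; NonZero)
open import Data.Nat.ListAction using (sum)
open import Data.Product using (Σ-syntax; ∃-syntax; _×_)
open import Data.Sum using (_⊎_)
open import Data.Vec using (tabulate)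
open import Function using (_∘_)
open import Relation.Binary.PropositionalEquality using (_≡_; _≢_)
open import Relation.Nullary using (¬_; does)

-- The machine model is the random access machine with uniform (unit) cost
-- whose only arithmetic is addition and truncated subtraction (so one step
-- lengthens the largest number by at most one bit), with structured control
-- flow.  A procedure call has no parameters or local variables: it is
-- a jump to a subroutine that returns to the point of call.

Reg : Set
Reg = ℕ

data Instr : Set where
  _≔_       : Reg → ℕ → Instr
  _≔_⊞_     : Reg → Reg → Reg → Instr
  _≔_⊟_     : Reg → Reg → Reg → Instr
  _≔mem[_]  : Reg → Reg → Instr
  mem[_]≔_  : Reg → Reg → Instr

infixr 5 _⨾_

data Cmd (q : ℕ) : Set where
  skip         : Cmd q
  instr        : Instr → Cmd q
  _⨾_          : Cmd q → Cmd q → Cmd q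
  ifNonZero    : Reg → Cmd q → Cmd q → Cmd q
  whileNonZero : Reg → Cmd q → Cmd q
  call         : Fin q → Cmd q

record Program : Set where
  field
    arity : ℕ
    procs : Fin arity → Cmd arity
    main  : Cmd arity

record State : Set where
  constructor ⟪_,_⟫
  field
    reg : Reg → ℕ
    mem : ℕ → ℕ

open State public

_[_↦_] : (ℕ → ℕ) → ℕ → ℕ → (ℕ → ℕ)
(f [ a ↦ v ]) x = if x ≡ᵇ a then v else f x

⟦_⟧ : Instr → State → State
⟦ x ≔ c ⟧       ⟪ r , h ⟫ = ⟪ r [ x ↦ c ] , h ⟫
⟦ x ≔ y ⊞ z ⟧   ⟪ r , h ⟫ = ⟪ r [ x ↦ r y + r z ] , h ⟫
⟦ x ≔ y ⊟ z ⟧   ⟪ r , h ⟫ = ⟪ r [ x ↦ r y ∸ r z ] , h ⟫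
⟦ x ≔mem[ y ] ⟧ ⟪ r , h ⟫ = ⟪ r [ x ↦ h (r y) ] , h ⟫
⟦ mem[ x ]≔ y ⟧ ⟪ r , h ⟫ = ⟪ r , h [ r x ↦ r y ] ⟫

-- procs ⊢ c , s ⇓ s′ ⟨ τ ⟩ : started in s, the command c halts in s′ after
-- exactly τ steps.  Every instruction, test and call costs one step.
data _⊢_,_⇓_⟨_⟩ {q : ℕ} (procs : Fin q → Cmd q) :
                Cmd q → State → State → ℕ → Set where
  ⇓skip  : ∀ {s} → procs ⊢ skip , s ⇓ s ⟨ 1 ⟩
  ⇓instr : ∀ {i s} → procs ⊢ instr i , s ⇓ ⟦ i ⟧ s ⟨ 1 ⟩
  ⇓seq   : ∀ {c₁ c₂ s s′ s″ τ₁ τ₂} →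
           procs ⊢ c₁ , s ⇓ s′ ⟨ τ₁ ⟩ → procs ⊢ c₂ , s′ ⇓ s″ ⟨ τ₂ ⟩ →
           procs ⊢ c₁ ⨾ c₂ , s ⇓ s″ ⟨ τ₁ + τ₂ ⟩
  ⇓then  : ∀ {x c₁ c₂ s s′ τ} → reg s x ≢ 0 →
           procs ⊢ c₁ , s ⇓ s′ ⟨ τ ⟩ →
           procs ⊢ ifNonZero x c₁ c₂ , s ⇓ s′ ⟨ suc τ ⟩
  ⇓else  : ∀ {x c₁ c₂ s s′ τ} → reg s x ≡ 0 →
           procs ⊢ c₂ , s ⇓ s′ ⟨ τ ⟩ →
           procs ⊢ ifNonZero x c₁ c₂ , s ⇓ s′ ⟨ suc τ ⟩
  ⇓loop  : ∀ {x c s s′ s″ τ₁ τ₂} → reg s x ≢ 0 →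
           procs ⊢ c , s ⇓ s′ ⟨ τ₁ ⟩ →
           procs ⊢ whileNonZero x c , s′ ⇓ s″ ⟨ τ₂ ⟩ →
           procs ⊢ whileNonZero x c , s ⇓ s″ ⟨ suc (τ₁ + τ₂) ⟩
  ⇓exit  : ∀ {x c s} → reg s x ≡ 0 →
           procs ⊢ whileNonZero x c , s ⇓ s ⟨ 1 ⟩
  ⇓call  : ∀ {f s s′ τ} →
           procs ⊢ procs f , s ⇓ s′ ⟨ τ ⟩ →
           procs ⊢ call f , s ⇓ s′ ⟨ suc τ ⟩

-- Cell a of the initial memory holds entry a of the input word; all other
-- cells hold 0.
contents : List ℕ → ℕ → ℕ
contents []      _       = 0
contents (v ∷ w) zero    = v
contents (v ∷ w) (suc a) = contents w a

initial : List ℕ → State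
initial w = ⟪ (λ _ → 0) , contents w ⟫

record DecisionProblem : Set₁ where
  field
    Inst   : Set
    encode : Inst → List ℕ
    Yes    : Inst → Set

module _ (P : DecisionProblem) where
  open DecisionProblem P

  -- The answer is returned in register 0.
  Answers : Inst → State → Set
  Answers I s = (reg s 0 ≡ 1 × Yes I) ⊎ (reg s 0 ≡ 0 × ¬ Yes I)

  DecidesWithin : Program → Inst → ℕ → Set
  DecidesWithin prog I b =
    ∃[ s ] ∃[ τ ] (procs ⊢ main , initial (encode I) ⇓ s ⟨ τ ⟩ × τ ≤ b × Answers I s)
    where open Program prog

  -- One program and one constant serve all instances.
  SolvableInO : (Inst → ℕ) → Set
  SolvableInO f =
    Σ[ prog ∈ Program ] ∃[ C ] (∀ I → DecidesWithin prog I (C * f I))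

  -- f has the form (function of the parameter) · (polynomial in the input size).
  FixedParameterBound : (κ f : Inst → ℕ) → Set
  FixedParameterBound κ f =
    Σ[ g ∈ (ℕ → ℕ) ] ∃[ c ] (∀ I → f I ≤ g (κ I) * length (encode I) ^ c)

Parameterized_By_SolvableInO_ : (P : DecisionProblem) (κ f : DecisionProblem.Inst P → ℕ) → Set
Parameterized P By κ SolvableInO f = FixedParameterBound P κ f × SolvableInO P f

-- The common input format of the two problems: `bound` is the list of demands,
-- respectively of capacities.  The universe is nonempty, and then the range
-- 1 ≤ bound i ≤ m forces m to be nonzero too.  The family is indexed: repeated
-- sets are allowed and count separately, and subfamilies are sets of indices.
record Instance : Set where
  field
    n m         : ℕ
    ⦃ n≢0 ⦄     : NonZero n
    bound       : Fin n → ℕ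
    bound-range : ∀ i → 1 ≤ bound i × bound i ≤ m
    F           : Fin m → Subset n
    price       : Fin m → ℕ
    k t         : ℕ

  -- 𝓕(i), as a set of indices
  containing : Fin n → Subset m
  containing i = tabulate (λ j → does (i ∈? F j))

  setSizes : List ℕ
  setSizes = map (λ j → ∣ F j ∣) (allFin m)

  occurrences : List ℕ
  occurrences = map (λ i → ∣ containing i ∣) (allFin n)

  -- The first argument of max and min is a value for the empty list; as
  -- it lies below (above) all entries, it is immaterial for nonempty ones.
  s-max s-min o-max o-min : ℕ
  s-max = max 0 setSizes
  s-min = min n setSizes
  o-max = max 0 occurrences
  o-min = min m occurrences

  totalPrice : Subset m → ℕ
  totalPrice S = sum (map price (filter (_∈? S) (allFin m)))

  -- number of sets of S that contain i
  coverage : Subset m → Fin n → ℕ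
  coverage S i = ∣ S ∩ containing i ∣

  -- n, m, k, t, the demands/capacities, the prices, and the incidence matrix
  -- of the family, set by set.
  encoding : List ℕ
  encoding = n ∷ m ∷ k ∷ t ∷ map bound (allFin n) ++ map price (allFin m)
             ++ concatMap (λ j → map (λ i → bit (does (i ∈? F j))) (allFin n)) (allFin m)
    where
    bit : Bool → ℕ
    bit b = if b then 1 else 0

SetCoverWithDemandsAndPrices : DecisionProblem
SetCoverWithDemandsAndPrices = record
  { Inst   = Instance
  ; encode = Instance.encoding
  ; Yes    = λ I → let open Instance I in
      Σ[ S ∈ Subset m ] (∣ S ∣ ≡ k × totalPrice S ≤ t × (∀ i → bound i ≤ coverage S i))
  }

SetCoverWithCapacitiesAndPrices : DecisionProblem
SetCoverWithCapacitiesAndPrices = record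
  { Inst   = Instance
  ; encode = Instance.encoding
  ; Yes    = λ I → let open Instance I in
      Σ[ S ∈ Subset m ] (∣ S ∣ ≡ k × totalPrice S ≤ t × (∀ i → coverage S i ≤ bound i))
  }

module Submission where

-- The search branches on a cheapest set F among those that still fit the residual capacities.  If a solution
-- contains no set meeting F, then any of its members may be exchanged for F; hence some solution contains F or
-- a set meeting F.  These are at most b = max 1 (s · o) candidates, for set sizes ≤ s and element occurrences
-- ≤ o, so the search tree has O(bᵏ) nodes, of O(n m) steps each, provided that b ≥ 2.  When no element lies in
-- two sets (so whenever s · o ≤ 1) the tree could cost an extra factor k.  Then the question is whether the
-- k cheapest fitting sets cost at most t, and with v the k-th smallest price this holds iff
-- k v ≤ t + Σⱼ (v ∸ pⱼ).  Such a v is found in linear time by the median of medians.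
--
-- Complementing all sets turns demands d into capacities k ∸ d; a demand d > k cannot be met.

open import Defs
open import Data.Bool using (Bool; true; false; not; _∧_; T; if_then_else_)
import Data.Bool
open import Data.Bool.Properties using (T-∧)
open import Data.Fin using (Fin; zero; suc; toℕ; fromℕ<)
open import Data.Fin.Properties using (toℕ<n; toℕ-fromℕ<)
open import Data.Fin.Subset using (Subset; ∣_∣; _∩_)
open import Data.Fin.Subset.Properties using (_∈?_)
open import Data.List using (List; []; _∷_; _++_; foldr; length; map; allFin; tabulate; filter; concatMap)
open import Data.List.Extrema.Nat using (xs≤max; min≤xs)
open import Data.List.Membership.Propositional using (_∈_)
open import Data.List.Membership.Propositional.Properties using (∈-map⁺; ∈-allFin)
open import Data.List.Properties using (map-tabulate; length-++; length-map; length-tabulate)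
open import Data.List.Relation.Unary.All using ([]; _∷_) renaming (lookup to All-lookup)
open import Data.List.Relation.Unary.Any using (here; there)
open import Data.Nat
open import Data.List.Membership.DecPropositional _≟_ using () renaming (_∈?_ to _∈ℕ?_)
open import Data.Nat.DivMod using (m/n≡1+[m∸n]/n; m<n⇒m/n≡0; m≡m%n+[m/n]*n; m%n<n; m/n<m)
open import Data.Nat.ListAction using (sum)
open import Data.Nat.Properties
open import Data.Nat.Tactic.RingSolver using (solve-∀)
open import Data.Product using (Σ-syntax; ∃-syntax; _×_; _,_; proj₁; proj₂)
open import Data.Sum using (_⊎_; inj₁; inj₂)
open import Data.Unit using (tt)
open import Data.Vec as Vec using (lookup)
open import Data.Vec.Properties using (lookup-zipWith; lookup∘tabulate)
open import Function using (_∘_; case_of_; id; Equivalence)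
open import Relation.Binary.Definitions using (tri<; tri≈; tri>)
open import Relation.Binary.PropositionalEquality
open import Relation.Nullary using (¬_; yes; no; contradiction; Dec; does)
open import Relation.Nullary.Decidable using (True; toWitness; _×-dec_; ¬?; decidable-stable)

-- The maximum with 1 is forced: if all sets are empty then s · o = 0, and for k ≥ 1 a bound with
-- base 0 would allow no step at all. The factor n m leaves no room for a logarithm: for n = 1 it is
-- m, and a comparison sort of the prices would be too slow, whence the selection in linear time.
-- For b ≥ 2 the levels of the search tree grow geometrically, so all inner nodes together cost no
-- more than a constant times the last level; for b = 1 there would be k + 1 levels of equal cost.
-- Procedures share all registers. The recursion therefore keeps its local values on a stack in
-- memory, and each specification of a procedure includes that `sp` and the cells below it are
-- preserved. Products such as m n and k v arise by repeated addition, within the time allowed.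
-- Complements turn a size u into n - u and a number of occurrences v into m - v; this is where n -
-- s_min and m - o_min come from.

out tmp rn rm matrix sp : Reg
out = 0
tmp = 1
rn = 2
rm = 3
matrix = 4
sp = 5

-- Registers from 6 on serve as loop counters and may be saved on the stack.
budget money caps costs : Reg
budget = 6
money = 7
caps = 8
costs = 9

counter row col best bestRow big item lo flag : Reg
counter = 10
row = 11
col = 12
best = 13
bestRow = 14
big = 15
item = 16
lo = 17
flag = 18

icounter p₁ p₂ acc rx ry rz stride dest : Reg
icounter = 20
p₁ = 21
p₂ = 22
acc = 23
rx = 24
ry = 25
rz = 26
stride = 27
dest = 28

len rank ptr blen brank groups half gcounter : Reg
len = 30
rank = 31
ptr = 32
blen = 33
brank = 34
groups = 35
half = 36
gcounter = 37

-- The programs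

Code : Set
Code = List Instr

block : Code → Cmd 2
block []       = skip
block (i ∷ is) = instr i ⨾ block is

set : Reg → ℕ → Instr
set = _≔_

add sub : Reg → Reg → Reg → Instr
add r a b = r ≔ a ⊞ b
sub r a b = r ≔ a ⊟ b

load store : Reg → Reg → Instr
load r a = r ≔mem[ a ]
store a r = mem[ a ]≔ r

-- Assumes that tmp holds 0.
copy : Reg → Reg → Instr
copy r r′ = add r tmp r′

increment decrement : Reg → Code
increment r = set tmp 1 ∷ add r r tmp ∷ []
decrement r = set tmp 1 ∷ sub r r tmp ∷ []

repeat : Reg → Cmd 2 → Cmd 2
repeat r c = whileNonZero r (c ⨾ block (decrement r))

data Op : Set where
  entry diff meet fixed slack excess below atMost : Op

code : Op → Code
code entry   = []
code diff    = sub rx rx ry ∷ []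
code meet    = add rx rx ry ∷ set tmp 1 ∷ sub rx rx tmp ∷ []
code fixed   = set tmp 0 ∷ copy rx rz ∷ []
code slack   = sub rx rz rx ∷ []
code excess  = sub rx rx rz ∷ []
code below   = sub rx rz rx ∷ set tmp 1 ∷ sub rx tmp rx ∷ sub rx tmp rx ∷ []
code atMost  = sub rx rx rz ∷ set tmp 1 ∷ sub rx tmp rx ∷ []

-- The arguments are the cells at `p₁` and `p₂` and the parameter `rz`. On bits, `meet` is the
-- conjunction. As 1 ∸ (1 ∸ x) is the sign of x, `below` and `atMost` are the indicators of a < c
-- and a ≤ c.
val : Op → ℕ → ℕ → ℕ → ℕ
val entry   a b c = a
val diff    a b c = a ∸ b
val meet    a b c = (a + b) ∸ 1
val fixed   a b c = c
val slack   a b c = c ∸ a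
val excess  a b c = a ∸ c
val below   a b c = 1 ∸ (1 ∸ (c ∸ a))
val atMost  a b c = 1 ∸ (a ∸ c)

sumBody mapBody sumLoop mapLoop : Op → Cmd 2
sumBody o =
    block (load rx p₁ ∷ load ry p₂ ∷ []) ⨾ block (code o)
  ⨾ block (add acc acc rx ∷ add p₁ p₁ stride ∷ increment p₂)
mapBody o =
    block (load rx p₁ ∷ load ry p₂ ∷ []) ⨾ block (code o)
  ⨾ block (store dest rx ∷ increment p₁ ++ increment p₂ ++ increment dest)
sumLoop o = repeat icounter (sumBody o)
mapLoop o = repeat icounter (mapBody o)

pointers : Reg → Reg → Reg → Code
pointers r₁ r₂ l =
  set tmp 0 ∷ copy p₁ r₁ ∷ copy p₂ r₂ ∷ copy icounter l ∷ set acc 0 ∷ set stride 1 ∷ []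

-- out := the value of rank brank among mem[ptr], …, mem[ptr + blen - 1]
brute : Cmd 2
brute = block (set tmp 0 ∷ copy p₁ ptr ∷ copy col ptr ∷ copy counter blen ∷ [])
  ⨾ repeat counter
    ( block (load rz col ∷ pointers ptr ptr blen) ⨾ sumLoop below
    ⨾ block (set tmp 0 ∷ copy lo acc ∷ pointers ptr ptr blen) ⨾ sumLoop atMost
    -- `flag` becomes (#< ∸ k) + (k + 1 ∸ #≤), which vanishes exactly for a candidate of rank k.
    ⨾ block (sub lo lo brank ∷ set tmp 1 ∷ add flag brank tmp ∷ sub flag flag acc ∷ add flag lo flag ∷ [])
    ⨾ ifNonZero flag skip (block (set tmp 0 ∷ copy out rz ∷ []))
    ⨾ block (increment col) )

-- ry := rx div c and rx := rx mod c
divide : ℕ → Cmd 2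
-- With c ∸ 1 in `rz`, `flag` is nonzero exactly while `rx` ≥ c.
divide c = block (set rz (c ∸ 1) ∷ set ry 0 ∷ sub flag rx rz ∷ [])
  ⨾ whileNonZero flag (block (set tmp c ∷ sub rx rx tmp ∷ increment ry ++ sub flag rx rz ∷ []))

-- The array at `sp` is compacted in place: `dest` never overtakes `p₁`, so no cell is overwritten
-- before it is read.
keepBody keepIf : Op → Cmd 2
keepBody o =
    block (set tmp 0 ∷ load rx p₁ ∷ copy ry rx ∷ []) ⨾ block (code o)
  ⨾ ifNonZero rx (block (store dest ry ∷ increment dest)) skip
  ⨾ block (increment p₁)
keepIf o = block (pointers sp sp len ++ set tmp 0 ∷ copy dest sp ∷ [])
  ⨾ repeat icounter (keepBody o)
  ⨾ block (sub len dest sp ∷ [])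

protect₁ : Reg → Cmd 2 → Cmd 2
protect₁ r c = block (store sp r ∷ increment sp) ⨾ c ⨾ block (decrement sp ++ load r sp ∷ [])

protect : List Reg → Cmd 2 → Cmd 2
protect rs c = foldr protect₁ c rs

-- Cell j of the new array at sp becomes the price of set j, or money + 1 if the set does not fit.
fittingBody fitting : Cmd 2
fittingBody =
    block (pointers row caps rn) ⨾ sumLoop diff
  ⨾ block (load item col ∷ [])
  ⨾ ifNonZero acc (block (set tmp 0 ∷ copy item big ∷ [])) skip
  ⨾ block (store dest item ∷ sub flag best item ∷ [])
  ⨾ ifNonZero flag (block (set tmp 0 ∷ copy best item ∷ copy bestRow row ∷ [])) skip
  ⨾ block (increment dest ++ increment col ++ add row row rn ∷ [])
fitting = block (set tmp 0 ∷ copy dest sp ∷ copy col costs ∷ copy row matrix ∷ copy counter rm ∷ copy bestRow matrix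
                 -- Starting at money + 1, `best` is beaten only by affordable prices. If there are
                 -- none, `bestRow` stays at the first row and the scan rejects every candidate.
                 ∷ set tmp 1 ∷ add big money tmp ∷ add best money tmp ∷ [])
  ⨾ repeat counter fittingBody

select search : Fin 2
select = zero
search = suc zero

medians splitStep selectBody branch scanBody searchBody : Cmd 2

-- Replaces each of the first `groups` blocks of five cells by its median, in a new array at sp.
medians = block (set tmp 0 ∷ copy dest sp ∷ copy gcounter groups ∷ [])
  ⨾ repeat gcounter
    (brute ⨾ block (store dest out ∷ increment dest ++ set tmp 5 ∷ add ptr ptr tmp ∷ []))

splitStep = block (sub sp sp len ∷ set tmp 0 ∷ copy rz out ∷ pointers sp sp len) ⨾ sumLoop below
  ⨾ block (set tmp 0 ∷ copy lo acc ∷ pointers sp sp len) ⨾ sumLoop atMost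
  ⨾ block (sub lo lo rank ∷ sub flag acc rank ∷ [])
  -- Nonzero slack marks the cells below the pivot, nonzero excess those above it. If neither side
  -- contains the wanted rank, the pivot is already in `out`.
  ⨾ ifNonZero lo (keepIf slack ⨾ call select)
    (ifNonZero flag skip (block (sub rank rank acc ∷ []) ⨾ keepIf excess ⨾ call select))

selectBody =
    block (set tmp 4 ∷ sub flag len tmp ∷ [])
  ⨾ ifNonZero flag
    ( block (set tmp 0 ∷ copy rx len ∷ []) ⨾ divide 5
    ⨾ block (set tmp 0 ∷ copy groups ry ∷ copy rx ry ∷ []) ⨾ divide 2
    -- Rank 2, counted from 0, is the median of five. The at most four cells after the last full
    -- block take part in the splitting only.
    ⨾ block (set tmp 0 ∷ copy half ry ∷ copy ptr sp ∷ set blen 5 ∷ set brank 2 ∷ add sp sp len ∷ [])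
    ⨾ protect (len ∷ rank ∷ [])
        (medians ⨾ block (set tmp 0 ∷ copy len groups ∷ copy rank half ∷ []) ⨾ call select)
    ⨾ splitStep )
    ( block (set tmp 0 ∷ copy ptr sp ∷ copy blen len ∷ copy brank rank ∷ []) ⨾ brute )

-- counter, row, col, bestRow, budget, money, caps, item and big, as offsets from register 6
branchLocals : List ℕ
branchLocals = 4 ∷ 5 ∷ 6 ∷ 8 ∷ 0 ∷ 1 ∷ 2 ∷ 10 ∷ 9 ∷ []

branch =
    block (pointers caps row rn ++ set tmp 0 ∷ copy dest sp ∷ []) ⨾ mapLoop diff
  -- Marked with `big`, the chosen set cannot be taken again in the subtree; its price is put back
  -- at the end. The child uses the present price array at `sp` - m as its price list, and the
  -- reduced capacities just written at `sp`.
  ⨾ block (store col big ∷ set tmp 0 ∷ copy ry sp ∷ sub rx sp rm ∷ add sp sp rn ∷ [])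
  ⨾ protect (map (6 +_) branchLocals)
      (block (set tmp 0 ∷ copy caps ry ∷ copy costs rx ∷ sub money money item ∷ []) ⨾ call search)
  ⨾ block (sub sp sp rn ∷ store col item ∷ [])

scanBody =
    block (pointers row bestRow rn
           -- `acc` starts as the indicator of `row` = `bestRow`, because an empty cheapest set
           -- shares no element even with itself and must still be a candidate.
           ++ sub rx row bestRow ∷ sub ry bestRow row ∷ add rx rx ry ∷ set tmp 1 ∷ sub acc tmp rx ∷ [])
  ⨾ sumLoop meet
  ⨾ block (load item col ∷ sub flag big item ∷ [])
  ⨾ ifNonZero acc (ifNonZero flag branch skip) skip
  ⨾ block (increment col ++ add row row rn ∷ [])

searchBody = ifNonZero budget
  ( fitting
  ⨾ block (set tmp 0 ∷ copy col sp ∷ copy row matrix ∷ copy counter rm ∷ add sp sp rm ∷ decrement budget)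
  ⨾ repeat counter scanBody
  ⨾ block (sub sp sp rm ∷ []) )
  (block (set out 1 ∷ []))

procs : Fin 2 → Cmd 2
procs zero       = selectBody
procs (suc zero) = searchBody

chooseCheapest solve setup : Cmd 2

chooseCheapest = block (sub flag budget rm ∷ []) ⨾ ifNonZero flag (block (set out 0 ∷ []))
  ( fitting
  -- Selection overwrites its array, so it runs on a copy and the prices survive for the sum of
  -- slacks.
  ⨾ block (pointers sp sp rm ++ add sp sp rm ∷ set tmp 0 ∷ copy dest sp ∷ []) ⨾ mapLoop entry
  ⨾ block (set tmp 0 ∷ copy len rm ∷ set tmp 1 ∷ sub rank budget tmp ∷ []) ⨾ call select
  ⨾ block (sub sp sp rm ∷ set tmp 0 ∷ copy rz out ∷ pointers sp sp rm) ⨾ sumLoop slack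
  -- Without multiplication, k v is the sum of k copies of v; this is linear in m since k ≤ m here.
  ⨾ block (add lo acc money ∷ pointers sp sp budget) ⨾ sumLoop fixed
  ⨾ block (sub acc acc lo ∷ set tmp 1 ∷ sub out tmp acc ∷ []) )

solve = block (set lo 0 ∷ set tmp 0 ∷ copy col matrix ∷ copy counter rn ∷ [])
  ⨾ repeat counter
    -- The matrix is stored row by row, so a stride of n walks down a column.
    ( block (pointers col col rm ++ set tmp 0 ∷ copy stride rn ∷ []) ⨾ sumLoop entry
    -- Each element adds its number of occurrences less one, so `lo` stays 0 iff no element lies in
    -- two sets.
    ⨾ block (set tmp 1 ∷ sub acc acc tmp ∷ add lo lo acc ∷ increment col) )
  ⨾ ifNonZero lo (block (set out 0 ∷ []) ⨾ call search)
    -- For k = 0 there is no k-th smallest price, and the empty selection is a solution.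
    (ifNonZero budget chooseCheapest (block (set out 1 ∷ [])))

setup = block
    ( set tmp 0 ∷ load rn tmp ∷ set tmp 1 ∷ load rm tmp
    ∷ set tmp 2 ∷ load budget tmp ∷ set tmp 3 ∷ load money tmp
    ∷ set caps 4 ∷ add costs caps rn ∷ add matrix costs rm
    ∷ set tmp 0 ∷ copy rz rn ∷ pointers matrix matrix rm )
  -- Adding n to `acc` m times gives the length of the matrix, and with it the first free cell.
  ⨾ sumLoop fixed ⨾ block (add sp matrix acc ∷ [])

capacities demands : Program
capacities = record { arity = 2 ; procs = procs ; main = setup ⨾ solve }
demands = record { arity = 2 ; procs = procs ; main = setup
  -- `flag` carries m n over the next two loops, to be the length of the matrix when it is
  -- complemented.
  ⨾ block (set tmp 0 ∷ copy rz budget ∷ set tmp 0 ∷ copy flag acc ∷ pointers caps caps rn) ⨾ sumLoop excess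
  ⨾ ifNonZero acc (block (set out 0 ∷ []))
    ( block (pointers caps caps rn ++ set tmp 0 ∷ copy dest sp ∷ copy caps sp ∷ []) ⨾ mapLoop slack
    ⨾ block (set rz 1 ∷ pointers matrix matrix flag
             ++ set tmp 0 ∷ add sp sp rn ∷ copy dest sp ∷ copy matrix sp ∷ add sp sp flag ∷ []) ⨾ mapLoop slack
    ⨾ solve ) }

-- Program logic

kept : Fin 2 → Reg → Bool
kept zero       r = (2 ≤ᵇ r) ∧ (r ≤ᵇ 7) ∧ not (r ≡ᵇ sp)
kept (suc zero) r = (2 ≤ᵇ r) ∧ (r ≤ᵇ 4)

writes : Instr → Reg → Bool
writes (r ≔ _)      r′ = r′ ≡ᵇ r
writes (r ≔ _ ⊞ _)  r′ = r′ ≡ᵇ r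
writes (r ≔ _ ⊟ _)  r′ = r′ ≡ᵇ r
writes (r ≔mem[ _ ]) r′ = r′ ≡ᵇ r
writes (mem[ _ ]≔ _) r′ = false

stores : Instr → Bool
stores (mem[ _ ]≔ _) = true
stores _             = false

keeps : Reg → Cmd 2 → Bool
keeps r skip              = true
keeps r (instr i)         = not (writes i r)
keeps r (c ⨾ d)           = keeps r c ∧ keeps r d
keeps r (ifNonZero _ c d) = keeps r c ∧ keeps r d
keeps r (whileNonZero _ c) = keeps r c
keeps r (call f)          = kept f r

readOnly : Cmd 2 → Bool
readOnly skip              = true
readOnly (instr i)         = not (stores i)
readOnly (c ⨾ d)           = readOnly c ∧ readOnly d
readOnly (ifNonZero _ c d) = readOnly c ∧ readOnly d
readOnly (whileNonZero _ c) = readOnly c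
readOnly (call f)          = false

kept-sound : ∀ f r → T (kept f r) → T (keeps r (procs f))
kept-sound zero       2 _ = tt
kept-sound zero       3 _ = tt
kept-sound zero       4 _ = tt
kept-sound zero       6 _ = tt
kept-sound zero       7 _ = tt
kept-sound (suc zero) 2 _ = tt
kept-sound (suc zero) 3 _ = tt
kept-sound (suc zero) 4 _ = tt

T-split : ∀ {a b} → T (a ∧ b) → T a × T b
T-split = Equivalence.to T-∧

instr-keeps : ∀ i {s r} → T (not (writes i r)) → reg (⟦ i ⟧ s) r ≡ reg s r
instr-keeps (r ≔ _)       {r = r′} h with r′ ≡ᵇ r
... | false = refl
instr-keeps (r ≔ _ ⊞ _)   {r = r′} h with r′ ≡ᵇ r
... | false = refl
instr-keeps (r ≔ _ ⊟ _)   {r = r′} h with r′ ≡ᵇ r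
... | false = refl
instr-keeps (r ≔mem[ _ ]) {r = r′} h with r′ ≡ᵇ r
... | false = refl
instr-keeps (mem[ _ ]≔ _) h = refl

instr-readOnly : ∀ i {s} → T (not (stores i)) → mem (⟦ i ⟧ s) ≡ mem s
instr-readOnly (_ ≔ _)       _ = refl
instr-readOnly (_ ≔ _ ⊞ _)   _ = refl
instr-readOnly (_ ≔ _ ⊟ _)   _ = refl
instr-readOnly (_ ≔mem[ _ ]) _ = refl

keeps-sound : ∀ {r c s s′ τ} → procs ⊢ c , s ⇓ s′ ⟨ τ ⟩ → T (keeps r c) → reg s′ r ≡ reg s r
keeps-sound ⇓skip        h = refl
keeps-sound (⇓instr {i}) h = instr-keeps i h
keeps-sound (⇓seq d e)   h =
  trans (keeps-sound e (proj₂ (T-split h))) (keeps-sound d (proj₁ (T-split h)))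
keeps-sound (⇓then _ d)  h = keeps-sound d (proj₁ (T-split h))
keeps-sound (⇓else {x} {c₁} _ d) h = keeps-sound d (proj₂ (T-split {keeps _ c₁} h))
keeps-sound (⇓loop _ d e) h = trans (keeps-sound e h) (keeps-sound d h)
keeps-sound (⇓exit _)    h = refl
keeps-sound (⇓call {f} d) h = keeps-sound d (kept-sound f _ h)

readOnly-sound : ∀ {c s s′ τ} → procs ⊢ c , s ⇓ s′ ⟨ τ ⟩ → T (readOnly c) → mem s′ ≡ mem s
readOnly-sound ⇓skip        h = refl
readOnly-sound (⇓instr {i}) h = instr-readOnly i h
readOnly-sound (⇓seq d e)   h =
  trans (readOnly-sound e (proj₂ (T-split h))) (readOnly-sound d (proj₁ (T-split h)))
readOnly-sound (⇓then _ d)  h = readOnly-sound d (proj₁ (T-split h))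
readOnly-sound (⇓else {x} {c₁} _ d) h = readOnly-sound d (proj₂ (T-split {readOnly c₁} h))
readOnly-sound (⇓loop _ d e) h = trans (readOnly-sound e h) (readOnly-sound d h)
readOnly-sound (⇓exit _)    h = refl

-- For concrete commands and registers the side conditions compute to the unit type, so as implicit
-- arguments they are filled in silently.
record Keeps (c : Cmd 2) (s s′ : State) : Set where
  field
    regs   : ∀ r {_ : T (keeps r c)} → reg s′ r ≡ reg s r
    memory : {_ : T (readOnly c)} → mem s′ ≡ mem s
open Keeps public

run-keeps : ∀ {c s s′ τ} → procs ⊢ c , s ⇓ s′ ⟨ τ ⟩ → Keeps c s s′
run-keeps d .regs r {h} = keeps-sound d h
run-keeps d .memory {h} = readOnly-sound d h

keeps-refl : ∀ {c s} → Keeps c s s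
keeps-refl .regs r = refl
keeps-refl .memory = refl

keeps-trans : ∀ {c s s′ s″} → Keeps c s s′ → Keeps c s′ s″ → Keeps c s s″
keeps-trans k l .regs r {h} = trans (l .regs r {h}) (k .regs r {h})
keeps-trans k l .memory {h} = trans (l .memory {h}) (k .memory {h})

record Runs (c : Cmd 2) (b : ℕ) (Q : State → Set) (s : State) : Set where
  constructor runs
  field
    {final}    : State
    {steps}    : ℕ
    derivation : procs ⊢ c , s ⇓ final ⟨ steps ⟩
    within     : steps ≤ b
    post       : Q final
open Runs public

exec : Code → State → State
exec []       s = s
exec (i ∷ is) s = exec is (⟦ i ⟧ s)

block-run : ∀ is {s} → procs ⊢ block is , s ⇓ exec is s ⟨ suc (length is) ⟩
block-run []       = ⇓skip
block-run (i ∷ is) = ⇓seq ⇓instr (block-run is)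

block-rule : ∀ {s} {Q : State → Set} is → Q (exec is s) → Runs (block is) (suc (length is)) Q s
block-rule is q = runs (block-run is) ≤-refl q

weaken : ∀ {b b′ c s Q} → b ≤ b′ → Runs c b Q s → Runs c b′ Q s
weaken h (runs e w q) = runs e (≤-trans w h) q

-- The continuation also receives `Keeps c s s′`, so the intermediate assertion R need only mention
-- what c changes.
seq : ∀ {b b′ c d s} {Q R : State → Set} → Runs c b R s → (∀ {s′} → Keeps c s s′ → R s′ → Runs d b′ Q s′) → Runs (c ⨾ d) (b + b′) Q s
seq (runs e w r) k = let runs e′ w′ q = k (run-keeps e) r in runs (⇓seq e e′) (+-mono-≤ w w′) q

infixr 3 _∙_
_∙_ : ∀ {b′ d s Q} is → Runs d b′ Q (exec is s) → Runs (block is ⨾ d) (suc (length is) + b′) Q s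
is ∙ runs e w q = runs (⇓seq (block-run is) e) (+-monoʳ-≤ (suc (length is)) w) q

consequence : ∀ {b c s} {Q R : State → Set} → Runs c b R s → (∀ {s′} → Keeps c s s′ → R s′ → Q s′) → Runs c b Q s
consequence (runs e w r) k = runs e w (k (run-keeps e) r)

skip-rule : ∀ {s} {Q : State → Set} → Q s → Runs skip 1 Q s
skip-rule q = runs ⇓skip ≤-refl q

skip-rule≤ : ∀ {b s} {Q : State → Set} → Q s → Runs skip (suc b) Q s
skip-rule≤ q = runs ⇓skip (s≤s z≤n) q

then-rule : ∀ {s c d b Q} r → reg s r ≢ 0 → Runs c b Q s → Runs (ifNonZero r c d) (suc b) Q s
then-rule r h (runs e w q) = runs (⇓then h e) (s≤s w) q

else-rule : ∀ {s c d b Q} r → reg s r ≡ 0 → Runs d b Q s → Runs (ifNonZero r c d) (suc b) Q s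
else-rule r h (runs e w q) = runs (⇓else h e) (s≤s w) q

if-same : ∀ {s c d b Q} r → (reg s r ≢ 0 → Runs c b Q s) → (reg s r ≡ 0 → Runs d b Q s) →
          Runs (ifNonZero r c d) (suc b) Q s
if-same {s = s} r f g with reg s r ≟ 0
... | yes h = else-rule r h (g h)
... | no  h = then-rule r h (f h)

if-rule : ∀ {s c d b b′ Q} r → (reg s r ≢ 0 → Runs c b Q s) → (reg s r ≡ 0 → Runs d b′ Q s) →
          Runs (ifNonZero r c d) (suc (b + b′)) Q s
if-rule {b = b} {b′} r f g = if-same r (weaken (m≤m+n b b′) ∘ f) (weaken (m≤n+m b′ b) ∘ g)

call-rule : ∀ {b s Q} f → Runs (procs f) b Q s → Runs (call f) (suc b) Q s
call-rule f (runs e w q) = runs (⇓call e) (s≤s w) q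

-- Loops and their cost

Σ< : ℕ → (ℕ → ℕ) → ℕ
Σ< zero    f = 0
Σ< (suc n) f = Σ< n f + f n

≡ᵇ-refl : ∀ n → (n ≡ᵇ n) ≡ true
≡ᵇ-refl zero    = refl
≡ᵇ-refl (suc n) = ≡ᵇ-refl n

private
  -- A loop unrolls at its first round while `Σ<` splits off its last term; this sum from the front
  -- mediates.
  costFrom : (ℕ → ℕ) → ℕ → ℕ → ℕ
  costFrom w i zero    = 0
  costFrom w i (suc l) = w i + costFrom w (suc i) l

  costFrom-Σ : ∀ w i l → Σ< i w + costFrom w i l ≡ Σ< (i + l) w
  costFrom-Σ w i zero    = trans (+-identityʳ _) (cong (λ k → Σ< k w) (sym (+-identityʳ i)))
  costFrom-Σ w i (suc l) = begin
    Σ< i w + (w i + costFrom w (suc i) l) ≡⟨ sym (+-assoc (Σ< i w) (w i) _) ⟩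
    Σ< (suc i) w + costFrom w (suc i) l  ≡⟨ costFrom-Σ w (suc i) l ⟩
    Σ< (suc i + l) w  ≡⟨ cong (λ k → Σ< k w) (sym (+-suc i l)) ⟩
    Σ< (i + suc l) w  ∎
    where open ≡-Reasoning

  -- The form `6 + r` makes the comparison with `tmp` compute for a variable r, leaving only r
  -- against itself.
  decremented : ∀ r s → reg (exec (decrement (6 + r)) s) (6 + r) ≡ reg s (6 + r) ∸ 1
  decremented r s rewrite ≡ᵇ-refl r = refl

  iterate : ∀ {r c} (I : ℕ → State → Set) (w : ℕ → ℕ) s N →
    (∀ i {s′} → i < N → Keeps (repeat (6 + r) c) s s′ → I i s′ →
      Runs c (w i) (λ s″ → I (suc i) (exec (decrement (6 + r)) s″) × reg s″ (6 + r) ≡ reg s′ (6 + r)) s′) →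
    ∀ i l {s′} → i + l ≡ N → reg s′ (6 + r) ≡ l → Keeps (repeat (6 + r) c) s s′ → I i s′ →
    -- A round adds 3 steps for the decrement and 1 for the test; the leading `suc` pays for the
    -- final, failing test.
    Runs (repeat (6 + r) c) (suc (costFrom (λ j → w j + 4) i l)) (I N) s′
  iterate I w s N step i zero e h κ p rewrite +-identityʳ i | e = runs (⇓exit h) (s≤s z≤n) p
  iterate {r} {c} I w s N step i (suc l) {s′} e h κ p = runs
    (⇓loop nz body (rest .derivation))
    (s≤s (≤-trans (+-mono-≤ (+-monoˡ-≤ 3 (B .within)) (rest .within)) (≤-reflexive shuffle)))
    (rest .post)
    where
    nz : reg s′ (6 + r) ≢ 0
    nz z = 0≢1+n (trans (sym z) h)
    B = step i (subst (i <_) e (m<m+n i (s≤s z≤n))) κ p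
    body = ⇓seq (B .derivation) (block-run (decrement (6 + r)))
    κ′ = keeps-trans κ (record { regs = λ j {t} → keeps-sound body t ; memory = λ {t} → readOnly-sound body t })
    h′ : reg (exec (decrement (6 + r)) (B .final)) (6 + r) ≡ l
    h′ = trans (decremented r (B .final)) (cong (_∸ 1) (trans (proj₂ (B .post)) h))
    rest = iterate I w s N step (suc i) l (trans (sym (+-suc i l)) e) h′ κ′ (proj₁ (B .post))
    open ≡-Reasoning
    F = costFrom (λ j → w j + 4) (suc i) l
    shuffle : w i + 3 + suc F ≡ w i + 4 + F
    shuffle = begin
      w i + 3 + suc F  ≡⟨ +-suc (w i + 3) F ⟩
      suc (w i + 3) + F ≡⟨ cong (_+ F) (sym (+-suc (w i) 3)) ⟩
      w i + 4 + F  ∎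

-- For bodies that restore the loop counter from the stack.
repeat-restoring : ∀ {r c s} (I : ℕ → State → Set) (w : ℕ → ℕ) N →
  reg s (6 + r) ≡ N → I 0 s →
  (∀ i {s′} → i < N → Keeps (repeat (6 + r) c) s s′ → I i s′ →
    Runs c (w i) (λ s″ → I (suc i) (exec (decrement (6 + r)) s″) × reg s″ (6 + r) ≡ reg s′ (6 + r)) s′) →
  Runs (repeat (6 + r) c) (suc (Σ< N (λ i → w i + 4))) (I N) s
repeat-restoring {s = s} I w N h p step =
  weaken (s≤s (≤-reflexive (costFrom-Σ (λ j → w j + 4) 0 N)))
    (iterate I w s N step 0 N refl h keeps-refl p)

repeat-rule : ∀ {r c s} (I : ℕ → State → Set) (w : ℕ → ℕ) N → {_ : T (keeps (6 + r) c)} →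
  reg s (6 + r) ≡ N → I 0 s →
  (∀ i {s′} → i < N → Keeps (repeat (6 + r) c) s s′ → I i s′ →
    Runs c (w i) (λ s″ → I (suc i) (exec (decrement (6 + r)) s″)) s′) →
  Runs (repeat (6 + r) c) (suc (Σ< N (λ i → w i + 4))) (I N) s
repeat-rule {r} I w N {k} h p step = repeat-restoring I w N h p λ i lt κ q →
  consequence (step i lt κ q) λ κ′ q′ → q′ , κ′ .regs (6 + r) {k}

Σ-const : ∀ n w → Σ< n (λ _ → w) ≡ n * w
Σ-const zero    w = refl
Σ-const (suc n) w = trans (cong (_+ w) (Σ-const n w)) (+-comm (n * w) w)

uniform : ∀ {c Q s} N w → Runs c (suc (Σ< N (λ _ → w))) Q s → Runs c (suc (N * w)) Q s
uniform N w = weaken (s≤s (≤-reflexive (Σ-const N w)))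

-- Array operations

code-val : ∀ o s → reg (exec (code o) s) rx ≡ val o (reg s rx) (reg s ry) (reg s rz)
code-val entry   s = refl
code-val diff    s = refl
code-val meet    s = refl
code-val fixed   s = refl
code-val slack   s = refl
code-val excess  s = refl
code-val below   s = refl
code-val atMost  s = refl

code-mem : ∀ o s → mem (exec (code o) s) ≡ mem s
code-mem entry   s = refl
code-mem diff    s = refl
code-mem meet    s = refl
code-mem fixed   s = refl
code-mem slack   s = refl
code-mem excess  s = refl
code-mem below   s = refl
code-mem atMost  s = refl

code-keeps : ∀ o {r} {_ : T (not (r ≡ᵇ rx) ∧ not (r ≡ᵇ tmp))} → T (keeps r (block (code o)))
code-keeps o {r} {h} = check o (r ≡ᵇ rx) (r ≡ᵇ tmp) h refl refl
  where
  check : ∀ o u v → T (not u ∧ not v) → (r ≡ᵇ rx) ≡ u → (r ≡ᵇ tmp) ≡ v → T (keeps r (block (code o)))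
  check entry   false false _ _ _ = tt
  check diff    false false _ e _ rewrite e = tt
  check meet    false false _ e f rewrite e | f = tt
  check fixed   false false _ e f rewrite e | f = tt
  check slack   false false _ e _ rewrite e = tt
  check excess  false false _ e _ rewrite e = tt
  check below   false false _ e f rewrite e | f = tt
  check atMost  false false _ e f rewrite e | f = tt

code-reg : ∀ o {s} r {_ : T (not (r ≡ᵇ rx) ∧ not (r ≡ᵇ tmp))} → reg (exec (code o) s) r ≡ reg s r
code-reg o r {h} = keeps-sound (block-run (code o)) (code-keeps o {r} {h})

code-length : ∀ o → length (code o) ≤ 4
code-length entry   = z≤n
code-length diff    = s≤s z≤n
code-length meet    = s≤s (s≤s (s≤s z≤n))
code-length fixed   = s≤s (s≤s z≤n)
code-length slack   = s≤s z≤n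
code-length excess  = s≤s z≤n
code-length below   = s≤s (s≤s (s≤s (s≤s z≤n)))
code-length atMost  = s≤s (s≤s (s≤s z≤n))

-- These conditions compute only once o is a constructor, hence the enumeration.
sum-static : ∀ o → T (keeps icounter (sumBody o)) × T (keeps stride (sumLoop o)) ×
             T (keeps rz (sumLoop o)) × T (readOnly (sumLoop o))
sum-static entry   = _
sum-static diff    = _
sum-static meet    = _
sum-static fixed   = _
sum-static slack   = _
sum-static excess  = _
sum-static below   = _
sum-static atMost  = _

map-static : ∀ o → T (keeps icounter (mapBody o)) × T (keeps rz (mapLoop o))
map-static entry   = _
map-static diff    = _
map-static meet    = _
map-static fixed   = _
map-static slack   = _
map-static excess  = _
map-static below   = _
map-static atMost  = _

-- 17 steps suffice for the body of `sumLoop` or `mapLoop`, whose operation has at most four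
-- instructions; 4 more go to the counter and the test.
loopCost : ℕ → ℕ
loopCost n = suc (n * 21)

+-next : ∀ {v} a i → v ≡ a + i → v + 1 ≡ a + suc i
+-next a i e = trans (cong (_+ 1) e) (trans (+-assoc a i 1) (cong (a +_) (+-comm i 1)))

sum-strided : ∀ {s} o N → reg s icounter ≡ N →
  Runs (sumLoop o) (loopCost N)
    (λ s′ → reg s′ acc ≡ reg s acc + Σ< N (λ i →
      val o (mem s (reg s p₁ + i * reg s stride)) (mem s (reg s p₂ + i)) (reg s rz))) s
sum-strided {s} o N h = uniform N 21 (consequence
  (repeat-rule I (λ _ → 17) N {proj₁ (sum-static o)} h
    (sym (+-identityʳ _) , sym (+-identityʳ _) , sym (+-identityʳ _)) step)
  (λ _ → proj₁))
  where
  f : ℕ → ℕ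
  f i = val o (mem s (reg s p₁ + i * reg s stride)) (mem s (reg s p₂ + i)) (reg s rz)
  I : ℕ → State → Set
  I i s′ = reg s′ acc ≡ reg s acc + Σ< i f × reg s′ p₁ ≡ reg s p₁ + i * reg s stride × reg s′ p₂ ≡ reg s p₂ + i
  step : ∀ i {s′} → i < N → Keeps (sumLoop o) s s′ → I i s′ →
         Runs (sumBody o) 17 (λ s″ → I (suc i) (exec (decrement icounter) s″)) s′
  step i {s′} _ κ (e₀ , e₁ , e₂) = weaken (+-monoʳ-≤ 3 (+-mono-≤ (s≤s (code-length o)) (m≤m+n 5 4)))
    ( load rx p₁ ∷ load ry p₂ ∷ [] ∙ code o ∙ block-rule (add acc acc rx ∷ add p₁ p₁ stride ∷ increment p₂)
      ( trans (cong₂ _+_ (trans (code-reg o acc) e₀) value) (+-assoc (reg s acc) _ _)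
      , trans (cong₂ _+_ (trans (code-reg o p₁) e₁)
                         (trans (code-reg o stride) (κ .regs stride {proj₁ (proj₂ (sum-static o))})))
              (trans (+-assoc (reg s p₁) _ _) (cong (reg s p₁ +_) (+-comm (i * reg s stride) _)))
      , +-next (reg s p₂) i (trans (code-reg o p₂) e₂)))
    where
    m≡ : mem s′ ≡ mem s
    m≡ = κ .memory {proj₂ (proj₂ (proj₂ (sum-static o)))}
    value : reg (exec (code o) (exec (load rx p₁ ∷ load ry p₂ ∷ []) s′)) rx ≡ f i
    value = trans (code-val o _) (cong₃ (val o) (cong₂ (λ h a → h a) m≡ e₁) (cong₂ (λ h a → h a) m≡ e₂)
                    (κ .regs rz {proj₁ (proj₂ (proj₂ (sum-static o)))}))
      where
      cong₃ : ∀ {a a′ b b′ c c′} (f : ℕ → ℕ → ℕ → ℕ) → a ≡ a′ → b ≡ b′ → c ≡ c′ → f a b c ≡ f a′ b′ c′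
      cong₃ f refl refl refl = refl

Σ-cong : ∀ n {f g : ℕ → ℕ} → (∀ {i} → i < n → f i ≡ g i) → Σ< n f ≡ Σ< n g
Σ-cong zero    h = refl
Σ-cong (suc n) h = cong₂ _+_ (Σ-cong n (λ lt → h (m<n⇒m<1+n lt))) (h (n<1+n n))

total : Op → (ℕ → ℕ) → ℕ → ℕ → ℕ → ℕ → ℕ
total o h a b v n = Σ< n (λ i → val o (h (a + i)) (h (b + i)) v)

total-cong : ∀ o n {h h′ a a′ b b′ v v′} → h ≡ h′ → a ≡ a′ → b ≡ b′ → v ≡ v′ →
             total o h a b v n ≡ total o h′ a′ b′ v′ n
total-cong o n refl refl refl refl = refl

sum-rule : ∀ {s} o N → reg s icounter ≡ N → reg s stride ≡ 1 →
  Runs (sumLoop o) (loopCost N)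
    (λ s′ → reg s′ acc ≡ reg s acc + total o (mem s) (reg s p₁) (reg s p₂) (reg s rz) N) s
sum-rule {s} o N h u = consequence (sum-strided o N h) λ _ e →
  trans e (cong (reg s acc +_) (Σ-cong N λ {i} _ →
    cong (λ k → val o (mem s (reg s p₁ + k)) (mem s (reg s p₂ + i)) (reg s rz))
         (trans (cong (i *_) u) (*-identityʳ i))))

≡ᵇ-≢ : ∀ {m n} → m ≢ n → (m ≡ᵇ n) ≡ false
≡ᵇ-≢ {m} {n} h with m ≡ᵇ n in e
... | true  = contradiction (≡ᵇ⇒≡ m n (subst T (sym e) tt)) h
... | false = refl

update-same : ∀ (f : ℕ → ℕ) a {v} → (f [ a ↦ v ]) a ≡ v
update-same f a rewrite ≡ᵇ-refl a = refl

update-other : ∀ (f : ℕ → ℕ) {a v i} → i ≢ a → (f [ a ↦ v ]) i ≡ f i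
update-other f h rewrite ≡ᵇ-≢ h = refl

_agrees_below_ : State → State → ℕ → Set
s′ agrees s below a = ∀ {i} → i < a → mem s′ i ≡ mem s i

map-rule : ∀ {s} o N → reg s icounter ≡ N → reg s p₁ + N ≤ reg s dest → reg s p₂ + N ≤ reg s dest →
  Runs (mapLoop o) (loopCost N)
    (λ s′ → s′ agrees s below reg s dest × (∀ {i} → i < N → mem s′ (reg s dest + i) ≡
      val o (mem s (reg s p₁ + i)) (mem s (reg s p₂ + i)) (reg s rz))) s
map-rule {s} o N h h₁ h₂ = uniform N 21 (consequence
  (repeat-rule I (λ _ → 17) N {proj₁ (map-static o)} h
    ((λ _ → refl) , (λ ()) , sym (+-identityʳ _) , sym (+-identityʳ _) , sym (+-identityʳ _)) step)
  (λ _ (e , e′ , _) → e , e′))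
  where
  f : ℕ → ℕ
  f i = val o (mem s (reg s p₁ + i)) (mem s (reg s p₂ + i)) (reg s rz)
  D = reg s dest
  I : ℕ → State → Set
  I i s′ = s′ agrees s below D × (∀ {j} → j < i → mem s′ (D + j) ≡ f j) ×
           reg s′ p₁ ≡ reg s p₁ + i × reg s′ p₂ ≡ reg s p₂ + i × reg s′ dest ≡ D + i
  step : ∀ i {s′} → i < N → Keeps (mapLoop o) s s′ → I i s′ →
         Runs (mapBody o) 17 (λ s″ → I (suc i) (exec (decrement icounter) s″)) s′
  step i {s′} lt κ (eb , ed , e₁ , e₂ , e₃) = weaken (+-monoʳ-≤ 3 (+-mono-≤ (s≤s (code-length o)) (m≤m+n 8 1)))
    ( load rx p₁ ∷ load ry p₂ ∷ [] ∙ code o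
    ∙ block-rule (store dest rx ∷ increment p₁ ++ increment p₂ ++ increment dest)
      ( (λ {j} l → trans (stored (<⇒≢ (<-≤-trans l (m≤m+n D i)))) (eb l))
      , (λ {j} l → case m≤n⇒m<n∨m≡n (s≤s⁻¹ l) of λ where
          (inj₁ l′)   → trans (stored (λ q → <⇒≢ l′ (+-cancelˡ-≡ D _ _ q))) (ed l′)
          (inj₂ refl) → trans (cong (λ a → mem s₃ a) (sym dest≡)) (trans (update-same (mem s₂) (reg s₂ dest)) value))
      , +-next _ i (trans (code-reg o p₁) e₁) , +-next _ i (trans (code-reg o p₂) e₂) , +-next _ i dest≡ ))
    where
    s₂ = exec (code o) (exec (load rx p₁ ∷ load ry p₂ ∷ []) s′)
    s₃ = ⟦ store dest rx ⟧ s₂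
    dest≡ : reg s₂ dest ≡ D + i
    dest≡ = trans (code-reg o dest) e₃
    stored : ∀ {a} → a ≢ D + i → mem s₃ a ≡ mem s′ a
    stored {a} ne = trans (update-other (mem s₂) (λ q → ne (trans q dest≡))) (cong (λ h → h a) (code-mem o _))
    read : ∀ {p} q → p ≡ q + i → q + N ≤ D → mem s′ p ≡ mem s (q + i)
    read q refl l = eb (<-≤-trans (+-monoʳ-< q lt) l)
    value : reg s₂ rx ≡ f i
    value = trans (code-val o _) (trans (cong₂ (λ v w → val o v w (reg s′ rz)) (read (reg s p₁) e₁ h₁) (read (reg s p₂) e₂ h₂))
              (cong (val o _ _) (κ .regs rz {proj₂ (map-static o)})))

-- Finite sums and ranks

Σ-mono : ∀ n {f g : ℕ → ℕ} → (∀ {i} → i < n → f i ≤ g i) → Σ< n f ≤ Σ< n g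
Σ-mono zero    h = z≤n
Σ-mono (suc n) h = +-mono-≤ (Σ-mono n (λ l → h (m<n⇒m<1+n l))) (h (n<1+n n))

Σ-+ : ∀ n (f g : ℕ → ℕ) → Σ< n (λ i → f i + g i) ≡ Σ< n f + Σ< n g
Σ-+ zero    f g = refl
Σ-+ (suc n) f g = trans (cong (_+ (f n + g n)) (Σ-+ n f g)) (shuffle (Σ< n f) (Σ< n g) (f n) (g n))
  where
  shuffle : ∀ a b c d → (a + b) + (c + d) ≡ (a + c) + (b + d)
  shuffle = solve-∀

Σ-* : ∀ n a (f : ℕ → ℕ) → Σ< n (λ i → a * f i) ≡ a * Σ< n f
Σ-* zero    a f = sym (*-zeroʳ a)
Σ-* (suc n) a f = trans (cong (_+ a * f n) (Σ-* n a f)) (sym (*-distribˡ-+ a (Σ< n f) (f n)))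

Σ-zero : ∀ n {f : ℕ → ℕ} → (∀ {i} → i < n → f i ≡ 0) → Σ< n f ≡ 0
Σ-zero n h = trans (Σ-cong n h) (trans (Σ-const n 0) (*-zeroʳ n))

Σ-one : ∀ n → Σ< n (λ _ → 1) ≡ n
Σ-one n = trans (Σ-const n 1) (*-identityʳ n)

Σ-split : ∀ m n (f : ℕ → ℕ) → Σ< (m + n) f ≡ Σ< m f + Σ< n (λ i → f (m + i))
Σ-split m zero    f rewrite +-identityʳ m = sym (+-identityʳ _)
Σ-split m (suc n) f rewrite +-suc m n | Σ-split m n f = +-assoc (Σ< m f) _ _

Σ-term : ∀ n (f : ℕ → ℕ) {i} → i < n → f i ≤ Σ< n f
Σ-term (suc n) f l with m≤n⇒m<n∨m≡n (s≤s⁻¹ l)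
... | inj₁ l′   = ≤-trans (Σ-term n f l′) (m≤m+n _ _)
... | inj₂ refl = m≤n+m _ _

Σ-swap : ∀ m n (f : ℕ → ℕ → ℕ) → Σ< m (λ i → Σ< n (f i)) ≡ Σ< n (λ j → Σ< m (λ i → f i j))
Σ-swap zero    n f = sym (Σ-zero n λ _ → refl)
Σ-swap (suc m) n f = trans (cong (_+ Σ< n (f m)) (Σ-swap m n f)) (sym (Σ-+ n _ (f m)))

Σ-strict : ∀ n {f g : ℕ → ℕ} → Σ< n f < Σ< n g → ∃[ i ] (i < n × f i < g i)
Σ-strict (suc n) {f} {g} h with f n <? g n
... | yes l = n , n<1+n n , l
... | no  l with Σ-strict n {f} {g} (+-cancelʳ-< (g n) _ _ (≤-<-trans (+-monoʳ-≤ (Σ< n f) (≮⇒≥ l)) h))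
...   | i , i<n , l′ = i , m<n⇒m<1+n i<n , l′

Σ-positive : ∀ n (f : ℕ → ℕ) → 0 < Σ< n f → ∃[ i ] (i < n × 0 < f i)
Σ-positive n f h = Σ-strict n {λ _ → 0} {f} (≤-trans (s≤s (≤-reflexive (Σ-zero n λ _ → refl))) h)

-- Indicators in the arithmetic of the machine.
sign : ℕ → ℕ
sign a = 1 ∸ (1 ∸ a)

lt le : ℕ → ℕ → ℕ
lt a v = sign (v ∸ a)
le a v = 1 ∸ (a ∸ v)

sign-pos : ∀ {a} → a ≢ 0 → sign a ≡ 1
sign-pos {zero}  h = contradiction refl h
sign-pos {suc a} h = cong (1 ∸_) (0∸n≡0 a)

lt-yes : ∀ {a v} → a < v → lt a v ≡ 1
lt-yes h = sign-pos (m>n⇒m∸n≢0 h)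

lt-no : ∀ {a v} → v ≤ a → lt a v ≡ 0
lt-no h rewrite m≤n⇒m∸n≡0 h = refl

le-yes : ∀ {a v} → a ≤ v → le a v ≡ 1
le-yes h rewrite m≤n⇒m∸n≡0 h = refl

le-no : ∀ {a v} → v < a → le a v ≡ 0
le-no {a} {v} h with a ∸ v | m<n⇒0<n∸m h
... | suc d | _ = 0∸n≡0 d

lt-≤1 : ∀ a v → lt a v ≤ 1
lt-≤1 a v = m∸n≤m 1 (1 ∸ (v ∸ a))

le-≤1 : ∀ a v → le a v ≤ 1
le-≤1 a v = m∸n≤m 1 (a ∸ v)

lt+ge : ∀ a v → lt a (suc v) ≡ le a v
lt+ge a v with <-≤-connex v a
... | inj₁ h = trans (lt-no h) (sym (le-no h))
... | inj₂ h = trans (lt-yes (s≤s h)) (sym (le-yes h))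

#< #≤ : (ℕ → ℕ) → ℕ → ℕ → ℕ
#< f n v = Σ< n (λ i → lt (f i) v)
#≤ f n v = Σ< n (λ i → le (f i) v)

-- v is the value at position k (counted from 0) of f 0, …, f (n - 1) in sorted order.
record Rank (f : ℕ → ℕ) (n k v : ℕ) : Set where
  constructor ranked
  field
    lower : #< f n v ≤ k
    upper : k < #≤ f n v

-- Lower v from the sum of all f i, where every value counts as ≤ v, to the least v with k < #≤.
-- Then #< at v is the count #≤ at v - 1, hence at most k, and #< < #≤ forces some value to equal v.
rank-exists : ∀ f n k → k < n → ∃[ i ] (i < n × Rank f n k (f i))
rank-exists f n k k<n = let v , l , u = least (Σ< n f) (subst (k <_) (sym full) k<n)
                            i , i<n , e = Σ-strict n (≤-<-trans l u)
                        in i , i<n , subst (Rank f n k) (sym (between (f i) v e)) (ranked l u)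
  where
  full : #≤ f n (Σ< n f) ≡ n
  full = trans (Σ-cong n λ l → le-yes (Σ-term n f l)) (Σ-one n)
  least : ∀ V → k < #≤ f n V → ∃[ v ] (#< f n v ≤ k × k < #≤ f n v)
  least zero    h = 0 , ≤-trans (≤-reflexive (Σ-zero n λ {i} _ → lt-no {f i} z≤n)) z≤n , h
  least (suc V) h with k <? #≤ f n V
  ... | yes h′ = least V h′
  ... | no  h′ = suc V , ≤-trans (≤-reflexive (Σ-cong n λ {i} _ → lt+ge (f i) V)) (≮⇒≥ h′) , h
  between : ∀ a v → lt a v < le a v → a ≡ v
  between a v h with <-cmp a v
  ... | tri< l _ _ = contradiction (subst (_< le a v) (lt-yes l) h) (≤⇒≯ (le-≤1 a v))
  ... | tri≈ _ e _ = e
  ... | tri> _ _ l = contradiction (subst (lt a v <_) (le-no l) h) λ ()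

module _ {f g : ℕ → ℕ} {n n′ p : ℕ} where

  -- Equality of sums under all weights w says that g lists the values of f below p with
  -- multiplicity, without naming a bijection; indicators as weights transfer the counts. The case v
  -- > p is impossible: all n′ values of g would be below v, so n′ ≤ k < n′.
  rank-below : (∀ w → Σ< n′ (w ∘ g) ≡ Σ< n (λ i → lt (f i) p * w (f i))) →
               ∀ {k v} → Rank g n′ k v → Rank f n k v
  rank-below h {k} {v} (ranked l u) with v ≤? p
  ... | yes v≤p = ranked
        (≤-trans (≤-reflexive (trans (Σ-cong n λ {i} _ → absorb (f i)) (sym (h (λ a → lt a v))))) l)
        (≤-trans u (≤-trans (≤-reflexive (h (λ a → le a v))) (Σ-mono n λ {i} _ → drop (f i))))
    where
    absorb : ∀ a → lt a v ≡ lt a p * lt a v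
    absorb a with a <? v
    ... | yes l rewrite lt-yes (<-≤-trans l v≤p) = sym (+-identityʳ _)
    ... | no  l rewrite lt-no (≮⇒≥ l) = sym (*-zeroʳ (lt a p))
    drop : ∀ a → lt a p * le a v ≤ le a v
    drop a = ≤-trans (*-monoˡ-≤ (le a v) (lt-≤1 a p)) (≤-reflexive (+-identityʳ _))
  ... | no  v≰p = contradiction (≤-trans (≤-trans u (Σ-mono n′ λ {i} _ → le-≤1 (g i) v)) (≤-trans (≤-reflexive all) l)) (<-irrefl refl)
    where
    all : Σ< n′ (λ _ → 1) ≡ #< g n′ v
    all = trans (h (λ _ → 1)) (trans (Σ-cong n λ {i} _ → small (f i)) (sym (h (λ a → lt a v))))
      where
      small : ∀ a → lt a p * 1 ≡ lt a p * lt a v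
      small a with a <? p
      ... | yes l rewrite lt-yes (<-trans l (≰⇒> v≰p)) = refl
      ... | no  l rewrite lt-no (≮⇒≥ l) = refl

  -- The values ≤ p, which are missing from g, all precede v and account for the shift of the rank.
  rank-above : (∀ w → Σ< n′ (w ∘ g) ≡ Σ< n (λ i → sign (f i ∸ p) * w (f i))) →
               ∀ {k v} → #≤ f n p ≤ k → Rank g n′ (k ∸ #≤ f n p) v → Rank f n k v
  rank-above h {k} {v} E≤k (ranked l u) = ranked
    (begin
      #< f n v  ≤⟨ Σ-mono n (λ {i} _ → split (f i)) ⟩
      Σ< n (λ i → le (f i) p + sign (f i ∸ p) * lt (f i) v)  ≡⟨ Σ-+ n _ _ ⟩
      #≤ f n p + Σ< n (λ i → sign (f i ∸ p) * lt (f i) v)  ≡⟨ cong (#≤ f n p +_) (sym (h (λ a → lt a v))) ⟩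
      #≤ f n p + #< g n′ v  ≤⟨ +-monoʳ-≤ (#≤ f n p) l ⟩
      #≤ f n p + (k ∸ #≤ f n p)  ≡⟨ m+[n∸m]≡n E≤k ⟩
      k ∎)
    (begin-strict
      k  ≡⟨ sym (m+[n∸m]≡n E≤k) ⟩
      #≤ f n p + (k ∸ #≤ f n p)  <⟨ +-monoʳ-< (#≤ f n p) u ⟩
      #≤ f n p + #≤ g n′ v  ≡⟨ cong (#≤ f n p +_) (h (λ a → le a v)) ⟩
      #≤ f n p + Σ< n (λ i → sign (f i ∸ p) * le (f i) v)  ≡⟨ sym (Σ-+ n _ _) ⟩
      Σ< n (λ i → le (f i) p + sign (f i ∸ p) * le (f i) v) ≤⟨ Σ-mono n (λ {i} _ → join (f i)) ⟩
      #≤ f n v ∎)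
    where
    open ≤-Reasoning
    split : ∀ a → lt a v ≤ le a p + sign (a ∸ p) * lt a v
    split a with a ≤? p
    ... | yes le₁ rewrite le-yes le₁ = ≤-trans (lt-≤1 a v) (s≤s z≤n)
    ... | no  nle rewrite sign-pos (m>n⇒m∸n≢0 (≰⇒> nle)) = ≤-trans (≤-reflexive (sym (+-identityʳ _))) (m≤n+m _ (le a p))
    -- For v ≤ p no value of g would be ≤ v, although the upper bound of its rank demands one.
    p<v : p < v
    p<v = ≰⇒> λ v≤p → contradiction (≤-trans u (≤-reflexive (trans (h (λ a → le a v)) (Σ-zero n λ {i} _ → none v≤p (f i))))) λ ()
      where
      none : v ≤ p → ∀ a → sign (a ∸ p) * le a v ≡ 0
      none v≤p a with a ≤? p
      ... | yes l rewrite m≤n⇒m∸n≡0 l = refl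
      ... | no  l rewrite le-no (≤-<-trans v≤p (≰⇒> l)) = *-zeroʳ (sign (a ∸ p))
    join : ∀ a → le a p + sign (a ∸ p) * le a v ≤ le a v
    join a with a ≤? p
    ... | yes l rewrite m≤n⇒m∸n≡0 l | le-yes (≤-trans l (<⇒≤ p<v)) = ≤-refl
    ... | no  l rewrite le-no (≰⇒> l) = ≤-reflexive (+-identityʳ _)

le+gt : ∀ a p → le a p + sign (a ∸ p) ≡ 1
le+gt a p with a ≤? p
... | yes l rewrite m≤n⇒m∸n≡0 l = refl
... | no  l rewrite le-no (≰⇒> l) = refl

-- At least three cells of a block of five are ≤ (≥) its median μ.
module _ {f μ : ℕ → ℕ} where

  Medians : ℕ → Set
  Medians g = ∀ {l} → l < g → Rank (λ i → f (l * 5 + i)) 5 2 (μ l)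

  private
    block-split : ∀ g (w : ℕ → ℕ) → Σ< (suc g * 5) w ≡ Σ< (g * 5) w + Σ< 5 (λ i → w (g * 5 + i))
    block-split g w = trans (cong (λ k → Σ< k w) (+-comm 5 (g * 5))) (Σ-split (g * 5) 5 w)

  -- A block has at most 2 cells below p if its median is ≥ p, and at most 2 + 3 otherwise.
  medians-below : ∀ g p → Medians g → #< f (g * 5) p ≤ 2 * g + 3 * #< μ g p
  medians-below zero    p h = z≤n
  medians-below (suc g) p h = begin
    #< f (suc g * 5) p  ≡⟨ block-split g (λ i → lt (f i) p) ⟩
    #< f (g * 5) p + #< (λ i → f (g * 5 + i)) 5 p  ≤⟨ +-mono-≤ (medians-below g p (λ l → h (m<n⇒m<1+n l))) one ⟩
    (2 * g + 3 * #< μ g p) + (2 + 3 * lt (μ g) p)  ≡⟨ shuffle g (#< μ g p) (lt (μ g) p) ⟩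
    2 * suc g + 3 * #< μ (suc g) p  ∎
    where
    open ≤-Reasoning
    shuffle : ∀ g a b → (2 * g + 3 * a) + (2 + 3 * b) ≡ 2 * (1 + g) + 3 * (a + b)
    shuffle = solve-∀
    one : #< (λ i → f (g * 5 + i)) 5 p ≤ 2 + 3 * lt (μ g) p
    one with μ g <? p
    ... | yes l rewrite lt-yes l = Σ-mono 5 λ {i} _ → lt-≤1 (f (g * 5 + i)) p
    ... | no  l rewrite lt-no (≮⇒≥ l) = ≤-trans (Σ-mono 5 λ {i} _ → mono (f (g * 5 + i))) (Rank.lower (h (n<1+n g)))
      where
      mono : ∀ a → lt a p ≤ lt a (μ g)
      mono a with a <? p
      ... | yes l′ rewrite lt-yes (<-≤-trans l′ (≮⇒≥ l)) = lt-≤1 a p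
      ... | no  l′ rewrite lt-no (≮⇒≥ l′) = z≤n

  medians-above : ∀ g p → Medians g → 3 * #≤ μ g p ≤ #≤ f (g * 5) p
  medians-above zero    p h = z≤n
  medians-above (suc g) p h = begin
    3 * #≤ μ (suc g) p  ≡⟨ *-distribˡ-+ 3 (#≤ μ g p) _ ⟩
    3 * #≤ μ g p + 3 * le (μ g) p  ≤⟨ +-mono-≤ (medians-above g p (λ l → h (m<n⇒m<1+n l))) one ⟩
    #≤ f (g * 5) p + #≤ (λ i → f (g * 5 + i)) 5 p  ≡⟨ sym (block-split g (λ i → le (f i) p)) ⟩
    #≤ f (suc g * 5) p ∎
    where
    open ≤-Reasoning
    one : 3 * le (μ g) p ≤ #≤ (λ i → f (g * 5 + i)) 5 p
    one with μ g ≤? p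
    ... | yes l rewrite le-yes l = ≤-trans (Rank.upper (h (n<1+n g))) (Σ-mono 5 λ {i} _ → mono (f (g * 5 + i)))
      where
      mono : ∀ a → le a (μ g) ≤ le a p
      mono a with a ≤? μ g
      ... | yes l′ rewrite le-yes (≤-trans l′ l) = le-≤1 a (μ g)
      ... | no  l′ rewrite le-no (≰⇒> l′) = z≤n
    ... | no  l rewrite le-no (≰⇒> l) = z≤n

-- The stack, and division by a constant

member : ∀ {rs} r {_ : True (r ∈ℕ? rs)} → r ∈ rs
member r {h} = toWitness h

record Balanced (R : ℕ → Set) (s s′ : State) : Set where
  constructor balanced
  field
    pointer : reg s′ sp ≡ reg s sp
    stack   : s′ agrees s below reg s sp
    output  : R (reg s′ out)
open Balanced public

SameRegs : State → State → Set
SameRegs s s₁ = ∀ r {_ : T (not (r ≡ᵇ sp) ∧ not (r ≡ᵇ tmp))} → reg s₁ r ≡ reg s r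

-- Each pop finds the pushed value because the inner command returns with the same `sp` and
-- untouched cells below it. A push and a pop take 4 steps each.
protect-rule : ∀ {s c b R} rs →
  (∀ {s₁} → reg s₁ sp ≡ length rs + reg s sp → SameRegs s s₁ → s₁ agrees s below reg s sp →
    Runs c b (Balanced R s₁) s₁) →
  Runs (protect (map (6 +_) rs) c) (length rs * 8 + b)
    (λ s′ → Balanced R s s′ × (∀ {r} → r ∈ rs → reg s′ (6 + r) ≡ reg s (6 + r))) s
protect-rule [] h = consequence (h refl (λ _ → refl) (λ _ → refl)) (λ _ B → B , λ ())
protect-rule {s} {c} {b} {R} (r ∷ rs) h = weaken overhead
  (push ∙ seq (protect-rule rs λ {s₁} e k a →
      h (trans e (trans (cong (length rs +_) (+-comm (reg s sp) 1)) (+-suc (length rs) (reg s sp))))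
        (λ r₁ {t} → trans (k r₁ {t}) (same r₁ {t}))
        (λ l → trans (a (≤-trans l (m≤m+n _ 1))) (update-other (mem s) (<⇒≢ l))))
    λ {s′} _ (balanced p st o , rest) → block-rule (decrement sp ++ load (6 + r) sp ∷ [])
      ( balanced (sp≡ p) (λ l → trans (st (≤-trans l (m≤m+n _ 1))) (update-other (mem s) (<⇒≢ l))) o
      , λ {r₁} m → restored {s′} p st rest m))
  where
  push = store sp (6 + r) ∷ increment sp
  s₀ = exec push s
  sp≡ : ∀ {v} → v ≡ reg s₀ sp → v ∸ 1 ≡ reg s sp
  sp≡ refl = m+n∸n≡m (reg s sp) 1
  same : SameRegs s s₀
  same r₁ {t} with r₁ ≡ᵇ sp | r₁ ≡ᵇ tmp
  ... | false | false = refl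
  restored : ∀ {s′ r₁} → reg s′ sp ≡ reg s₀ sp → s′ agrees s₀ below reg s₀ sp →
    (∀ {r} → r ∈ rs → reg s′ (6 + r) ≡ reg s₀ (6 + r)) → r₁ ∈ r ∷ rs →
    reg (exec (decrement sp ++ load (6 + r) sp ∷ []) s′) (6 + r₁) ≡ reg s (6 + r₁)
  restored {s′} {r₁} p st rest m with r₁ ≡ᵇ r in e
  ... | true rewrite ≡ᵇ⇒≡ r₁ r (subst T (sym e) tt) = trans (cong (mem s′) (sp≡ p))
          (trans (st (m<m+n (reg s sp) (s≤s z≤n))) (update-same (mem s) (reg s sp)))
  restored p st rest (here refl) | false = contradiction (trans (sym e) (≡ᵇ-refl r)) λ ()
  restored p st rest (there m)   | false = rest m
  overhead : 4 + (length rs * 8 + b + 4) ≤ length (r ∷ rs) * 8 + b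
  overhead = ≤-reflexive (trans (cong (4 +_) (+-comm (length rs * 8 + b) 4)) (sym (+-assoc 8 (length rs * 8) b)))

divide-rule : ∀ d {s} → Runs (divide (suc d)) (5 + reg s rx * 7) (λ s′ → reg s′ ry ≡ reg s rx / suc d) s
divide-rule d {s} = set rz d ∷ set ry 0 ∷ sub flag rx rz ∷ [] ∙ loop (reg s rx) ≤-refl refl refl
  where
  body = set tmp (suc d) ∷ sub rx rx tmp ∷ increment ry ++ sub flag rx rz ∷ []
  loop : ∀ fuel {s} → reg s rx ≤ fuel → reg s rz ≡ d → reg s flag ≡ reg s rx ∸ reg s rz →
    Runs (whileNonZero flag (block body)) (suc (reg s rx * 7)) (λ s′ → reg s′ ry ≡ reg s ry + reg s rx / suc d) s
  loop fuel {s} l ez ef with reg s flag ≟ 0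
  ... | yes e0 = runs (⇓exit e0) (s≤s z≤n) (trans (sym (+-identityʳ _)) (cong (reg s ry +_)
          (sym (m<n⇒m/n≡0 (s≤s (subst (reg s rx ≤_) ez (m∸n≡0⇒m≤n (trans (sym ef) e0))))))))
  ... | no  nz with reg s rx in ex
  ...   | zero = contradiction (trans ef (0∸n≡0 (reg s rz))) nz
  loop (suc fuel) {s} l ez ef | no nz | suc v = runs
      (⇓loop nz (block-run body) (B .derivation))
      (s≤s (+-monoʳ-≤ 6 (≤-trans (B .within) cost)))
      (trans (B .post) (trans (+-assoc (reg s ry) 1 _) (cong (reg s ry +_)
        (trans (cong (λ u → suc (u / suc d)) s₁x) (sym (m/n≡1+[m∸n]/n c≤v))))))
    where
    s₁ = exec body s
    s₁x : reg s₁ rx ≡ suc v ∸ suc d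
    s₁x = cong (_∸ suc d) ex
    c≤v : suc d ≤ suc v
    c≤v = ≰⇒> λ le → nz (trans ef (m≤n⇒m∸n≡0 (≤-trans le (≤-reflexive (sym ez)))))
    B = loop fuel {s₁} (≤-trans (≤-reflexive s₁x) (≤-trans (m∸n≤m v d) (s≤s⁻¹ l))) ez refl
    cost : suc (reg s₁ rx * 7) ≤ suc (v * 7)
    cost = s≤s (*-monoˡ-≤ 7 (≤-trans (≤-reflexive s₁x) (m∸n≤m v d)))

-- Selection in linear time

bruteCost : ℕ → ℕ
bruteCost n = 6 + n * (8 + (loopCost n + (9 + (loopCost n + (6 + (5 + 3))))) + 4)

-- Equal cells may share rank k and overwrite `out` in turn. So the invariant says only that `out`
-- has rank k once some cell passed has it; `rank-exists` supplies such a cell.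
brute-rule : ∀ {s n k} → reg s blen ≡ n → reg s brank ≡ k → k < n →
  Runs brute (bruteCost n) (λ s′ → Rank (λ i → mem s (reg s ptr + i)) n k (reg s′ out)) s
brute-rule {s} {n} {k} en ek k<n =
  set tmp 0 ∷ copy p₁ ptr ∷ copy col ptr ∷ copy counter blen ∷ [] ∙ uniform n _
  (consequence (repeat-rule I _ n en (sym (+-identityʳ _) , λ ()) step) λ _ (_ , h) →
    let _ , i<n , r = rank-exists F n k k<n in h i<n r)
  where
  F : ℕ → ℕ
  F i = mem s (reg s ptr + i)
  I : ℕ → State → Set
  I i s′ = reg s′ col ≡ reg s ptr + i × (∀ {j} → j < i → Rank F n k (F j) → Rank F n k (reg s′ out))
  body : Cmd 2
  body = block (load rz col ∷ pointers ptr ptr blen) ⨾ sumLoop below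
    ⨾ block (set tmp 0 ∷ copy lo acc ∷ pointers ptr ptr blen) ⨾ sumLoop atMost
    ⨾ block (sub lo lo brank ∷ set tmp 1 ∷ add flag brank tmp ∷ sub flag flag acc ∷ add flag lo flag ∷ [])
    ⨾ ifNonZero flag skip (block (set tmp 0 ∷ copy out rz ∷ []))
    ⨾ block (increment col)
  step : ∀ i {s′} → i < n → Keeps (repeat counter body) (exec (set tmp 0 ∷ copy p₁ ptr ∷ copy col ptr ∷ copy counter blen ∷ []) s) s′ → I i s′ →
    Runs body _ (λ s″ → I (suc i) (exec (decrement counter) s″)) s′
  step i {s′} i<n κ (e , h) =
    load rz col ∷ pointers ptr ptr blen
    ∙ seq (sum-rule below n (trans (κ .regs blen) en) refl) λ {s₁} κ₁ e₁ →
    set tmp 0 ∷ copy lo acc ∷ pointers ptr ptr blen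
    ∙ seq (sum-rule atMost n (trans (κ₁ .regs blen) (trans (κ .regs blen) en)) refl) λ {s₂} κ₂ e₂ →
    let m₁ = trans (κ₁ .memory) (κ .memory)
        a₁ = trans (κ₁ .regs ptr) (κ .regs ptr)
        v₀ : mem s′ (reg s′ col) ≡ F i
        v₀ = cong₂ (λ f a → f a) (κ .memory) e
        v₁ = trans (κ₁ .regs rz) v₀
        v₂ = trans (κ₂ .regs rz) v₁
        lo≡ : reg s₂ lo ≡ #< F n (F i)
        lo≡ = trans (κ₂ .regs lo) (trans e₁ (total-cong below n (κ .memory) (κ .regs ptr) (κ .regs ptr) v₀))
        hi≡ : reg s₂ acc ≡ #≤ F n (F i)
        hi≡ = trans e₂ (total-cong atMost n m₁ a₁ a₁ v₁)
        k≡ : reg s₂ brank ≡ k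
        k≡ = trans (κ₂ .regs brank) (trans (κ₁ .regs brank) (trans (κ .regs brank) ek))
        test : (reg s₂ lo ∸ reg s₂ brank) + ((reg s₂ brank + 1) ∸ reg s₂ acc) ≡ (#< F n (F i) ∸ k) + (suc k ∸ #≤ F n (F i))
        test = cong₂ _+_ (cong₂ _∸_ lo≡ k≡) (cong₂ _∸_ (trans (cong (_+ 1) k≡) (+-comm k 1)) hi≡)
        out≡ : reg s₂ out ≡ reg s′ out
        out≡ = trans (κ₂ .regs out) (κ₁ .regs out)
        col≡ = trans (κ₂ .regs col) (trans (κ₁ .regs col) e)
    in sub lo lo brank ∷ set tmp 1 ∷ add flag brank tmp ∷ sub flag flag acc ∷ add flag lo flag ∷ []
    ∙ seq {R = λ s₃ → ∀ {j} → j < suc i → Rank F n k (F j) → Rank F n k (reg s₃ out)}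
      (if-rule flag
        (λ nz → skip-rule λ l r → case m≤n⇒m<n∨m≡n (s≤s⁻¹ l) of λ where
          (inj₁ l′)   → subst (Rank F n k) (sym out≡) (h l′ r)
          (inj₂ refl) → contradiction (trans test (cong₂ _+_ (m≤n⇒m∸n≡0 (Rank.lower r)) (m≤n⇒m∸n≡0 (Rank.upper r)))) nz)
        (λ z → block-rule (set tmp 0 ∷ copy out rz ∷ []) λ _ _ → subst (Rank F n k) (sym v₂)
          (let z′ = trans (sym test) z in
           ranked (m∸n≡0⇒m≤n (m+n≡0⇒m≡0 _ z′)) (m∸n≡0⇒m≤n (m+n≡0⇒n≡0 (#< F n (F i) ∸ k) z′)))))
    λ {s₃} κ₃ q → block-rule (increment col)
      (+-next (reg s ptr) i (trans (κ₃ .regs col) col≡)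
      , q)

keep-static : ∀ o → T (keeps icounter (keepBody o)) × T (keeps sp (repeat icounter (keepBody o))) × T (keeps rz (repeat icounter (keepBody o)))
keep-static entry   = _
keep-static diff    = _
keep-static meet    = _
keep-static fixed   = _
keep-static slack   = _
keep-static excess  = _
keep-static below   = _
keep-static atMost  = _

keepCost : ℕ → ℕ
keepCost n = 9 + (suc (n * 22) + 2)

-- The kept cells are described by their sums under every weight, the form that `rank-below` and
-- `rank-above` consume; the weight 1 gives their number.
keepIf-rule : ∀ o {s n} → reg s len ≡ n →
  let F = λ i → mem s (reg s sp + i) in
  Runs (keepIf o) (keepCost n) (λ s′ → s′ agrees s below reg s sp ×
    (∀ (w : ℕ → ℕ) → Σ< (reg s′ len) (λ i → w (mem s′ (reg s sp + i))) ≡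
           Σ< n (λ i → sign (val o (F i) (F i) (reg s rz)) * w (F i)))) s
keepIf-rule o {s} {n} en = prelude ∙
  seq (uniform n 22 (repeat-rule I (λ _ → 18) n {proj₁ (keep-static o)} en
        (sym (+-identityʳ P) , 0 , z≤n , sym (+-identityʳ P) , (λ _ → refl) , (λ _ → refl) , (λ _ _ → refl)) step))
  λ {s′} κ (_ , j , _ , ed , ag , W , _) → block-rule (sub len dest sp ∷ [])
    ( ag , λ w → trans (cong (λ l → Σ< l (λ i → w (mem s′ (P + i))))
        (trans (cong₂ _∸_ ed (κ .regs sp {proj₁ (proj₂ (keep-static o))})) (m+n∸m≡n P j))) (W w))
  where
  prelude = pointers sp sp len ++ set tmp 0 ∷ copy dest sp ∷ []
  P = reg s sp
  F : ℕ → ℕ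
  F i = mem s (P + i)
  t : ℕ → ℕ
  t i = val o (F i) (F i) (reg s rz)
  I : ℕ → State → Set
  I i s′ = reg s′ p₁ ≡ P + i × ∃[ j ] (j ≤ i × reg s′ dest ≡ P + j × s′ agrees s below P ×
    (∀ (w : ℕ → ℕ) → Σ< j (λ l → w (mem s′ (P + l))) ≡ Σ< i (λ l → sign (t l) * w (F l))) ×
    (∀ {l} → i ≤ l → l < n → mem s′ (P + l) ≡ F l))
  step : ∀ i {s′} → i < n → Keeps (repeat icounter (keepBody o)) (exec prelude s) s′ → I i s′ →
    Runs (keepBody o) 18 (λ s″ → I (suc i) (exec (decrement icounter) s″)) s′
  step i {s′} i<n κ (e₁ , j , j≤i , ed , ag , W , rest) =
    weaken (+-monoʳ-≤ 4 (+-monoˡ-≤ 9 (s≤s (code-length o))))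
    ( set tmp 0 ∷ load rx p₁ ∷ copy ry rx ∷ [] ∙ code o ∙
      seq {R = λ s₃ → reg s₃ p₁ ≡ P + i × ∃[ j ] (j ≤ suc i × reg s₃ dest ≡ P + j × s₃ agrees s below P ×
        (∀ (w : ℕ → ℕ) → Σ< j (λ l → w (mem s₃ (P + l))) ≡ Σ< (suc i) (λ l → sign (t l) * w (F l))) ×
        (∀ {l} → suc i ≤ l → l < n → mem s₃ (P + l) ≡ F l))}
      (if-rule rx
        (λ nz → block-rule (store dest ry ∷ increment dest)
          ( trans (code-reg o p₁) e₁ , suc j , s≤s j≤i , +-next P j dest≡
          , (λ l → trans (stored (<⇒≢ (<-≤-trans l (m≤m+n P j)))) (ag l))
          , (λ w → cong₂ _+_ (trans (Σ-cong j λ l → cong w (stored λ q → <⇒≢ l (+-cancelˡ-≡ P _ _ q))) (W w))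
              (trans (cong w (trans (cong (mem s₃) (sym dest≡)) (trans (update-same (mem s₂) (reg s₂ dest)) y≡)))
                (sym (trans (cong (_* w (F i)) (sign-pos (λ z → nz (trans x≡ z)))) (+-identityʳ _)))))
          , (λ l l<n → trans (stored λ q → <⇒≢ (≤-trans (s≤s j≤i) l) (sym (+-cancelˡ-≡ P _ _ q))) (rest (<⇒≤ l) l<n)) ))
        (λ z → skip-rule
          ( trans (code-reg o p₁) e₁ , j , m≤n⇒m≤1+n j≤i , dest≡
          , (λ l → trans (same _) (ag l))
          , (λ w → trans (trans (Σ-cong j λ _ → cong w (same _)) (W w))
              (trans (sym (+-identityʳ _)) (cong (Σ< i (λ l → sign (t l) * w (F l)) +_) (sym (cong (λ v → sign v * w (F i)) (trans (sym x≡) z))))))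
          , (λ l l<n → trans (same _) (rest (<⇒≤ l) l<n)) )))
      λ _ (q , r) → block-rule (increment p₁) (+-next P i q , r) )
    where
    s₁ = exec (set tmp 0 ∷ load rx p₁ ∷ copy ry rx ∷ []) s′
    s₂ = exec (code o) s₁
    s₃ = exec (store dest ry ∷ increment dest) s₂
    same : ∀ a → mem s₂ a ≡ mem s′ a
    same a = cong (λ h → h a) (code-mem o s₁)
    dest≡ : reg s₂ dest ≡ P + j
    dest≡ = trans (code-reg o dest) ed
    stored : ∀ {a} → a ≢ P + j → mem s₃ a ≡ mem s′ a
    stored ne = trans (update-other (mem s₂) (λ q → ne (trans q dest≡))) (same _)
    F≡ : mem s′ (reg s′ p₁) ≡ F i
    F≡ = trans (cong (mem s′) e₁) (rest ≤-refl i<n)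
    y≡ : reg s₂ ry ≡ F i
    y≡ = trans (code-reg o ry) F≡
    x≡ : reg s₂ rx ≡ t i
    x≡ = trans (code-val o s₁) (trans (cong (λ v → val o v v (reg s′ rz)) F≡)
           (cong (val o (F i) (F i)) (κ .regs rz {proj₂ (proj₂ (keep-static o))})))

Rank-cong : ∀ {f g n k v} → (∀ {i} → i < n → f i ≡ g i) → Rank f n k v → Rank g n k v
Rank-cong {n = n} {k} {v} h (ranked l u) = ranked
  (subst (_≤ k) (Σ-cong n λ i<n → cong (λ a → lt a v) (h i<n)) l)
  (subst (k <_) (Σ-cong n λ i<n → cong (λ a → le a v) (h i<n)) u)

mediansCost : ℕ → ℕ
mediansCost g = 4 + suc (g * ((bruteCost 5 + 6) + 4))

medians-rule : ∀ {s g} → reg s groups ≡ g → reg s blen ≡ 5 → reg s brank ≡ 2 → reg s ptr + g * 5 ≤ reg s sp →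
  Runs medians (mediansCost g) (λ s′ → s′ agrees s below reg s sp ×
    Medians {λ i → mem s (reg s ptr + i)} {λ l → mem s′ (reg s sp + l)} g) s
medians-rule {s} {g} eg e5 e2 fit = prelude ∙ consequence
  (uniform g _ (repeat-rule I _ g eg
    ((λ _ → refl) , (λ ()) , sym (+-identityʳ _) , sym (+-identityʳ _)) step))
  λ _ (a , m , _) → a , m
  where
  prelude = set tmp 0 ∷ copy dest sp ∷ copy gcounter groups ∷ []
  A = reg s ptr
  P = reg s sp
  F : ℕ → ℕ
  F i = mem s (A + i)
  I : ℕ → State → Set
  I i s′ = s′ agrees s below P × Medians {F} {λ l → mem s′ (P + l)} i × reg s′ ptr ≡ A + i * 5 × reg s′ dest ≡ P + i
  tail : Code
  tail = store dest out ∷ increment dest ++ set tmp 5 ∷ add ptr ptr tmp ∷ []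
  step : ∀ i {s′} → i < g → Keeps (repeat gcounter (brute ⨾ block tail)) (exec prelude s) s′ → I i s′ →
    Runs (brute ⨾ block tail) (bruteCost 5 + 6) (λ s″ → I (suc i) (exec (decrement gcounter) s″)) s′
  step i {s′} i<g κ (ag , med , ep , ed) =
    seq (brute-rule (trans (κ .regs blen) e5) (trans (κ .regs brank) e2) (s≤s (s≤s (s≤s z≤n)))) λ {s₁} κ₁ r →
    let stored : ∀ {a} → a ≢ P + i → mem (exec tail s₁) a ≡ mem s′ a
        stored {a} ne = trans (update-other (mem s₁) (λ q → ne (trans q (trans (κ₁ .regs dest) ed)))) (cong (λ h → h a) (κ₁ .memory))
        here≡ : mem (exec tail s₁) (P + i) ≡ reg s₁ out
        here≡ = trans (cong (mem (exec tail s₁)) (sym (trans (κ₁ .regs dest) ed))) (update-same (mem s₁) (reg s₁ dest))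
    in block-rule tail
      ( (λ l → trans (stored (<⇒≢ (<-≤-trans l (m≤m+n P i)))) (ag l))
      , (λ {l} l<  → case m≤n⇒m<n∨m≡n (s≤s⁻¹ l<) of λ where
          (inj₁ l′)   → subst (Rank (λ j → F (l * 5 + j)) 5 2) (sym (stored λ q → <⇒≢ l′ (+-cancelˡ-≡ P _ _ q))) (med l′)
          (inj₂ refl) → subst (Rank (λ j → F (i * 5 + j)) 5 2) (sym here≡)
            (Rank-cong (λ {j} j<5 → trans (cong (λ a → mem s′ (a + j)) ep)
                (trans (ag (<-≤-trans (subst (_< A + (i * 5 + 5)) (sym (+-assoc A (i * 5) j)) (+-monoʳ-< A (+-monoʳ-< (i * 5) j<5)))
                             (≤-trans (+-monoʳ-≤ A (≤-trans (≤-reflexive (+-comm (i * 5) 5)) (*-monoˡ-≤ 5 i<g))) fit)))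
                       (cong (mem s) (+-assoc A (i * 5) j)))) r))
      , trans (cong (_+ 5) (trans (κ₁ .regs ptr) ep)) (trans (+-assoc A (i * 5) 5) (cong (A +_) (+-comm (i * 5) 5)))
      , +-next P i (trans (κ₁ .regs dest) ed) )

-- Linear bounds and the time of selection

infixr 5 _⊕_ _⊕ˡ_ _⊕²_

-- Records rather than functions, so that Agda infers the constants c.
record Linear (x c a : ℕ) : Set where
  constructor lin
  field bound : a ≤ c * x

-- The term k holds the cost of recursive calls, whose coefficient must not grow if the induction is
-- to close.
record Affine (x c k a : ℕ) : Set where
  constructor aff
  field bound : a ≤ c * x + k

_⊕²_ : ∀ {x c d k l a b} → Affine x c k a → Affine x d l b → Affine x (c + d) (k + l) (a + b)
_⊕²_ {x} {c} {d} {k} {l} (aff h) (aff h′) = aff (≤-trans (+-mono-≤ h h′) (≤-reflexive (eq c d x k l)))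
  where
  eq : ∀ c d x k l → (c * x + k) + (d * x + l) ≡ (c + d) * x + (k + l)
  eq = solve-∀

_⊕_ : ∀ {x c d a b} → Linear x c a → Linear x d b → Linear x (c + d) (a + b)
_⊕_ {x} {c} {d} (lin h) (lin h′) = lin (≤-trans (+-mono-≤ h h′) (≤-reflexive (sym (*-distribʳ-+ x c d))))

_⊕ˡ_ : ∀ {x c d k a b} → Linear x c a → Affine x d k b → Affine x (c + d) k (a + b)
_⊕ˡ_ {x} {c} {d} {k} (lin h) (aff h′) = aff (≤-trans (+-mono-≤ h h′)
  (≤-reflexive (trans (sym (+-assoc (c * x) (d * x) k)) (cong (_+ k) (sym (*-distribʳ-+ x c d))))))

exactly : ∀ {x} k → Affine x 0 k k
exactly k = aff ≤-refl

constant : ∀ {x} c → 1 ≤ x → Linear x c c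
constant {x} c h = lin (≤-trans (≤-reflexive (sym (*-identityʳ c))) (*-monoʳ-≤ c h))

linear : ∀ {x} l w → l ≤ x → Linear x w (l * w)
linear l w h = lin (≤-trans (≤-reflexive (*-comm l w)) (*-monoʳ-≤ w h))

selectCost : (K n g r : ℕ) → ℕ
selectCost K n g r = suc (3 + suc
  (3 + ((5 + n * 7) + (4 + ((5 + g * 7) + (7 + ((2 * 8 + (mediansCost g + (4 + K * g))) +
    (10 + (loopCost n + (9 + (loopCost n + (3 + suc (suc (2 + (keepCost n + K * r)))))))))))))))

opaque

  -- K is the assumed cost per value of the recursive calls, on g medians and on r remaining values.
  -- That c is chosen before K allows K to be defined from c afterwards.
  selectCost-affine : Σ[ c ∈ ℕ ] (∀ K n g r → 1 ≤ n → g ≤ n → Affine n c (K * g + K * r) (selectCost K n g r))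
  selectCost-affine = _ , λ K n g r p q →
    constant 8 p ⊕ˡ (constant 5 p ⊕ linear n 7 ≤-refl) ⊕ˡ constant 4 p ⊕ˡ (constant 5 p ⊕ linear g 7 q) ⊕ˡ
    constant 7 p ⊕ˡ
    (constant 16 p ⊕ˡ (constant 5 p ⊕ linear g _ q) ⊕ˡ constant 4 p ⊕ˡ exactly (K * g)) ⊕²
    (constant 10 p ⊕ˡ (constant 1 p ⊕ linear n 21 ≤-refl) ⊕ˡ constant 9 p ⊕ˡ (constant 1 p ⊕ linear n 21 ≤-refl) ⊕ˡ
     constant 7 p ⊕ˡ (constant 10 p ⊕ (linear n 22 ≤-refl ⊕ constant 2 p)) ⊕ˡ exactly (K * r))

  -- The factor 18 comes from n ≤ 9 g and g ≤ 2 e in `select-budget`, where e = h + 2 ρ counts the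
  -- values that remain after both subproblems are paid.
  selectRate : ℕ
  selectRate = 18 * proj₁ selectCost-affine

  selectRate-≡ : selectRate ≡ 18 * proj₁ selectCost-affine
  selectRate-≡ = refl

  small-budget : 10 + bruteCost 4 ≤ selectRate
  small-budget = ≤ᵇ⇒≤ (10 + bruteCost 4) selectRate tt

-- The pivot computation on g values and a subproblem on the remaining n ∸ (g + (h + ρ * 2)) values
-- leave a fixed fraction of the n values to pay for the rest.
select-budget : ∀ n g h r ρ → 1 ≤ g → r ≤ 4 → n ≡ r + g * 5 → g ≡ ρ + h * 2 →
  selectCost selectRate n g (n ∸ (g + (h + ρ * 2))) ≤ selectRate * n
select-budget n g h r ρ 1≤g r≤4 en eg = begin
  selectCost K n g l  ≤⟨ Affine.bound (proj₂ selectCost-affine K n g l (≤-trans 1≤g g≤n) g≤n) ⟩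
  c * n + (K * g + K * l)  ≤⟨ +-monoˡ-≤ (K * g + K * l) (*-monoʳ-≤ c n≤18e) ⟩
  c * (18 * e) + (K * g + K * l)  ≡⟨ cong (_+ (K * g + K * l)) (trans (regroup c e) (cong (_* e) (sym selectRate-≡))) ⟩
  K * e + (K * g + K * l)  ≡⟨ collect K e g l ⟩
  K * ((g + e) + l)  ≡⟨ cong (K *_) (m+[n∸m]≡n g+e≤n) ⟩
  K * n  ∎
  where
  open ≤-Reasoning
  K = selectRate
  c = proj₁ selectCost-affine
  e = h + ρ * 2
  l = n ∸ (g + e)
  regroup : ∀ c e → c * (18 * e) ≡ 18 * c * e
  regroup = solve-∀
  collect : ∀ K e g l → K * e + (K * g + K * l) ≡ K * ((g + e) + l)
  collect = solve-∀
  5g≤n : g * 5 ≤ n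
  5g≤n = subst (g * 5 ≤_) (sym en) (m≤n+m (g * 5) r)
  g≤n : g ≤ n
  g≤n = ≤-trans (m≤m*n g 5) 5g≤n
  g≤2e : g ≤ 2 * e
  g≤2e = ≤-trans (≤-reflexive eg) (≤-trans (m≤m+n (ρ + h * 2) (3 * ρ)) (≤-reflexive (eq ρ h)))
    where
    eq : ∀ ρ h → (ρ + h * 2) + 3 * ρ ≡ 2 * (h + ρ * 2)
    eq = solve-∀
  n≤18e : n ≤ 18 * e
  n≤18e = ≤-trans (≤-reflexive en) (≤-trans (+-monoˡ-≤ (g * 5) (≤-trans r≤4 (*-monoʳ-≤ 4 1≤g)))
    (≤-trans (≤-reflexive (eq₁ g)) (≤-trans (*-monoʳ-≤ 9 g≤2e) (≤-reflexive (eq₂ e)))))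
    where
    eq₁ : ∀ g → 4 * g + g * 5 ≡ 9 * g
    eq₁ = solve-∀
    eq₂ : ∀ e → 9 * (2 * e) ≡ 18 * e
    eq₂ = solve-∀
  g+e≤n : g + e ≤ n
  g+e≤n = ≤-trans (+-monoʳ-≤ g (≤-trans (m≤m+n e (3 * h)) (≤-trans (≤-reflexive (eq h ρ)) (*-monoˡ-≤ 2 (≤-reflexive (sym eg))))))
           (≤-trans (≤-trans (m≤m+n _ (2 * g)) (≤-reflexive (eq₂ g))) 5g≤n)
    where
    eq : ∀ h ρ → (h + ρ * 2) + 3 * h ≡ (ρ + h * 2) * 2
    eq = solve-∀
    eq₂ : ∀ g → (g + g * 2) + 2 * g ≡ g * 5
    eq₂ = solve-∀

module _ (F : ℕ → ℕ) {μ : ℕ → ℕ} {n g h r ρ p : ℕ} (en : n ≡ r + g * 5) (eg : g ≡ ρ + h * 2)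
         (med : Medians {F} {μ} g) (mid : Rank μ g h p) where

  -- At most 2 g + 3 h + r values are below p: at most h medians are, and the r cells outside the
  -- blocks are all conceded. Subtracted from n = 5 g + r, this leaves 3 g - 3 h = g + (h + 2 ρ).
  few-below : #< F n p ≤ n ∸ (g + (h + ρ * 2))
  few-below = m+n≤o⇒m≤o∸n (#< F n p) (≤-trans (≤-reflexive (+-comm (#< F n p) _)) (begin
    g + (h + ρ * 2) + #< F n p  ≤⟨ +-monoʳ-≤ (g + (h + ρ * 2)) tail ⟩
    g + (h + ρ * 2) + ((2 * g + 3 * h) + r)  ≡⟨ cong (λ g → g + (h + ρ * 2) + ((2 * g + 3 * h) + r)) eg ⟩
    _  ≡⟨ eq h r ρ ⟩
    r + (ρ + h * 2) * 5  ≡⟨ cong (λ g → r + g * 5) (sym eg) ⟩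
    r + g * 5  ≡⟨ sym en ⟩
    n  ∎))
    where
    open ≤-Reasoning
    eq : ∀ h r ρ → (ρ + h * 2) + (h + ρ * 2) + ((2 * (ρ + h * 2) + 3 * h) + r) ≡ r + (ρ + h * 2) * 5
    eq = solve-∀
    tail : #< F n p ≤ (2 * g + 3 * h) + r
    tail = begin
      #< F n p  ≡⟨ cong (λ n → #< F n p) (trans en (+-comm r (g * 5))) ⟩
      #< F (g * 5 + r) p  ≡⟨ Σ-split (g * 5) r (λ i → lt (F i) p) ⟩
      #< F (g * 5) p + _  ≤⟨ +-mono-≤ (≤-trans (medians-below {F} {μ} g p med) (+-monoʳ-≤ (2 * g) (*-monoʳ-≤ 3 (Rank.lower mid))))
                                                        (≤-trans (Σ-mono r λ {i} _ → lt-≤1 (F (g * 5 + i)) p) (≤-reflexive (Σ-one r))) ⟩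
      (2 * g + 3 * h) + r  ∎

  -- At least h + 1 medians are ≤ p, so at least 3 (h + 1) values are. This is no less than g + (h +
  -- 2 ρ) = 3 (ρ + h) because ρ ≤ 1.
  few-above : ρ ≤ 1 → Σ< n (λ i → sign (F i ∸ p)) ≤ n ∸ (g + (h + ρ * 2))
  few-above ρ≤1 = m+n≤o⇒m≤o∸n G (≤-trans (≤-reflexive (+-comm G _)) (begin
    g + (h + ρ * 2) + G  ≡⟨ cong (λ g → g + (h + ρ * 2) + G) eg ⟩
    (ρ + h * 2) + (h + ρ * 2) + G  ≡⟨ eq h ρ G ⟩
    3 * (ρ + h) + G  ≤⟨ +-monoˡ-≤ G (*-monoʳ-≤ 3 (+-monoˡ-≤ h ρ≤1)) ⟩
    3 * suc h + G  ≤⟨ +-monoˡ-≤ G (≤-trans (*-monoʳ-≤ 3 (Rank.upper mid)) (medians-above {F} {μ} g p med)) ⟩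
    #≤ F (g * 5) p + G  ≤⟨ +-monoˡ-≤ G (≤-trans (m≤m+n _ _) (≤-reflexive (sym (Σ-split (g * 5) r (λ i → le (F i) p))))) ⟩
    #≤ F (g * 5 + r) p + G  ≡⟨ cong (λ n → #≤ F n p + G) (trans (+-comm (g * 5) r) (sym en)) ⟩
    #≤ F n p + G  ≡⟨ sym (Σ-+ n _ _) ⟩
    Σ< n (λ i → le (F i) p + sign (F i ∸ p)) ≡⟨ Σ-cong n (λ {i} _ → le+gt (F i) p) ⟩
    Σ< n (λ _ → 1)  ≡⟨ Σ-one n ⟩
    n  ∎))
    where
    open ≤-Reasoning
    G : ℕ
    G = Σ< n (λ i → sign (F i ∸ p))
    eq : ∀ h ρ G → (ρ + h * 2) + (h + ρ * 2) + G ≡ 3 * (ρ + h) + G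
    eq = solve-∀

bruteCost-mono : ∀ {m n} → m ≤ n → bruteCost m ≤ bruteCost n
bruteCost-mono {m} {n} h = +-monoʳ-≤ 6 (*-mono-≤ h (+-monoˡ-≤ 4 (+-monoʳ-≤ 8
  (+-mono-≤ l (+-monoʳ-≤ 9 (+-monoˡ-≤ 14 l))))))
  where
  l : loopCost m ≤ loopCost n
  l = s≤s (*-monoˡ-≤ 21 h)

splitCost : ℕ → ℕ → ℕ
splitCost n b = 10 + (loopCost n + (9 + (loopCost n + (3 + suc (suc (2 + (keepCost n + b)))))))

-- `fuel` bounds the length: both recursive calls are on smaller lengths, but not structurally
-- smaller ones.
SelectsWithin : ℕ → Set
SelectsWithin fuel = ∀ {s} → reg s len ≤ fuel → reg s rank < reg s len →
  Runs (call select) (selectRate * reg s len)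
    (Balanced (Rank (λ i → mem s (reg s sp + i)) (reg s len) (reg s rank)) s) s

module _ {fuel : ℕ} (recurse : SelectsWithin fuel) {s : State} (k<n : reg s rank < reg s len) where

  private
    P n k : ℕ
    P = reg s sp
    n = reg s len
    k = reg s rank
    F : ℕ → ℕ
    F i = mem s (P + i)

  split-rule : ∀ {l s₄} → let p = reg s₄ out in l ≤ fuel →
    #< F n p ≤ l → Σ< n (λ i → sign (F i ∸ p)) ≤ l →
    reg s₄ sp ≡ P + n → reg s₄ len ≡ n → reg s₄ rank ≡ k → s₄ agrees s below (P + n) →
    Runs splitStep (splitCost n (selectRate * l)) (Balanced (Rank F n k) s) s₄
  split-rule {l} {s₄} l≤fuel below-l above-l esp elen erank ag =
    sub sp sp len ∷ set tmp 0 ∷ copy rz out ∷ pointers sp sp len ∙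
    seq (sum-rule below n elen refl) λ {s₅} κ₅ e₅ →
    set tmp 0 ∷ copy lo acc ∷ pointers sp sp len ∙
    seq (sum-rule atMost n (trans (κ₅ .regs len) elen) refl) λ {s₆} κ₆ e₆ →
    let sp₅ = trans (κ₅ .regs sp) sp≡
        sp₆ : reg s₆ sp ≡ P
        sp₆ = trans (κ₆ .regs sp) sp₅
        len₆ = trans (κ₆ .regs len) (trans (κ₅ .regs len) elen)
        rank₆ = trans (κ₆ .regs rank) (trans (κ₅ .regs rank) erank)
        z₅ = κ₅ .regs rz
        z₆ : reg s₆ rz ≡ p
        z₆ = trans (κ₆ .regs rz) z₅
        m₆ : mem s₆ ≡ mem s₄
        m₆ = trans (κ₆ .memory) (κ₅ .memory)
        ag₆ : s₆ agrees s below P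
        ag₆ = λ {i} i<P → trans (cong (λ h → h i) m₆) (ag (<-≤-trans i<P (m≤m+n P n)))
        lo₆ : reg s₆ lo ≡ #< F n p
        lo₆ = trans (κ₆ .regs lo) (trans e₅ (trans (total-cong below n {mem s₄} refl sp≡ sp≡ (refl {x = p})) (Σ-cong n λ l → cong (λ a → lt a p) (cell l))))
        hi₆ : reg s₆ acc ≡ #≤ F n p
        hi₆ = trans e₆ (trans (total-cong atMost n (κ₅ .memory) sp₅ sp₅ z₅) (Σ-cong n λ l → cong (λ a → le a p) (cell l)))
        cell₆ : ∀ {i} → i < n → mem s₆ (reg s₆ sp + i) ≡ F i
        cell₆ = λ {i} i<n → trans (cong₂ (λ h a → h (a + i)) m₆ sp₆) (cell i<n)
        out₆ : reg s₆ out ≡ p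
        out₆ = trans (κ₆ .regs out) (κ₅ .regs out)
        low : reg s₆ lo ∸ reg s₆ rank ≡ #< F n p ∸ k
        low = cong₂ _∸_ lo₆ rank₆
    in sub lo lo rank ∷ sub flag acc rank ∷ [] ∙
    if-same lo
      (λ nz → weaken (m≤n+m _ 3)
        (narrow slack len₆ sp₆ z₆ rank₆ ag₆ cell₆ below-l (≰⇒> λ le → nz (trans low (m≤n⇒m∸n≡0 le))) (λ W → rank-below {p = p} W)))
      (λ z → if-same flag
        (λ nz → skip-rule≤ (balanced sp₆ ag₆ (subst (Rank F n k) (sym out₆)
          (ranked (m∸n≡0⇒m≤n (trans (sym low) z))
            (≰⇒> λ le → nz (trans (cong₂ _∸_ hi₆ rank₆) (m≤n⇒m∸n≡0 le)))))))
        (λ z′ → sub rank rank acc ∷ [] ∙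
          let hi≤k : #≤ F n p ≤ k
              hi≤k = m∸n≡0⇒m≤n (trans (sym (cong₂ _∸_ hi₆ rank₆)) z′)
          in narrow excess len₆ sp₆ z₆ (cong₂ _∸_ rank₆ hi₆) ag₆ cell₆ above-l
               (+-cancelˡ-< (#≤ F n p) _ _ (subst₂ _<_ (sym (m+[n∸m]≡n hi≤k)) (sym all) k<n))
               (λ W → rank-above {p = p} W hi≤k)))
    where
    p : ℕ
    p = reg s₄ out
    all : #≤ F n p + Σ< n (λ i → sign (F i ∸ p)) ≡ n
    all = trans (sym (Σ-+ n _ _)) (trans (Σ-cong n λ {i} _ → le+gt (F i) p) (Σ-one n))
    sp≡ : reg s₄ sp ∸ reg s₄ len ≡ P
    sp≡ = trans (cong₂ _∸_ esp elen) (m+n∸n≡m P n)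
    cell : ∀ {i} → i < n → mem s₄ (P + i) ≡ F i
    cell i<n = ag (+-monoʳ-< P i<n)
    -- Both recursive cases at once: they differ in the operation, in the new rank k′ and in the
    -- lemma `step` that lifts the rank back to F.
    narrow : ∀ o {k′ s₆} {_ : T (keeps sp (keepIf o))} {_ : T (keeps rank (keepIf o))} →
      let t = λ i → sign (val o (F i) (F i) p) in
      reg s₆ len ≡ n → reg s₆ sp ≡ P → reg s₆ rz ≡ p → reg s₆ rank ≡ k′ → s₆ agrees s below P →
      (∀ {i} → i < n → mem s₆ (reg s₆ sp + i) ≡ F i) → Σ< n t ≤ l → k′ < Σ< n t →
      (∀ {n′ G} → (∀ (w : ℕ → ℕ) → Σ< n′ (w ∘ G) ≡ Σ< n (λ i → t i * w (F i))) → ∀ {v} → Rank G n′ k′ v → Rank F n k v) →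
      Runs (keepIf o ⨾ call select) (keepCost n + selectRate * l) (Balanced (Rank F n k) s) s₆
    narrow o {k′} {s₆} {hs} {hr} len₆ sp₆ z₆ rank₆ ag₆ cell₆ le lt step =
      seq (keepIf-rule o len₆) λ {s₇} κ₇ (ag₇ , W) →
      let t = λ i → sign (val o (F i) (F i) p)
          sp₇ : reg s₇ sp ≡ P
          sp₇ = trans (κ₇ .regs sp {hs}) sp₆
          k₇ : reg s₇ rank ≡ k′
          k₇ = trans (κ₇ .regs rank {hr}) rank₆
          W₇ : ∀ (w : ℕ → ℕ) → Σ< (reg s₇ len) (λ i → w (mem s₇ (reg s₇ sp + i))) ≡ Σ< n (λ i → t i * w (F i))
          W₇ = λ w → trans (cong (λ a → Σ< (reg s₇ len) (λ i → w (mem s₇ (a + i)))) (κ₇ .regs sp {hs})) (trans (W w)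
                 (Σ-cong n λ i<n → cong₂ (λ v z → sign (val o v v z) * w v) (cell₆ i<n) z₆))
          len₇ : reg s₇ len ≡ Σ< n t
          len₇ = trans (sym (Σ-one (reg s₇ len))) (trans (W₇ (λ _ → 1)) (Σ-cong n λ {i} _ → *-identityʳ (t i)))
          le₇ = ≤-trans (≤-reflexive len₇) le
          G = λ i → mem s₇ (reg s₇ sp + i)
      in weaken (*-monoʳ-≤ selectRate le₇)
        (consequence (recurse (≤-trans le₇ l≤fuel) (subst₂ _<_ (sym k₇) (sym len₇) lt)) λ _ (balanced p st r) →
          balanced (trans p sp₇)
            (λ {i} i<P → trans (st (subst (i <_) (sym sp₇) i<P)) (trans (ag₇ (subst (i <_) (sym sp₆) i<P)) (ag₆ i<P)))
            (step {G = G} W₇ (subst (λ k → Rank G (reg s₇ len) k _) k₇ r)))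

module _ {fuel : ℕ} (recurse : SelectsWithin fuel) {s : State} where

  private
    P n g h : ℕ
    P = reg s sp
    n = reg s len
    g = n / 5
    h = g / 2
    F : ℕ → ℕ
    F i = mem s (P + i)

  Pivot : ℕ → Set
  Pivot v = ∃[ μ ] (Medians {F} {μ} g × Rank μ g h v)

  pivot-rule : ∀ {s′} → g ≤ fuel → h < g → reg s′ sp ≡ 2 + (P + n) → reg s′ groups ≡ g → reg s′ half ≡ h →
    reg s′ ptr ≡ P → reg s′ blen ≡ 5 → reg s′ brank ≡ 2 → s′ agrees s below (P + n) →
    Runs (medians ⨾ block (set tmp 0 ∷ copy len groups ∷ copy rank half ∷ []) ⨾ call select)
      (mediansCost g + (4 + selectRate * g)) (Balanced Pivot s′) s′
  pivot-rule {s′} g≤fuel h<g esp eg eh eptr e5 e2 ag =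
    seq (medians-rule eg e5 e2 (subst₂ _≤_ (cong (_+ g * 5) (sym eptr)) (sym esp) fit)) λ {s₁} κ (ag₁ , med) →
    let g₁ = trans (κ .regs groups) eg
        h₁ = trans (κ .regs half) eh
        sp₁ = κ .regs sp
    in set tmp 0 ∷ copy len groups ∷ copy rank half ∷ [] ∙
    weaken (≤-reflexive (cong (selectRate *_) g₁))
      (consequence (recurse (≤-trans (≤-reflexive g₁) g≤fuel) (subst₂ _<_ (sym h₁) (sym g₁) h<g))
        λ _ (balanced p st o) → balanced (trans p sp₁)
          (λ {i} l → trans (st (subst (i <_) (sym sp₁) l)) (ag₁ l))
          ( (λ l → mem s₁ (reg s′ sp + l))
          , (λ {l} l<g → Rank-cong (λ {i} i<5 → trans (cong (λ a → mem s′ (a + (l * 5 + i))) eptr)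
                (ag (+-monoʳ-< P (<-≤-trans (+-monoʳ-< (l * 5) i<5)
                  (≤-trans (≤-trans (≤-reflexive (+-comm (l * 5) 5)) (*-monoˡ-≤ 5 l<g)) 5g≤n))))) (med l<g))
          , subst₂ (λ a b → Rank (λ l → mem s₁ (reg s′ sp + l)) a b _) g₁ h₁
              (subst (λ a → Rank (λ l → mem s₁ (a + l)) _ _ _) sp₁ o)))
    where
    5g≤n : g * 5 ≤ n
    5g≤n = ≤-trans (m≤n+m _ (n % 5)) (≤-reflexive (sym (m≡m%n+[m/n]*n n 5)))
    fit : P + g * 5 ≤ 2 + (P + n)
    fit = ≤-trans (+-monoʳ-≤ P 5g≤n) (m≤n+m _ 2)

select-rule : ∀ fuel → SelectsWithin fuel
select-rule zero       l h = contradiction (≤-trans h l) λ ()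
select-rule (suc fuel) {s} n≤fuel k<n with 4 <? reg s len
... | no  n≤4 = weaken cost (call-rule select
      (set tmp 4 ∷ sub flag len tmp ∷ [] ∙ else-rule flag (m≤n⇒m∸n≡0 (≮⇒≥ n≤4))
        (set tmp 0 ∷ copy ptr sp ∷ copy blen len ∷ copy brank rank ∷ [] ∙
          consequence (brute-rule refl refl k<n) λ κ r →
            balanced (κ .regs sp) (λ {i} _ → cong (λ h → h i) (κ .memory)) r)))
  where
  cost : suc (3 + suc (5 + bruteCost (reg s len))) ≤ selectRate * reg s len
  cost = ≤-trans (+-monoʳ-≤ 10 (bruteCost-mono (≮⇒≥ n≤4)))
    (≤-trans small-budget (≤-trans (≤-reflexive (sym (*-identityʳ selectRate)))
      (*-monoʳ-≤ selectRate (≤-trans (s≤s z≤n) k<n))))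
... | yes 4<n = weaken (select-budget n g h (n % 5) (g % 2) 1≤g (s≤s⁻¹ (m%n<n n 5)) en eg) (call-rule select
      (set tmp 4 ∷ sub flag len tmp ∷ [] ∙ then-rule flag (m>n⇒m∸n≢0 4<n)
      (set tmp 0 ∷ copy rx len ∷ [] ∙ seq (divide-rule 4) λ {s₁} κ₁ e₁ →
       set tmp 0 ∷ copy groups ry ∷ copy rx ry ∷ [] ∙
       seq (weaken (≤-reflexive (cong (λ g → 5 + g * 7) e₁)) (divide-rule 1)) λ {s₂} κ₂ e₂ →
       set tmp 0 ∷ copy half ry ∷ copy ptr sp ∷ set blen 5 ∷ set brank 2 ∷ add sp sp len ∷ [] ∙
       let sp₂ : reg s₂ sp ≡ reg s sp
           sp₂ = trans (κ₂ .regs sp) (κ₁ .regs sp)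
           len₂ : reg s₂ len ≡ n
           len₂ = trans (κ₂ .regs len) (κ₁ .regs len)
           m₂ : mem s₂ ≡ mem s
           m₂ = trans (κ₂ .memory) (κ₁ .memory)
           top : reg s₂ sp + reg s₂ len ≡ reg s sp + n
           top = cong₂ _+_ sp₂ len₂
           g₂ : reg s₂ groups ≡ g
           g₂ = trans (κ₂ .regs groups) e₁
           h₂ : reg s₂ ry ≡ h
           h₂ = trans e₂ (cong (_/ 2) e₁)
       -- 24 and 25 are `len` and `rank` as offsets from register 6.
       in seq (protect-rule {R = Pivot {fuel} (select-rule fuel) {s}} (24 ∷ 25 ∷ []) λ {s′} esp same ag →
            pivot-rule (select-rule fuel) {s} g≤fuel h<g (trans esp (cong (2 +_) top))
              (trans (same groups) g₂) (trans (same half) h₂) (trans (same ptr) sp₂) (same blen) (same brank)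
              (λ {i} l → trans (ag (subst (i <_) (sym top) l)) (cong (λ m → m i) m₂)))
          λ {s₄} κ₄ (balanced p st (μ , med , mid) , saved) →
          split-rule (select-rule fuel) {s} k<n lim≤fuel
            (few-below (λ i → mem s (reg s sp + i)) {μ} en eg med mid) (few-above (λ i → mem s (reg s sp + i)) {μ} en eg med mid (s≤s⁻¹ (m%n<n g 2)))
            (trans p top) (trans (saved (member 24)) len₂)
            (trans (saved (member 25)) (trans (κ₂ .regs rank) (κ₁ .regs rank)))
            (λ {i} l → trans (st (subst (i <_) (sym top) l)) (cong (λ m → m i) m₂)))))
  where
  n g h lim : ℕ
  n = reg s len
  g = n / 5
  h = g / 2
  lim = n ∸ (g + (h + (g % 2) * 2))
  en : n ≡ n % 5 + g * 5
  en = m≡m%n+[m/n]*n n 5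
  eg : g ≡ g % 2 + h * 2
  eg = m≡m%n+[m/n]*n g 2
  1≤g : 1 ≤ g
  1≤g = n≢0⇒n>0 λ z → <-irrefl refl (<-≤-trans 4<n
          (≤-trans (≤-reflexive (trans en (trans (cong (λ g → n % 5 + g * 5) z) (+-identityʳ _)))) (s≤s⁻¹ (m%n<n n 5))))
  h<g : h < g
  h<g = m/n<m g 2 {{>-nonZero 1≤g}} ≤-refl
  g≤fuel : g ≤ fuel
  g≤fuel = s≤s⁻¹ (<-≤-trans (m/n<m n 5 {{>-nonZero (≤-trans (s≤s z≤n) 4<n)}} (s≤s (s≤s z≤n))) n≤fuel)
  lim≤fuel : lim ≤ fuel
  lim≤fuel = s≤s⁻¹ (<-≤-trans (∸-monoʳ-< (≤-trans 1≤g (m≤m+n g _)) g+e≤n) n≤fuel)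
    where
    open ≤-Reasoning
    g+e≤n : g + (h + (g % 2) * 2) ≤ n
    g+e≤n = begin
      g + (h + (g % 2) * 2)  ≤⟨ +-monoʳ-≤ g (≤-trans (m≤m+n _ (3 * h)) (≤-reflexive (eq h (g % 2)))) ⟩
      g + (g % 2 + h * 2) * 2  ≡⟨ cong (λ k → g + k * 2) (sym eg) ⟩
      g + g * 2  ≤⟨ ≤-trans (m≤m+n _ (2 * g)) (≤-reflexive (eq₂ g)) ⟩
      g * 5  ≤⟨ m≤n+m _ (n % 5) ⟩
      n % 5 + g * 5  ≡⟨ sym en ⟩
      n ∎
      where
      eq : ∀ h ρ → (h + ρ * 2) + 3 * h ≡ (ρ + h * 2) * 2
      eq = solve-∀
      eq₂ : ∀ g → (g + g * 2) + 2 * g ≡ g * 5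
      eq₂ = solve-∀

-- Packings

bit : Bool → ℕ
bit b = if b then 1 else 0

bit-≤1 : ∀ b → bit b ≤ 1
bit-≤1 true  = ≤-refl
bit-≤1 false = z≤n

-- Adding the exchanged terms crosswise avoids truncated subtraction.
Σ-update : ∀ m {j} (f g : ℕ → ℕ) → j < m → (∀ {i} → i ≢ j → f i ≡ g i) → Σ< m f + g j ≡ Σ< m g + f j
Σ-update (suc m) {j} f g l h with m≤n⇒m<n∨m≡n (s≤s⁻¹ l)
... | inj₁ j<m rewrite sym (h (λ e → <⇒≢ j<m (sym e))) = begin
  Σ< m f + f m + g j ≡⟨ swap (Σ< m f) (f m) (g j) ⟩
  Σ< m f + g j + f m ≡⟨ cong (_+ f m) (Σ-update m f g j<m h) ⟩
  Σ< m g + f j + f m ≡⟨ swap (Σ< m g) (f j) (f m) ⟩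
  Σ< m g + f m + f j ∎
  where
  open ≡-Reasoning
  swap : ∀ a b c → a + b + c ≡ a + c + b
  swap = solve-∀
... | inj₂ refl rewrite Σ-cong m {f} {g} (λ l → h (<⇒≢ l)) = swap (Σ< m g) (f m) (g m)
  where
  swap : ∀ a b c → a + b + c ≡ a + c + b
  swap = solve-∀

-- Subfamilies S of m indexed sets, where a j i = 1 if the j-th set contains element i, and 0 otherwise.
record Packing (n m : ℕ) (a : ℕ → ℕ → ℕ) (k t : ℕ) (c q : ℕ → ℕ) : Set where
  constructor packing
  field
    S     : ℕ → Bool
    size  : Σ< m (bit ∘ S) ≡ k
    price : Σ< m (λ j → bit (S j) * q j) ≤ t
    cover : ∀ {i} → i < n → Σ< m (λ j → bit (S j) * a j i) ≤ c i

-- A price of t + 1 excludes set j from all solutions of price at most t.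
without : (ℕ → ℕ) → ℕ → ℕ → (ℕ → ℕ)
without q j t = q [ j ↦ t + 1 ]

remaining : (ℕ → ℕ → ℕ) → (ℕ → ℕ) → ℕ → ℕ → ℕ
remaining a c j i = c i ∸ a j i

module _ {n m : ℕ} {a : ℕ → ℕ → ℕ} where

  Pack : ℕ → ℕ → (ℕ → ℕ) → (ℕ → ℕ) → Set
  Pack = Packing n m a

  empty-pack : ∀ {t c q} → Pack 0 t c q
  empty-pack = packing (λ _ → false) none (≤-trans (≤-reflexive none) z≤n) (λ _ → ≤-trans (≤-reflexive none) z≤n)
    where
    none : Σ< m (λ _ → 0) ≡ 0
    none = Σ-zero m λ _ → refl

  Fits : (ℕ → ℕ) → ℕ → Set
  Fits c j = ∀ {i} → i < n → a j i ≤ c i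

  member-≤ : ∀ {S : ℕ → Bool} (f : ℕ → ℕ) {j} → j < m → S j ≡ true → f j ≤ Σ< m (λ j → bit (S j) * f j)
  member-≤ {S} f {j} j<m e = ≤-trans (≤-reflexive (trans (sym (+-identityʳ (f j))) (cong (λ b → bit b * f j) (sym e))))
                               (Σ-term m _ j<m)

  Σ-members : ∀ {S : ℕ → Bool} {f g : ℕ → ℕ} → (∀ {j} → j < m → S j ≡ true → f j ≡ g j) →
              Σ< m (λ j → bit (S j) * f j) ≡ Σ< m (λ j → bit (S j) * g j)
  Σ-members {S} {f} {g} h = Σ-cong m λ {j} j<m → term j (h j<m)
    where
    term : ∀ j → (S j ≡ true → f j ≡ g j) → bit (S j) * f j ≡ bit (S j) * g j
    term j h with S j
    ... | true  = cong (1 *_) (h refl)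
    ... | false = refl

  Filtered : (t : ℕ) (c q q′ : ℕ → ℕ) → Set
  Filtered t c q q′ = ∀ {j} → j < m → (q′ j ≡ q j × Fits c j) ⊎ (q′ j ≡ t + 1 × ¬ Fits c j)

  module _ {k t : ℕ} {c q q′ : ℕ → ℕ} (filtered : Filtered t c q q′) where

    filtered-fits : ∀ {j} → j < m → q′ j ≤ t → Fits c j
    filtered-fits j<m le with filtered j<m
    ... | inj₁ (_ , f) = f
    ... | inj₂ (e , _) = contradiction (subst (_≤ t) (trans e (+-comm t 1)) le) (<-irrefl refl)

    -- Each member of a packing fits on its own, so only prices of non-members are raised.
    filter-pack : Pack k t c q → Pack k t c q′
    filter-pack (packing S sz pr co) = packing S sz (subst (_≤ t) (Σ-members {S} same) pr) co
      where
      same : ∀ {j} → j < m → S j ≡ true → q j ≡ q′ j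
      same {j} j<m e with filtered j<m
      ... | inj₁ (e′ , _) = sym e′
      ... | inj₂ (_ , nf) = contradiction (λ {i} i<n → ≤-trans (member-≤ {S} (λ j → a j i) j<m e) (co i<n)) nf

    members-cheap : ∀ {S : ℕ → Bool} → Σ< m (λ j → bit (S j) * q′ j) ≤ t → ∀ {j} → j < m → S j ≡ true → q′ j ≤ t
    members-cheap {S} pr j<m e = ≤-trans (member-≤ {S} q′ j<m e) pr

    unfilter-pack : Pack k t c q′ → Pack k t c q
    unfilter-pack (packing S sz pr co) = packing S sz (subst (_≤ t) (Σ-members {S} same) pr) co
      where
      same : ∀ {j} → j < m → S j ≡ true → q′ j ≡ q j
      same {j} j<m e with filtered j<m
      ... | inj₁ (e′ , _) = e′
      ... | inj₂ (e′ , _) = contradiction (subst (_≤ t) (trans e′ (+-comm t 1)) (members-cheap {S} pr j<m e)) (<-irrefl refl)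

  private
    put : (ℕ → Bool) → ℕ → Bool → ℕ → Bool
    put S j b i = if i ≡ᵇ j then b else S i

    put-same : ∀ S j b → put S j b j ≡ b
    put-same S j b rewrite ≡ᵇ-refl j = refl

    put-other : ∀ S {i j} b → i ≢ j → put S j b i ≡ S i
    put-other S b h rewrite ≡ᵇ-≢ h = refl

    drop : ∀ S {j} (f : ℕ → ℕ) → j < m → S j ≡ true →
           Σ< m (λ i → bit (put S j false i) * f i) + f j ≡ Σ< m (λ i → bit (S i) * f i)
    drop S {j} f j<m e = begin
      Σ< m (λ i → bit (put S j false i) * f i) + f j  ≡⟨ cong (Σ< m (λ i → bit (put S j false i) * f i) +_) (trans (sym (+-identityʳ (f j))) (cong (λ b → bit b * f j) (sym e))) ⟩
      Σ< m (λ i → bit (put S j false i) * f i) + bit (S j) * f j  ≡⟨ Σ-update m _ _ j<m (λ {i} ne → cong (λ b → bit b * f i) (put-other S false ne)) ⟩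
      Σ< m (λ i → bit (S i) * f i) + bit (put S j false j) * f j  ≡⟨ cong (λ b → Σ< m (λ i → bit (S i) * f i) + bit b * f j) (put-same S j false) ⟩
      Σ< m (λ i → bit (S i) * f i) + 0  ≡⟨ +-identityʳ _ ⟩
      Σ< m (λ i → bit (S i) * f i)  ∎
      where open ≡-Reasoning

    add-member : ∀ S {j} (f g : ℕ → ℕ) → j < m → S j ≡ false → (∀ {i} → i ≢ j → f i ≡ g i) →
           Σ< m (λ i → bit (put S j true i) * f i) ≡ Σ< m (λ i → bit (S i) * g i) + f j
    add-member S {j} f g j<m e h = begin
      Σ< m (λ i → bit (put S j true i) * f i)  ≡⟨ sym (+-identityʳ _) ⟩
      Σ< m (λ i → bit (put S j true i) * f i) + 0  ≡⟨ cong (λ b → Σ< m (λ i → bit (put S j true i) * f i) + bit b * g j) (sym e) ⟩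
      Σ< m (λ i → bit (put S j true i) * f i) + bit (S j) * g j  ≡⟨ Σ-update m _ _ j<m (λ {i} ne → cong₂ (λ b v → bit b * v) (put-other S true ne) (h ne)) ⟩
      Σ< m (λ i → bit (S i) * g i) + bit (put S j true j) * f j  ≡⟨ cong (λ b → Σ< m (λ i → bit (S i) * g i) + bit b * f j) (put-same S j true) ⟩
      Σ< m (λ i → bit (S i) * g i) + 1 * f j  ≡⟨ cong (Σ< m (λ i → bit (S i) * g i) +_) (+-identityʳ (f j)) ⟩
      Σ< m (λ i → bit (S i) * g i) + f j  ∎
      where open ≡-Reasoning

    size-1 : ∀ (S : ℕ → Bool) → Σ< m (bit ∘ S) ≡ Σ< m (λ i → bit (S i) * 1)
    size-1 S = Σ-cong m λ {i} _ → sym (*-identityʳ (bit (S i)))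

    drop-size : ∀ S {j k} → Σ< m (bit ∘ S) ≡ suc k → j < m → S j ≡ true → Σ< m (bit ∘ put S j false) ≡ k
    drop-size S {j} sz j<m e = suc-injective (trans (+-comm 1 _) (trans (cong (_+ 1) (size-1 (put S j false)))
      (trans (drop S (λ _ → 1) j<m e) (trans (sym (size-1 S)) sz))))

  -- The smaller packing cannot contain j already, since the price t + 1 of j exceeds t ∸ q j.
  extend : ∀ {j k t c q} → j < m → q j ≤ t → Fits c j → Pack k (t ∸ q j) (remaining a c j) (without q j t) → Pack (suc k) t c q
  extend {j} {k} {t} {c} {q} j<m qj≤t fits (packing S sz pr co) = packing (put S j true)
    (trans (size-1 (put S j true)) (trans (add-member S (λ _ → 1) (λ _ → 1) j<m new (λ _ → refl))
      (trans (cong (_+ 1) (trans (sym (size-1 S)) sz)) (+-comm k 1))))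
    (≤-trans (≤-reflexive (add-member S q (without q j t) j<m new (λ ne → sym (update-other q ne))))
      (≤-trans (+-monoˡ-≤ (q j) pr) (≤-reflexive (m∸n+n≡m qj≤t))))
    (λ {i} i<n → ≤-trans (≤-reflexive (add-member S (λ j → a j i) (λ j → a j i) j<m new (λ _ → refl)))
      (≤-trans (+-monoˡ-≤ (a j i) (co i<n)) (≤-reflexive (m∸n+n≡m (fits i<n)))))
    where
    new : S j ≡ false
    new with S j in e
    ... | false = refl
    ... | true  = contradiction (≤-trans (≤-reflexive (trans (+-comm 1 t) (sym (update-same q j))))
                    (≤-trans (member-≤ {S} (without q j t) j<m e) (≤-trans pr (m∸n≤m t (q j))))) (<-irrefl refl)

  -- An optimal choice either meets the cheapest set jm or may be changed, by exchanging any member for jm.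
  exchange : ∀ {k t c q jm} {M : ℕ → Set} → (∀ j → Dec (M j)) → jm < m → M jm →
    (∀ {j} → ¬ M j → ∀ {i} → i < n → a j i ≡ 0 ⊎ a jm i ≡ 0) →
    (∀ {j} → j < m → q j ≤ t → q jm ≤ q j) → Pack (suc k) t c q →
    ∃[ j ] (j < m × M j × q j ≤ t × Pack k (t ∸ q j) (remaining a c j) (without q j t))
  exchange {k} {t} {c} {q} {jm} {M} M? jm<m Mjm disjoint cheapest (packing S sz pr co)
    with anyUpTo? (λ j → S j Data.Bool.≟ true ×-dec M? j) m
  ... | yes (j , j<m , e , Mj) = j , j<m , Mj , ≤-trans (member-≤ {S} q j<m e) pr , packing (put S j false)
        (drop-size S sz j<m e)
        (m+n≤o⇒m≤o∸n _ (≤-trans (≤-reflexive (trans (cong (_+ q j) (Σ-members {put S j false} away)) (drop S q j<m e))) pr))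
        (λ {i} i<n → m+n≤o⇒m≤o∸n _ (≤-trans (≤-reflexive (drop S (λ j → a j i) j<m e)) (co i<n)))
    where
    away : ∀ {i} → i < m → put S j false i ≡ true → without q j t i ≡ q i
    away {i} _ e′ = update-other q λ { refl → contradiction (trans (sym e′) (put-same S j false)) λ () }
  -- No member is a candidate, so an arbitrary member j gives way to jm, which costs no more than j.
  ... | no none = jm , jm<m , Mjm , ≤-trans (cheapest j<m (≤-trans (member-≤ {S} q j<m e) pr)) (≤-trans (member-≤ {S} q j<m e) pr) , packing (put S j false)
        (drop-size S sz j<m e)
        (≤-trans (m+n≤o⇒m≤o∸n _ (≤-trans (≤-reflexive (trans (cong (_+ q j) (Σ-members {put S j false} away)) (drop S q j<m e))) pr))
          (∸-monoʳ-≤ t (cheapest j<m (≤-trans (member-≤ {S} q j<m e) pr))))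
        cover
    where
    some : ∃[ j ] (j < m × 0 < bit (S j))
    some = Σ-positive m (bit ∘ S) (≤-trans (s≤s z≤n) (≤-reflexive (sym sz)))
    j = proj₁ some
    j<m = proj₁ (proj₂ some)
    e : S j ≡ true
    e with S j | proj₂ (proj₂ some)
    ... | true | _ = refl
    put-⊆ : ∀ {i} → put S j false i ≡ true → S i ≡ true
    put-⊆ {i} e′ with i ≡ᵇ j
    ... | false = e′
    away : ∀ {i} → i < m → put S j false i ≡ true → without q jm t i ≡ q i
    away {i} i<m e′ = update-other q λ { refl → none (jm , jm<m , put-⊆ e′ , Mjm) }
    -- If i lies in jm, no member contains i and the sum is 0; otherwise the capacity of i is not
    -- reduced.
    cover : ∀ {i} → i < n → Σ< m (λ l → bit (put S j false l) * a l i) ≤ (remaining a c jm) i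
    cover {i} i<n with a jm i ≟ 0
    ... | yes z rewrite z = ≤-trans (m≤m+n _ (a j i)) (≤-trans (≤-reflexive (drop S (λ l → a l i) j<m e)) (co i<n))
    ... | no nz = ≤-trans (≤-reflexive (trans (Σ-members {put S j false} {g = λ _ → 0} λ {l} l<m e′ →
          case disjoint {l} (λ Ml → none (l , l<m , put-⊆ e′ , Ml)) i<n of λ where
            (inj₁ z) → z
            (inj₂ z) → contradiction z nz) (Σ-zero m λ {l} _ → *-zeroʳ (bit (put S j false l))))) z≤n

  -- The number of sets that meet the set jm; e j indicates j = jm, in case that set is empty.
  meeting-≤ : ∀ {jm s o} (e : ℕ → ℕ) → jm < m → (∀ j i → a j i ≤ 1) →
    Σ< n (a jm) ≤ s → (∀ {i} → i < n → Σ< m (λ j → a j i) ≤ o) →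
    (∀ {j} → j ≢ jm → e j ≡ 0) →
    Σ< m (λ j → sign (e j + Σ< n (λ i → (a j i + a jm i) ∸ 1))) ≤ 1 ⊔ (s * o)
  meeting-≤ {jm} {s} {o} e jm<m a≤1 row col e0 with Σ< n (a jm) ≟ 0
  -- An empty set meets nothing, so jm alone is counted, through e.
  ... | yes z = ≤-trans (subst (_≤ 1) Σ≡ (m∸n≤m 1 (1 ∸ meets jm))) (m≤m⊔n 1 (s * o))
    where
    meets : ℕ → ℕ
    meets j = e j + Σ< n (λ i → (a j i + a jm i) ∸ 1)
    a0 : ∀ {i} → i < n → a jm i ≡ 0
    a0 {i} i<n = n≤0⇒n≡0 (≤-trans (Σ-term n (a jm) i<n) (≤-reflexive z))
    alone : ∀ {j} → j ≢ jm → sign (meets j) ≡ 0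
    alone {j} ne = cong sign (cong₂ _+_ (e0 ne) (Σ-zero n λ {i} i<n →
      m≤n⇒m∸n≡0 (subst (λ v → a j i + v ≤ 1) (sym (a0 i<n)) (subst (_≤ 1) (sym (+-identityʳ _)) (a≤1 j i)))))
    Σ≡ : sign (meets jm) ≡ Σ< m (sign ∘ meets)
    Σ≡ = sym (trans (sym (+-identityʳ _)) (trans (Σ-update m (sign ∘ meets) (λ _ → 0) jm<m alone)
           (cong (_+ sign (meets jm)) (Σ-zero m λ _ → refl))))
  ... | no nz = begin
    Σ< m (λ j → sign (e j + Σ< n (λ i → (a j i + a jm i) ∸ 1)))  ≤⟨ Σ-mono m (λ {j} _ → one j) ⟩
    Σ< m (λ j → Σ< n (λ i → a jm i * a j i))  ≡⟨ Σ-swap m n (λ j i → a jm i * a j i) ⟩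
    Σ< n (λ i → Σ< m (λ j → a jm i * a j i))  ≡⟨ Σ-cong n (λ {i} _ → Σ-* m (a jm i) (λ j → a j i)) ⟩
    Σ< n (λ i → a jm i * Σ< m (λ j → a j i))  ≤⟨ Σ-mono n (λ {i} i<n → *-monoʳ-≤ (a jm i) (col i<n)) ⟩
    Σ< n (λ i → a jm i * o)  ≡⟨ Σ-cong n (λ {i} _ → *-comm (a jm i) o) ⟩
    Σ< n (λ i → o * a jm i)  ≡⟨ Σ-* n o (a jm) ⟩
    o * Σ< n (a jm)  ≤⟨ *-monoʳ-≤ o row ⟩
    o * s  ≡⟨ *-comm o s ⟩
    s * o  ≤⟨ m≤n⊔m 1 (s * o) ⟩
    1 ⊔ (s * o)  ∎
    where
    open ≤-Reasoning
    meet-bits : ∀ {u v} → u ≤ 1 → v ≤ 1 → (u + v) ∸ 1 ≡ v * u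
    meet-bits z≤n       z≤n       = refl
    meet-bits z≤n       (s≤s z≤n) = refl
    meet-bits (s≤s z≤n) z≤n       = refl
    meet-bits (s≤s z≤n) (s≤s z≤n) = refl
    product : ∀ j → Σ< n (λ i → (a j i + a jm i) ∸ 1) ≡ Σ< n (λ i → a jm i * a j i)
    product j = Σ-cong n λ {i} _ → meet-bits (a≤1 j i) (a≤1 jm i)
    sign-≤ : ∀ v → sign v ≤ v
    sign-≤ zero    = z≤n
    sign-≤ (suc v) = ≤-trans (≤-reflexive (sign-pos {suc v} λ ())) (s≤s z≤n)
    square : ∀ {u} → u ≤ 1 → u * u ≡ u
    square z≤n       = refl
    square (s≤s z≤n) = refl
    one : ∀ j → sign (e j + Σ< n (λ i → (a j i + a jm i) ∸ 1)) ≤ Σ< n (λ i → a jm i * a j i)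
    one j with j ≟ jm
    ... | no  ne rewrite e0 ne = ≤-trans (sign-≤ _) (≤-reflexive (product j))
    -- For jm itself the right side is its size, here at least 1, so the indicator e costs nothing
    -- extra.
    ... | yes refl = ≤-trans (m∸n≤m 1 (1 ∸ (e j + Σ< n (λ i → (a j i + a j i) ∸ 1)))) (≤-trans (n≢0⇒n>0 nz) (≤-reflexive (Σ-cong n λ {i} _ → sym (square (a≤1 j i)))))

  -- When no element is in two sets, every selection of sets that fit is a packing.
  Choice : ℕ → ℕ → (ℕ → ℕ) → Set
  Choice k t q = Σ[ S ∈ (ℕ → Bool) ] (Σ< m (bit ∘ S) ≡ k × Σ< m (λ j → bit (S j) * q j) ≤ t)

  choice-pack : ∀ {k t c q q′} → Filtered t c q q′ → (∀ {i} → i < n → Σ< m (λ j → a j i) ≤ 1) →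
                Choice k t q′ → Pack k t c q′
  choice-pack {k} {t} {c} {q} {q′} filtered col (S , sz , pr) = packing S sz pr cover
    where
    cover : ∀ {i} → i < n → Σ< m (λ j → bit (S j) * a j i) ≤ c i
    cover {i} i<n with Σ< m (λ j → bit (S j) * a j i) ≟ 0
    ... | yes z = subst (_≤ c i) (sym z) z≤n
    ... | no nz with Σ-positive m (λ j → bit (S j) * a j i) (n≢0⇒n>0 nz)
    ...   | j , j<m , h = ≤-trans (Σ-mono m λ {j} _ → ≤-bit (S j) (a j i)) (≤-trans (col i<n) (found (S j) refl h))
      where
      ≤-bit : ∀ b v → bit b * v ≤ v
      ≤-bit true  v = ≤-reflexive (+-identityʳ v)
      ≤-bit false v = z≤n
      found : ∀ b → S j ≡ b → 0 < bit b * a j i → 1 ≤ c i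
      found true e h = ≤-trans (subst (0 <_) (+-identityʳ (a j i)) h)
        (filtered-fits {k} {t} {c} {q} {q′} filtered j<m (members-cheap {k} {t} {c} {q} {q′} filtered {S} pr j<m e) i<n)

  module _ {k t v : ℕ} {q : ℕ → ℕ} where

    -- Weak duality: q j + (v ∸ q j) ≥ v for each chosen j.
    choice⇒bound : Choice k t q → k * v ≤ Σ< m (λ j → v ∸ q j) + t
    choice⇒bound (S , sz , pr) = begin
      k * v  ≡⟨ cong (_* v) (sym sz) ⟩
      Σ< m (bit ∘ S) * v  ≡⟨ *-comm _ v ⟩
      v * Σ< m (bit ∘ S)  ≡⟨ sym (Σ-* m v (bit ∘ S)) ⟩
      Σ< m (λ j → v * bit (S j))  ≤⟨ Σ-mono m (λ {j} _ → term (S j) (q j)) ⟩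
      Σ< m (λ j → (v ∸ q j) + bit (S j) * q j)  ≡⟨ Σ-+ m _ _ ⟩
      Σ< m (λ j → v ∸ q j) + Σ< m (λ j → bit (S j) * q j)  ≤⟨ +-monoʳ-≤ _ pr ⟩
      Σ< m (λ j → v ∸ q j) + t  ∎
      where
      open ≤-Reasoning
      term : ∀ b u → v * bit b ≤ (v ∸ u) + bit b * u
      term true  u rewrite *-identityʳ v | +-identityʳ u = ≤-trans (m≤n+m∸n v u) (≤-reflexive (+-comm u (v ∸ u)))
      term false u rewrite *-zeroʳ v = z≤n

    private
      -- f marks the forced indices and g the allowed ones. From the last index down, an index is
      -- left out if it is not forced and the allowed ones before it still suffice for k; otherwise
      -- it is taken, and the bounds on k remain valid after lowering it by one.
      interpolate : ∀ {k f g} l → (∀ {j} → j < l → f j ≤ g j × g j ≤ 1) → Σ< l f ≤ k → k ≤ Σ< l g →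
        Σ[ S ∈ (ℕ → Bool) ] (Σ< l (bit ∘ S) ≡ k × (∀ {j} → j < l → f j ≤ bit (S j) × bit (S j) ≤ g j))
      interpolate zero h lo hi = (λ _ → false) , sym (n≤0⇒n≡0 hi) , λ ()
      interpolate {k} {f} {g} (suc l) h lo hi = case ((f l ≟ 0) ×-dec (k ≤? Σ< l g)) of λ where
          (yes (z , k≤)) → step false k (+-identityʳ k) (≤-reflexive z) z≤n (≤-trans (m≤m+n _ (f l)) lo) k≤
          (no  nb) → let 0<k = positive nb in
            step true (pred k) (trans (+-comm (pred k) 1) (suc-pred k {{>-nonZero 0<k}})) (≤-trans (proj₁ (h (n<1+n l))) (proj₂ (h (n<1+n l))))
              (one nb)
              (s≤s⁻¹ (≤-trans (many nb) (≤-reflexive (sym (suc-pred k {{>-nonZero 0<k}})))))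
              (s≤s⁻¹ (≤-trans (≤-reflexive (suc-pred k {{>-nonZero 0<k}}))
                (≤-trans hi (≤-trans (+-monoʳ-≤ (Σ< l g) (proj₂ (h (n<1+n l)))) (≤-reflexive (+-comm _ 1))))))
        where
        many : ¬ (f l ≡ 0 × k ≤ Σ< l g) → suc (Σ< l f) ≤ k
        many nb with f l ≟ 0
        ... | no  nz = ≤-trans (≤-reflexive (+-comm 1 _)) (≤-trans (+-monoʳ-≤ (Σ< l f) (n≢0⇒n>0 nz)) lo)
        ... | yes z  = ≤-trans (s≤s (Σ-mono l λ j<l → proj₁ (h (m<n⇒m<1+n j<l)))) (≰⇒> λ k≤ → nb (z , k≤))
        positive : ¬ (f l ≡ 0 × k ≤ Σ< l g) → 0 < k
        positive nb = ≤-trans (s≤s z≤n) (many nb)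
        one : ¬ (f l ≡ 0 × k ≤ Σ< l g) → 1 ≤ g l
        one nb = n≢0⇒n>0 λ z → nb (n≤0⇒n≡0 (subst (f l ≤_) z (proj₁ (h (n<1+n l)))) ,
          ≤-trans hi (≤-reflexive (trans (cong (Σ< l g +_) z) (+-identityʳ _))))
        step : ∀ b k′ → k′ + bit b ≡ k → f l ≤ bit b → bit b ≤ g l → Σ< l f ≤ k′ → k′ ≤ Σ< l g →
          Σ[ S ∈ (ℕ → Bool) ] (Σ< (suc l) (bit ∘ S) ≡ k × (∀ {j} → j < suc l → f j ≤ bit (S j) × bit (S j) ≤ g j))
        step b k′ e fb bg lo′ hi′ = put S l b
          , trans (cong₂ _+_ (trans (Σ-cong l λ j<l → cong bit (put-other S b (<⇒≢ j<l))) sz) (cong bit (put-same S l b))) e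
          , λ {j} j<1+l → case m≤n⇒m<n∨m≡n (s≤s⁻¹ j<1+l) of λ where
              (inj₁ j<l)  → subst (λ b → f j ≤ bit b × bit b ≤ g j) (sym (put-other S b (<⇒≢ j<l))) (between j<l)
              (inj₂ refl) → subst (λ b → f l ≤ bit b × bit b ≤ g l) (sym (put-same S l b)) (fb , bg)
          where
          R = interpolate l (λ j<l → h (m<n⇒m<1+n j<l)) lo′ hi′
          S = proj₁ R
          sz = proj₁ (proj₂ R)
          between = proj₂ (proj₂ R)

    -- Equality holds for a choice that contains every j with q j < v and only j with q j ≤ v.
    bound⇒choice : #< q m v ≤ k → k ≤ #≤ q m v → k * v ≤ Σ< m (λ j → v ∸ q j) + t → Choice k t q
    bound⇒choice lower upper h =
      S , sz , +-cancelˡ-≤ (Σ< m (λ j → v ∸ q j)) _ _ (≤-trans (≤-reflexive tight) h)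
      where
      lt≤le : ∀ u → lt u v ≤ le u v
      lt≤le u with u <? v
      ... | yes l rewrite le-yes (<⇒≤ l) = lt-≤1 u v
      ... | no  l rewrite lt-no (≮⇒≥ l) = z≤n
      R = interpolate {k} m (λ {j} _ → lt≤le (q j) , le-≤1 (q j) v) lower upper
      S = proj₁ R
      sz = proj₁ (proj₂ R)
      term : ∀ b u → lt u v ≤ bit b → bit b ≤ le u v → (v ∸ u) + bit b * u ≡ v * bit b
      term true  u _ h with u ≤? v
      ... | yes l rewrite *-identityʳ v | +-identityʳ u = m∸n+n≡m l
      ... | no  l rewrite le-no (≰⇒> l) = contradiction h λ ()
      term false u h _ with u <? v
      ... | yes l rewrite lt-yes l = contradiction h λ ()
      ... | no  l rewrite m≤n⇒m∸n≡0 (≮⇒≥ l) | *-zeroʳ v = refl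
      tight : Σ< m (λ j → v ∸ q j) + Σ< m (λ j → bit (S j) * q j) ≡ k * v
      tight = trans (sym (Σ-+ m _ _)) (trans
        (Σ-cong m λ {j} j<m → term (S j) (q j) (proj₁ (proj₂ (proj₂ R) j<m)) (proj₂ (proj₂ (proj₂ R) j<m)))
        (trans (Σ-* m v (bit ∘ S)) (trans (*-comm v _) (cong (_* v) sz))))

-- The branching search

fittingStep : ℕ → ℕ
fittingStep n = 7 + (loopCost n + (2 + (suc (3 + 1) + (3 + (suc (4 + 1) + 6)))))

fittingCost : ℕ → ℕ → ℕ
fittingCost n m = 10 + suc (m * (fittingStep n + 4))

branchCost : ℕ → ℕ → ℕ
branchCost n b = 9 + (loopCost n + (6 + ((72 + (5 + b)) + 3)))

scanCost : ℕ → ℕ → ℕ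
scanCost n b = 12 + (loopCost n + (3 + (suc (suc (branchCost n b)) + 4)))

-- The time of a search with remaining budget k, when at most B branches leave each node.
searchTime : ℕ → ℕ → ℕ → ℕ → ℕ
searchTime n m B zero    = 4
searchTime n m B (suc k) = 2 + (fittingCost n m + (8 + (suc (m * (scanCost n 0 + 4) + B * searchTime n m B k) + 2)))

module _ {n m : ℕ} {a : ℕ → ℕ → ℕ} where

  record Matrix (L : ℕ) (s : State) : Set where
    field
      rn≡  : reg s rn ≡ n
      rm≡  : reg s rm ≡ m
      fits : reg s matrix + m * n ≤ L
      rows : ∀ {j i} → j < m → i < n → mem s (reg s matrix + j * n + i) ≡ a j i

  record Level (c q : ℕ → ℕ) (s : State) : Set where
    field
      caps-top   : reg s caps + n ≤ reg s sp
      costs-top  : reg s costs + m ≤ reg s sp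
      caps-cell  : ∀ {i} → i < n → mem s (reg s caps + i) ≡ c i
      costs-cell : ∀ {j} → j < m → mem s (reg s costs + j) ≡ q j

  open Matrix
  open Level

  private
    row-next : ∀ A i → A + i * n + n ≡ A + suc i * n
    row-next A i = trans (+-assoc A (i * n) n) (cong (A +_) (+-comm (i * n) n))

    row-top : ∀ A {j} → j < m → A + j * n + n ≤ A + m * n
    row-top A {j} j<m = ≤-trans (≤-reflexive (row-next A j)) (+-monoʳ-≤ A (*-monoˡ-≤ n j<m))

  row-fits : ∀ {L s j} → Matrix L s → j < m → reg s matrix + j * n + n ≤ L
  row-fits {s = s} M j<m = ≤-trans (row-top (reg s matrix) j<m) (fits M)

  matrix-transfer : ∀ {L s s′} → Matrix L s → reg s′ rn ≡ reg s rn → reg s′ rm ≡ reg s rm →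
    reg s′ matrix ≡ reg s matrix → s′ agrees s below L → Matrix L s′
  matrix-transfer M e₁ e₂ e₃ ag .rn≡ = trans e₁ (rn≡ M)
  matrix-transfer M e₁ e₂ e₃ ag .rm≡ = trans e₂ (rm≡ M)
  matrix-transfer M e₁ e₂ e₃ ag .fits = subst (λ b → b + m * n ≤ _) (sym e₃) (fits M)
  matrix-transfer {s = s} {s′} M e₁ e₂ e₃ ag .rows {j} {i} j<m i<n =
    trans (cong (λ b → mem s′ (b + j * n + i)) e₃)
      (trans (ag (<-≤-trans (+-monoʳ-< _ i<n) (row-fits M j<m))) (rows M j<m i<n))

  record Fitted (t : ℕ) (c q : ℕ → ℕ) (s s′ : State) : Set where
    field
      unchanged : s′ agrees s below reg s sp
      filtered  : Filtered {n} {m} {a} t c q (λ j → mem s′ (reg s sp + j))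
      big≡      : reg s′ big ≡ t + 1
      {jm}      : ℕ
      jm<m      : jm < m
      bestRow≡  : reg s′ bestRow ≡ reg s matrix + jm * n
      cheapest  : ∀ {j} → j < m → mem s′ (reg s sp + j) ≤ t → mem s′ (reg s sp + jm) ≤ mem s′ (reg s sp + j)

  fitting-rule : ∀ {L s t c q} → 1 ≤ m → Matrix L s → L ≤ reg s sp → Level c q s → reg s money ≡ t →
    Runs fitting (fittingCost n m) (Fitted t c q s) s
  fitting-rule {L} {s} {t} {c} {q} 1≤m M L≤sp V et = prelude ∙ consequence
    (uniform m _ (repeat-rule I (λ _ → fittingStep n) m (rm≡ M)
      record { agrees₀ = λ _ → refl ; done = λ () ; dest≡ = sym (+-identityʳ P) ; col≡ = sym (+-identityʳ _)
             ; row≡ = sym (+-identityʳ _) ; jm<m = 1≤m ; bestRow≡ = sym (+-identityʳ _)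
             ; attained = λ le → contradiction (subst (_≤ t) (cong (_+ 1) et) le) (<⇒≱ (m<m+n t (s≤s z≤n)))
             ; least = λ () }
      step))
    λ κ J → record { unchanged = I.agrees₀ J ; filtered = I.done J ; big≡ = trans (κ .regs big) (cong (_+ 1) et)
                   ; jm<m = I.jm<m J ; bestRow≡ = I.bestRow≡ J
                   ; cheapest = λ j<m le → let b≤ = I.least J j<m le in
                       ≤-trans (≤-reflexive (proj₂ (I.attained J (≤-trans b≤ le)))) b≤ }
    where
    prelude = set tmp 0 ∷ copy dest sp ∷ copy col costs ∷ copy row matrix ∷ copy counter rm ∷ copy bestRow matrix
              ∷ set tmp 1 ∷ add big money tmp ∷ add best money tmp ∷ []
    P A : ℕ
    P = reg s sp
    A = reg s matrix
    Price : ℕ → ℕ → Set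
    Price j v = (v ≡ q j × Fits {n} {m} {a} c j) ⊎ (v ≡ t + 1 × ¬ Fits {n} {m} {a} c j)
    record I (i : ℕ) (s′ : State) : Set where
      field
        agrees₀  : s′ agrees s below P
        done     : ∀ {j} → j < i → Price j (mem s′ (P + j))
        dest≡    : reg s′ dest ≡ P + i
        col≡     : reg s′ col ≡ reg s costs + i
        row≡     : reg s′ row ≡ A + i * n
        {jm}     : ℕ
        jm<m     : jm < m
        bestRow≡ : reg s′ bestRow ≡ A + jm * n
        -- While `best` > t no affordable set has been seen, and jm is an arbitrary row.
        attained : reg s′ best ≤ t → jm < i × mem s′ (P + jm) ≡ reg s′ best
        least    : ∀ {j} → j < i → mem s′ (P + j) ≤ t → reg s′ best ≤ mem s′ (P + j)
    step : ∀ i {s′} → i < m → Keeps (repeat counter fittingBody) (exec prelude s) s′ → I i s′ →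
           Runs fittingBody (fittingStep n) (λ s″ → I (suc i) (exec (decrement counter) s″)) s′
    step i {s′} i<m κ J =
      pointers row caps rn ∙ seq (sum-rule diff n (trans (κ .regs rn) (rn≡ M)) refl) λ {s₁} κ₁ e₁ →
      load item col ∷ [] ∙ seq {R = λ s₃ → Price i (reg s₃ item)}
        (if-rule acc
          (λ nz → block-rule (set tmp 0 ∷ copy item big ∷ [])
            (inj₂ ( trans (κ₁ .regs big) (trans (κ .regs big) (cong (_+ 1) et))
                  , λ f → nz (trans (excess₁ e₁) (Σ-zero n λ i<n → m≤n⇒m∸n≡0 (f i<n))))))
          (λ z → skip-rule (inj₁
            ( trans (cong₂ (λ h b → h b) (κ₁ .memory) (trans (κ₁ .regs col) (I.col≡ J)))
                (trans (I.agrees₀ J (<-≤-trans (+-monoʳ-< _ i<m) (costs-top V))) (costs-cell V i<m))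
            , λ {l} l<n → m∸n≡0⇒m≤n (n≤0⇒n≡0 (≤-trans (Σ-term n (λ l → a i l ∸ c l) l<n)
                (≤-reflexive (trans (sym (excess₁ e₁)) z))))))))
      λ {s₃} κ₃ price →
      store dest item ∷ sub flag best item ∷ [] ∙
      let s₄ = exec (store dest item ∷ sub flag best item ∷ []) s₃
          w = reg s₃ item
          m₃ : mem s₃ ≡ mem s′
          m₃ = trans (κ₃ .memory) (κ₁ .memory)
          dest₃ : reg s₃ dest ≡ P + i
          dest₃ = trans (κ₃ .regs dest) (trans (κ₁ .regs dest) (I.dest≡ J))
          row₃ = trans (κ₃ .regs row) (trans (κ₁ .regs row) (I.row≡ J))
          best₃ = trans (κ₃ .regs best) (κ₁ .regs best)
          stored : ∀ {b} → b ≢ P + i → mem s₄ b ≡ mem s′ b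
          stored {b} ne = trans (update-other (mem s₃) (λ e → ne (trans e dest₃))) (cong (λ h → h b) m₃)
          older : ∀ {j} → j < i → mem s₄ (P + j) ≡ mem s′ (P + j)
          older j<i = stored λ e → <⇒≢ j<i (+-cancelˡ-≡ P _ _ e)
          new : mem s₄ (P + i) ≡ w
          new = trans (cong (mem s₄) (sym dest₃)) (update-same (mem s₃) (reg s₃ dest))
          old-least : ∀ {j} → j < i → mem s₄ (P + j) ≤ t → reg s′ best ≤ mem s₄ (P + j)
          old-least j<i le = subst (reg s′ best ≤_) (sym (older j<i)) (I.least J j<i (subst (_≤ t) (older j<i) le))
      in seq {R = λ s₅ → ∃[ jm ] (jm < m × reg s₅ bestRow ≡ A + jm * n ×
               (reg s₅ best ≤ t → jm < suc i × mem s₄ (P + jm) ≡ reg s₅ best) ×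
               (∀ {j} → j < suc i → mem s₄ (P + j) ≤ t → reg s₅ best ≤ mem s₄ (P + j)))}
        (if-rule flag
          (λ nz → let w<b : w < reg s′ best
                      w<b = subst (w <_) best₃ (≰⇒> λ le → nz (m≤n⇒m∸n≡0 le)) in
            block-rule (set tmp 0 ∷ copy best item ∷ copy bestRow row ∷ [])
            ( i , i<m , row₃ , (λ _ → n<1+n i , new)
            , λ {j} j<1+i le → case m≤n⇒m<n∨m≡n (s≤s⁻¹ j<1+i) of λ where
                (inj₁ j<i)  → ≤-trans (<⇒≤ w<b) (old-least j<i le)
                (inj₂ refl) → ≤-reflexive (sym new) ))
          (λ z → skip-rule
            ( I.jm J , I.jm<m J , trans (κ₃ .regs bestRow) (trans (κ₁ .regs bestRow) (I.bestRow≡ J))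
            , (λ le → let jm<i , e = I.attained J (subst (_≤ t) best₃ le) in
                m<n⇒m<1+n jm<i , trans (older jm<i) (trans e (sym best₃)))
            , λ {j} j<1+i le → case m≤n⇒m<n∨m≡n (s≤s⁻¹ j<1+i) of λ where
                (inj₁ j<i)  → subst (_≤ _) (sym best₃) (old-least j<i le)
                (inj₂ refl) → ≤-trans (m∸n≡0⇒m≤n z) (≤-reflexive (sym new)) )))
      λ {s₅} κ₅ (jm , jm<m , eb , att , lst) →
      let m₅ : ∀ b → mem s₅ b ≡ mem s₄ b
          m₅ b = cong (λ h → h b) (κ₅ .memory)
      in block-rule (increment dest ++ increment col ++ add row row rn ∷ []) record
        { agrees₀ = λ {b} l → trans (m₅ b) (trans (stored (<⇒≢ (<-≤-trans l (m≤m+n P i)))) (I.agrees₀ J l))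
        ; done = λ {j} j<1+i → subst (Price j) (sym (m₅ (P + j))) (case m≤n⇒m<n∨m≡n (s≤s⁻¹ j<1+i) of λ where
            (inj₁ j<i)  → subst (Price j) (sym (older j<i)) (I.done J j<i)
            (inj₂ refl) → subst (Price j) (sym new) price)
        ; dest≡ = +-next P i (trans (κ₅ .regs dest) dest₃)
        ; col≡ = +-next (reg s costs) i (trans (κ₅ .regs col) (trans (κ₃ .regs col) (trans (κ₁ .regs col) (I.col≡ J))))
        ; row≡ = trans (cong₂ _+_ (trans (κ₅ .regs row) row₃)
                   (trans (κ₅ .regs rn) (trans (κ₃ .regs rn) (trans (κ₁ .regs rn) (trans (κ .regs rn) (rn≡ M))))))
                   (row-next A i)
        ; jm<m = jm<m ; bestRow≡ = eb
        ; attained = λ le → let l , e = att le in l , trans (m₅ _) e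
        ; least = λ {j} l le → subst (_ ≤_) (sym (m₅ (P + j))) (lst l (subst (_≤ t) (m₅ (P + j)) le)) }
      where
      excess₁ : ∀ {v} → v ≡ total diff (mem s′) (reg s′ row) (reg s′ caps) (reg s′ rz) n → v ≡ Σ< n (λ l → a i l ∸ c l)
      excess₁ e = trans e (Σ-cong n λ {l} l<n → cong₂ _∸_
        (trans (cong (λ b → mem s′ (b + l)) (I.row≡ J))
          (trans (I.agrees₀ J (<-≤-trans (+-monoʳ-< _ l<n) (≤-trans (row-fits M i<m) L≤sp))) (rows M i<m l<n)))
        (trans (cong (λ b → mem s′ (b + l)) (κ .regs caps))
          (trans (I.agrees₀ J (<-≤-trans (+-monoʳ-< _ l<n) (caps-top V))) (caps-cell V l<n))))

  -- `out` is one flag shared by the whole search tree, and it is only ever raised: o is its value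
  -- on entry, and the result is the disjunction of o = 1 with A.
  Ans : ℕ → Set → ℕ → Set
  Ans o A v = (v ≡ 1 × (o ≡ 1 ⊎ A)) ⊎ (v ≡ o × ¬ A)

  Searches : ℕ → ℕ → ℕ → Set
  Searches L k b = ∀ {s t c q} → Matrix L s → L ≤ reg s sp → Level c q s → reg s budget ≡ k → reg s money ≡ t →
    Runs (call search) b (Balanced (Ans (reg s out) (Packing n m a k t c q)) s) s

  -- Memory is unchanged up to P + m, which includes the price array of this node at P. The child
  -- sees that array with the price of j replaced, and the last store restores it.
  branch-rule : ∀ {L k b} → Searches L k b → ∀ {s t c q j P} → Matrix L s → L ≤ P → reg s sp ≡ P + m →
    reg s caps + n ≤ P → (∀ {i} → i < n → mem s (reg s caps + i) ≡ c i) → (∀ {l} → l < m → mem s (P + l) ≡ q l) →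
    j < m → reg s col ≡ P + j → reg s row ≡ reg s matrix + j * n → reg s item ≡ q j → reg s big ≡ t + 1 →
    reg s budget ≡ k → reg s money ≡ t →
    Runs branch (branchCost n b) (λ s′ → reg s′ sp ≡ reg s sp × s′ agrees s below (P + m) ×
      Ans (reg s out) (Packing n m a k (t ∸ q j) (remaining a c j) (without q j t)) (reg s′ out) ×
      (∀ {r} → r ∈ branchLocals → reg s′ (6 + r) ≡ reg s (6 + r))) s
  branch-rule {L} {k} {b} recurse {s} {t} {c} {q} {j} {P} M L≤P esp caps-fit caps≡ costs≡ j<m ecol erow eitem ebig ek et =
    pointers caps row rn ++ set tmp 0 ∷ copy dest sp ∷ [] ∙
    seq (map-rule diff n (rn≡ M)
          (≤-trans caps-fit (≤-trans (m≤m+n P m) (≤-reflexive (sym esp))))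
          (≤-trans (subst (λ r → r + n ≤ L) (sym erow) (row-fits M j<m)) (≤-trans L≤P (≤-trans (m≤m+n P m) (≤-reflexive (sym esp))))))
    λ {s₁} κ₁ (ag₁ , new₁) →
    let s₂ = exec (store col big ∷ set tmp 0 ∷ copy ry sp ∷ sub rx sp rm ∷ add sp sp rn ∷ []) s₁
        sp₁ : reg s₁ sp ≡ P + m
        sp₁ = trans (κ₁ .regs sp) esp
        col₁ : reg s₁ col ≡ P + j
        col₁ = trans (κ₁ .regs col) ecol
        stored : ∀ {x} → x ≢ P + j → mem s₂ x ≡ mem s₁ x
        stored ne = update-other (mem s₁) (λ e → ne (trans e col₁))
        same₁ : ∀ {x} → x < P + m → mem s₁ x ≡ mem s x
        same₁ {x} l = ag₁ (subst (x <_) (sym esp) l)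
        top₂ : reg s₂ sp ≡ P + m + n
        top₂ = cong₂ _+_ sp₁ (trans (κ₁ .regs rn) (rn≡ M))
        cell : ∀ {l} → l < m → mem s₂ (P + l) ≡ without q j t l
        cell {l} l<m = case l ≟ j of λ where
          (yes refl) → trans (cong (mem s₂) (sym col₁)) (trans (update-same (mem s₁) (reg s₁ col))
                         (trans (κ₁ .regs big) (trans ebig (sym (update-same q j)))))
          (no  ne)   → trans (stored (λ e → ne (+-cancelˡ-≡ P _ _ e)))
                         (trans (same₁ (+-monoʳ-< P l<m)) (trans (costs≡ l<m) (sym (update-other q ne))))
    in store col big ∷ set tmp 0 ∷ copy ry sp ∷ sub rx sp rm ∷ add sp sp rn ∷ [] ∙
    seq (protect-rule {R = Ans (reg s out) (Packing n m a k (t ∸ q j) (remaining a c j) (without q j t))}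
          branchLocals λ {s₃} esp₃ same ag₃ →
      let below₃ : ∀ {x} → x < P + m + n → mem s₃ x ≡ mem s₂ x
          below₃ {x} l = ag₃ (subst (x <_) (sym top₂) l)
          sp₃ : P + m + n ≤ reg s₃ sp
          -- 9 is the number of saved registers.
          sp₃ = ≤-trans (≤-reflexive (sym top₂)) (≤-trans (m≤n+m _ 9) (≤-reflexive (sym esp₃)))
          caps₃ : reg s₃ ry ≡ P + m
          caps₃ = trans (same ry) sp₁
          costs₃ : reg s₃ rx ≡ P
          costs₃ = trans (same rx) (trans (cong₂ _∸_ sp₁ (trans (κ₁ .regs rm) (rm≡ M))) (m+n∸n≡m P m))
          out₃ : reg s₃ out ≡ reg s out
          out₃ = trans (same out) (κ₁ .regs out)
          low : ∀ {x} → x < P → mem s₃ x ≡ mem s x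
          low {x} l = trans (below₃ (<-≤-trans l (≤-trans (m≤m+n P m) (m≤m+n _ n))))
            (trans (stored (<⇒≢ (<-≤-trans l (m≤m+n P j)))) (same₁ (<-≤-trans l (m≤m+n P m))))
          money₃ : reg s₃ money ∸ reg s₃ item ≡ t ∸ q j
          money₃ = cong₂ _∸_ (trans (same money) (trans (κ₁ .regs money) et)) (trans (same item) (trans (κ₁ .regs item) eitem))
      in set tmp 0 ∷ copy caps ry ∷ copy costs rx ∷ sub money money item ∷ [] ∙
         consequence (recurse
           (matrix-transfer M (trans (same rn) (κ₁ .regs rn)) (trans (same rm) (κ₁ .regs rm))
             (trans (same matrix) (κ₁ .regs matrix)) (λ l → low (<-≤-trans l L≤P)))
           (≤-trans L≤P (≤-trans (≤-trans (m≤m+n P m) (m≤m+n _ n)) sp₃))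
           record
             { caps-top = ≤-trans (≤-reflexive (cong (_+ n) caps₃)) sp₃
             ; costs-top = ≤-trans (≤-reflexive (cong (_+ m) costs₃)) (≤-trans (m≤m+n _ n) sp₃)
             ; caps-cell = λ {i} i<n → trans (cong (λ x → mem s₃ (x + i)) caps₃) (trans (below₃ (+-monoʳ-< (P + m) i<n))
                 (trans (stored (λ e → <⇒≢ (<-≤-trans (+-monoʳ-< P j<m) (m≤m+n _ i)) (sym e)))
                 (trans (cong (λ x → mem s₁ (x + i)) (sym esp)) (trans (new₁ i<n)
                   (cong₂ _∸_ (caps≡ i<n) (trans (cong (λ x → mem s (x + i)) erow) (rows M j<m i<n)))))))
             ; costs-cell = λ {l} l<m → trans (cong (λ x → mem s₃ (x + l)) costs₃)
                 (trans (below₃ (<-≤-trans (+-monoʳ-< P l<m) (m≤m+n _ n))) (cell l<m)) }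
           (trans (same budget) (trans (κ₁ .regs budget) ek)) money₃)
         λ _ (balanced p st o) → balanced p st (subst (λ v → Ans v _ _) out₃ o))
    λ {s₄} κ₄ (balanced p st o , saved) →
      let r₄ : reg s₄ sp ∸ reg s₄ rn ≡ P + m
          r₄ = trans (cong₂ _∸_ (trans p top₂) (trans (κ₄ .regs rn) (trans (κ₁ .regs rn) (rn≡ M)))) (m+n∸n≡m (P + m) n)
          col₄ : reg s₄ col ≡ P + j
          col₄ = trans (saved (member 6)) col₁
          item₄ : reg s₄ item ≡ q j
          item₄ = trans (saved (member 10))
                    (trans (κ₁ .regs item) eitem)
      in block-rule (sub sp sp rn ∷ store col item ∷ [])
        ( trans r₄ (sym esp)
        , (λ {x} l → case x ≟ P + j of λ where
            (yes refl) → trans (cong (mem (exec (sub sp sp rn ∷ store col item ∷ []) s₄)) (sym col₄))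
                           (trans (update-same (mem s₄) (reg s₄ col)) (trans item₄ (sym (costs≡ j<m))))
            (no  ne)   → trans (update-other (mem s₄) (λ e → ne (trans e col₄)))
                           (trans (st (subst (x <_) (sym top₂) (<-≤-trans l (m≤m+n _ n)))) (trans (stored ne) (same₁ l))))
        , o
        , λ {r} r∈ → trans (saved r∈) (earlier {s₁} κ₁ r∈) )
    where
    turn = store col big ∷ set tmp 0 ∷ copy ry sp ∷ sub rx sp rm ∷ add sp sp rn ∷ []
    earlier : ∀ {s₁ r} → Keeps (mapLoop diff) (exec (pointers caps row rn ++ set tmp 0 ∷ copy dest sp ∷ []) s) s₁ →
      r ∈ branchLocals → reg (exec turn s₁) (6 + r) ≡ reg s (6 + r)
    earlier {s₁} κ = All-lookup {P = λ r → reg (exec turn s₁) (6 + r) ≡ reg s (6 + r)} (κ .regs counter ∷ κ .regs row ∷ κ .regs col ∷ κ .regs bestRow ∷ κ .regs budget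
      ∷ κ .regs money ∷ κ .regs caps ∷ κ .regs item ∷ κ .regs big ∷ [])

  Ans-step : ∀ {o v v′ A B C} → (A ⊎ B → C) → (C → A ⊎ B) → Ans o A v → Ans v B v′ → Ans o C v′
  Ans-step f g (inj₁ (e , inj₁ o)) (inj₁ (e′ , _))      = inj₁ (e′ , inj₁ o)
  Ans-step f g (inj₁ (e , inj₂ x)) (inj₁ (e′ , _))      = inj₁ (e′ , inj₂ (f (inj₁ x)))
  Ans-step f g (inj₂ (e , _)) (inj₁ (e′ , inj₁ v))      = inj₁ (e′ , inj₁ (trans (sym e) v))
  Ans-step f g (inj₂ (e , _)) (inj₁ (e′ , inj₂ y))      = inj₁ (e′ , inj₂ (f (inj₂ y)))
  Ans-step f g (inj₁ (e , inj₁ o)) (inj₂ (e′ , _))      = inj₁ (trans e′ e , inj₁ o)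
  Ans-step f g (inj₁ (e , inj₂ x)) (inj₂ (e′ , _))      = inj₁ (trans e′ e , inj₂ (f (inj₁ x)))
  Ans-step f g (inj₂ (e , na)) (inj₂ (e′ , nb))         = inj₂ (trans e′ e , λ z → case g z of λ where
    (inj₁ x) → na x
    (inj₂ y) → nb y)

  Ans-map : ∀ {o v A B} → (A → B) → (B → A) → Ans o A v → Ans o B v
  Ans-map f g (inj₁ (e , inj₁ o)) = inj₁ (e , inj₁ o)
  Ans-map f g (inj₁ (e , inj₂ x)) = inj₁ (e , inj₂ (f x))
  Ans-map f g (inj₂ (e , na))     = inj₂ (e , na ∘ g)

  module _ (a≤1 : ∀ j i → a j i ≤ 1) (1≤n : 1 ≤ n) (1≤m : 1 ≤ m) {w o : ℕ}
           (row-sum : ∀ {j} → j < m → Σ< n (a j) ≤ w) (col-sum : ∀ {i} → i < n → Σ< m (λ j → a j i) ≤ o) where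

    private
      B : ℕ
      B = 1 ⊔ (w * o)

    -- The machine compares rows by address; different indices have different addresses because n ≥
    -- 1.
    same-row : ℕ → ℕ → ℕ
    same-row r r′ = 1 ∸ ((r ∸ r′) + (r′ ∸ r))

    same-row-≡ : ∀ r → same-row r r ≡ 1
    same-row-≡ r rewrite n∸n≡0 r = refl

    same-row-≢ : ∀ {r r′} → r ≢ r′ → same-row r r′ ≡ 0
    same-row-≢ {r} {r′} ne with <-cmp r r′
    ... | tri< l _ _ = m≤n⇒m∸n≡0 (≤-trans (m<n⇒0<n∸m l) (m≤n+m _ (r ∸ r′)))
    ... | tri≈ _ e _ = contradiction e ne
    ... | tri> _ _ l = m≤n⇒m∸n≡0 (≤-trans (m<n⇒0<n∸m l) (m≤m+n _ (r′ ∸ r)))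

    search-rule : ∀ L k → Searches L k (searchTime n m B k)
    search-rule L zero {s} M L≤sp V ek et = call-rule search (else-rule budget ek
      (block-rule (set out 1 ∷ []) (balanced refl (λ _ → refl) (inj₁ (refl , inj₂ empty-pack)))))
    search-rule L (suc k) {s} {t} {c} {q} M L≤sp V ek et = call-rule search (then-rule budget (λ z → 0≢1+n (trans (sym z) ek))
      (seq (fitting-rule 1≤m M L≤sp V et) λ {s₁} κ₁ φ → scan s₁ κ₁ φ))
      where
      P A X : ℕ
      P = reg s sp
      A = reg s matrix
      X = searchTime n m B k
      prelude = set tmp 0 ∷ copy col sp ∷ copy row matrix ∷ copy counter rm ∷ add sp sp rm ∷ decrement budget
      scan : ∀ s₁ → Keeps fitting s s₁ → Fitted t c q s s₁ →
        Runs (block prelude ⨾ repeat counter scanBody ⨾ block (sub sp sp rm ∷ []))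
          (8 + (suc (m * (scanCost n 0 + 4) + B * X) + 2))
          (Balanced (Ans (reg s out) (Packing n m a (suc k) t c q)) s) s₁
      scan s₁ κ₁ φ = prelude ∙ seq
        -- Round i is charged for a child search only if set i meets jm, so `meeting-≤` bounds the
        -- number of children by B.
        (weaken (s≤s total-time) (repeat-restoring I (λ i → scanCost n (sign (ov i) * X)) m
          (trans (κ₁ .regs rm) (rm≡ M))
          record { agrees₁ = λ _ → refl ; sp≡ = cong₂ _+_ (κ₁ .regs sp) (trans (κ₁ .regs rm) (rm≡ M))
                 ; col≡ = trans (κ₁ .regs sp) (sym (+-identityʳ P))
                 ; row≡ = trans (κ₁ .regs matrix) (sym (+-identityʳ A))
                 ; bestRow≡ = Fitted.bestRow≡ φ ; caps≡ = κ₁ .regs caps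
                 ; budget≡ = cong (_∸ 1) (trans (κ₁ .regs budget) ek) ; money≡ = trans (κ₁ .regs money) et
                 ; big≡ = Fitted.big≡ φ
                 ; answer = inj₂ (κ₁ .regs out , λ ()) }
          step))
        λ {s₃} κ₃ J → block-rule (sub sp sp rm ∷ []) (balanced
          (trans (cong₂ _∸_ (I.sp≡ J) (trans (κ₃ .regs rm) (trans (κ₁ .regs rm) (rm≡ M)))) (m+n∸n≡m P m))
          (λ l → trans (I.agrees₁ J (<-≤-trans l (m≤m+n P m))) (Fitted.unchanged φ l))
          (Ans-map sound complete (I.answer J)))
        where
        jm : ℕ
        jm = Fitted.jm φ
        q′ : ℕ → ℕ
        q′ j = mem s₁ (P + j)
        e ov : ℕ → ℕ
        e j = same-row (A + j * n) (A + jm * n)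
        ov j = e j + Σ< n (λ i → (a j i + a jm i) ∸ 1)
        Cand : ℕ → Set
        Cand j = ov j ≢ 0 × q′ j ≤ t × Packing n m a k (t ∸ q′ j) (remaining a c j) (without q′ j t)
        Found : ℕ → Set
        Found i = ∃[ j ] (j < i × Cand j)
        record I (i : ℕ) (s′ : State) : Set where
          field
            agrees₁  : s′ agrees s₁ below (P + m)
            sp≡      : reg s′ sp ≡ P + m
            col≡     : reg s′ col ≡ P + i
            row≡     : reg s′ row ≡ A + i * n
            bestRow≡ : reg s′ bestRow ≡ A + jm * n
            caps≡    : reg s′ caps ≡ reg s caps
            budget≡  : reg s′ budget ≡ k
            money≡   : reg s′ money ≡ t
            big≡     : reg s′ big ≡ t + 1
            answer   : Ans (reg s out) (Found i) (reg s′ out)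
        filtered : Filtered {n} {m} {a} t c q q′
        filtered = Fitted.filtered φ
        sound : Found m → Packing n m a (suc k) t c q
        sound (j , j<m , _ , le , p) = unfilter-pack {k = suc k} {c = c} {q = q} {q′ = q′} filtered
          (extend j<m le (filtered-fits {k = k} {t} {c} {q} {q′} filtered j<m le) p)
        complete : Packing n m a (suc k) t c q → Found m
        complete p = let j , j<m , Mj , le , p′ = exchange {M = λ j → ov j ≢ 0} (λ j → ¬? (ov j ≟ 0)) (Fitted.jm<m φ)
                           (λ z → 1+n≢0 (trans (sym (same-row-≡ (A + jm * n))) (m+n≡0⇒m≡0 (e jm) z)))
                           (λ {j} nn → disjoint {j} (decidable-stable (ov j ≟ 0) nn))
                           (Fitted.cheapest φ) (filter-pack {k = suc k} {c = c} {q = q} {q′ = q′} filtered p)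
                     in j , j<m , Mj , le , p′
          where
          disjoint : ∀ {j} → ov j ≡ 0 → ∀ {i} → i < n → a j i ≡ 0 ⊎ a jm i ≡ 0
          disjoint {j} z {i} i<n with a j i in ej | a jm i in em
          ... | zero  | _     = inj₁ refl
          ... | suc u | zero  = inj₂ refl
          ... | suc u | suc v = contradiction (subst₂ (λ x y → (x + y) ∸ 1 ≤ 0) ej em
                  (≤-trans (Σ-term n (λ i → (a j i + a jm i) ∸ 1) i<n) (≤-reflexive (m+n≡0⇒n≡0 (e j) z))))
                  (λ le → contradiction (≤-trans (≤-reflexive (sym (+-suc u v))) le) λ ())
        total-time : Σ< m (λ i → scanCost n (sign (ov i) * X) + 4) ≤ m * (scanCost n 0 + 4) + B * X
        total-time = begin
          Σ< m (λ i → scanCost n (sign (ov i) * X) + 4)  ≡⟨ Σ-cong m (λ {i} _ → eq (loopCost n) (sign (ov i) * X)) ⟩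
          Σ< m (λ i → (scanCost n 0 + 4) + sign (ov i) * X)  ≡⟨ Σ-+ m _ _ ⟩
          Σ< m (λ _ → scanCost n 0 + 4) + Σ< m (λ i → sign (ov i) * X) ≡⟨ cong₂ _+_ (Σ-const m _) (Σ-cong m λ {i} _ → *-comm (sign (ov i)) X) ⟩
          m * (scanCost n 0 + 4) + Σ< m (λ i → X * sign (ov i))  ≡⟨ cong (m * (scanCost n 0 + 4) +_) (trans (Σ-* m X (λ i → sign (ov i))) (*-comm X _)) ⟩
          m * (scanCost n 0 + 4) + Σ< m (λ i → sign (ov i)) * X  ≤⟨ +-monoʳ-≤ (m * (scanCost n 0 + 4)) (*-monoˡ-≤ X
              (meeting-≤ {n} {m} {a} {jm} e (Fitted.jm<m φ) a≤1 (row-sum (Fitted.jm<m φ)) col-sum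
                (λ ne → same-row-≢ (λ r → ne (*-cancelʳ-≡ _ _ n {{>-nonZero 1≤n}} (+-cancelˡ-≡ A _ _ r)))))) ⟩
          m * (scanCost n 0 + 4) + B * X  ∎
          where
          open ≤-Reasoning
          -- `scanCost n b` written out with l for the loop cost, which exposes that b enters as a
          -- mere summand.
          eq : ∀ l b → 12 + (l + (3 + (2 + (9 + (l + (6 + ((72 + (5 + b)) + 3)))) + 4))) + 4 ≡
                       (12 + (l + (3 + (2 + (9 + (l + (6 + ((72 + (5 + 0)) + 3)))) + 4))) + 4) + b
          eq = solve-∀
        step : ∀ i {s′} → i < m → Keeps (repeat counter scanBody) (exec prelude s₁) s′ → I i s′ →
          Runs scanBody (scanCost n (sign (ov i) * X))
            (λ s″ → I (suc i) (exec (decrement counter) s″) × reg s″ counter ≡ reg s′ counter) s′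
        step i {s′} i<m κ J =
          pointers row bestRow rn ++ sub rx row bestRow ∷ sub ry bestRow row ∷ add rx rx ry ∷ set tmp 1 ∷ sub acc tmp rx ∷ [] ∙
          seq (sum-rule meet n rn′ refl) λ {s₄} κ₄ e₄ →
          let m₄ : mem s₄ ≡ mem s′
              m₄ = κ₄ .memory
              item₄ : mem s₄ (reg s₄ col) ≡ q′ i
              item₄ = trans (cong₂ (λ h x → h x) m₄ (trans (κ₄ .regs col) (I.col≡ J))) (I.agrees₁ J (+-monoʳ-< P i<m))
              big₄ : reg s₄ big ≡ t + 1
              big₄ = trans (κ₄ .regs big) (I.big≡ J)
              low₄ : s₄ agrees s below P
              low₄ {x} l = trans (cong (λ h → h x) m₄) (trans (I.agrees₁ J (<-≤-trans l (m≤m+n P m))) (Fitted.unchanged φ l))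
              acc₄ : reg s₄ acc ≡ ov i
              acc₄ = trans e₄ (cong₂ _+_ (cong₂ same-row (I.row≡ J) (I.bestRow≡ J))
                (Σ-cong n λ {l} l<n → cong₂ (λ u v → (u + v) ∸ 1) (cell i<m l<n (I.row≡ J)) (cell (Fitted.jm<m φ) l<n (I.bestRow≡ J))))
              s₅ = exec (load item col ∷ sub flag big item ∷ []) s₄
              M₅ : Matrix L s₅
              M₅ = matrix-transfer M (trans (κ₄ .regs rn) (trans (κ .regs rn) (κ₁ .regs rn)))
                     (trans (κ₄ .regs rm) (trans (κ .regs rm) (κ₁ .regs rm)))
                     (trans (κ₄ .regs matrix) matrix′) (λ l → low₄ (<-≤-trans l L≤sp))
              caps₅ : reg s₅ caps ≡ reg s caps
              caps₅ = trans (κ₄ .regs caps) (I.caps≡ J)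
              keep : ∀ {s₆} → Ans (reg s₅ out) (Cand i) (reg s₆ out) → s₆ agrees s₅ below (P + m) →
                reg s₆ sp ≡ reg s₅ sp →
                (∀ {r} → r ∈ branchLocals → reg s₆ (6 + r) ≡ reg s₅ (6 + r)) →
                Next i s′ s₆
              keep {s₆} an ag p sv = record
                { agrees₁ = λ {x} l → trans (ag l) (trans (cong (λ h → h x) m₄) (I.agrees₁ J l))
                ; sp≡ = trans p (trans (κ₄ .regs sp) (I.sp≡ J))
                ; counter≡ = trans (sv (member 4)) (κ₄ .regs counter)
                ; row≡ = trans (sv (member 5)) (trans (κ₄ .regs row) (I.row≡ J))
                ; col≡ = trans (sv (member 6)) (trans (κ₄ .regs col) (I.col≡ J))
                ; bestRow≡ = trans (sv (member 8)) (trans (κ₄ .regs bestRow) (I.bestRow≡ J))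
                ; budget≡ = trans (sv (member 0)) (trans (κ₄ .regs budget) (I.budget≡ J))
                ; money≡ = trans (sv (member 1)) (trans (κ₄ .regs money) (I.money≡ J))
                ; caps≡ = trans (sv (member 2)) caps₅
                ; big≡ = trans (sv (member 9)) big₄
                ; answer = Ans-step
                    (λ { (inj₁ (j , j<i , p)) → j , m<n⇒m<1+n j<i , p ; (inj₂ p) → i , n<1+n i , p })
                    (λ { (j , j<1+i , p) → case m≤n⇒m<n∨m≡n (s≤s⁻¹ j<1+i) of λ where
                           (inj₁ j<i)  → inj₁ (j , j<i , p)
                           (inj₂ refl) → inj₂ p })
                    (I.answer J) (subst (λ v → Ans v (Cand i) (reg s₆ out)) (κ₄ .regs out) an) }
          in load item col ∷ sub flag big item ∷ [] ∙
          seq {R = Next i s′}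
            (if-same acc
              (λ nz → if-same flag
                (λ fl → let le : q′ i ≤ t
                            le = s≤s⁻¹ (subst₂ _<_ item₄ (trans big₄ (+-comm t 1)) (≰⇒> λ le → fl (m≤n⇒m∸n≡0 le))) in
                  weaken (≤-reflexive (cong (branchCost n) (sym (trans (cong (_* X) (sign-pos (λ z → nz (trans acc₄ z)))) (+-identityʳ X)))))
                  (consequence (branch-rule (search-rule L k) {c = c} {q = q′} M₅ L≤sp (trans (κ₄ .regs sp) (I.sp≡ J))
                      (subst (λ x → x + n ≤ P) (sym caps₅) (caps-top V))
                      (λ {l} l<n → trans (cong (λ x → mem s₅ (x + l)) caps₅)
                         (trans (low₄ (<-≤-trans (+-monoʳ-< _ l<n) (caps-top V))) (caps-cell V l<n)))
                      (λ {l} l<m → trans (cong (λ h → h (P + l)) m₄) (I.agrees₁ J (+-monoʳ-< P l<m)))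
                      i<m (trans (κ₄ .regs col) (I.col≡ J))
                      (trans (κ₄ .regs row) (trans (I.row≡ J) (cong (_+ i * n) (sym (trans (κ₄ .regs matrix) matrix′)))))
                      item₄ big₄ (trans (κ₄ .regs budget) (I.budget≡ J)) (trans (κ₄ .regs money) (I.money≡ J)))
                    λ {s₆} _ (p , ag , an , sv) →
                      keep {s₆} (Ans-map (λ p → (λ z → nz (trans acc₄ z)) , le , p) (λ (_ , _ , p) → p) an) ag p sv))
                (λ z → skip-rule≤ (keep (inj₂ (refl , λ (_ , le , _) → <⇒≱ (≤-trans (≤-reflexive (+-comm 1 t))
                    (≤-trans (≤-reflexive (sym big₄)) (≤-trans (m∸n≡0⇒m≤n z) (≤-reflexive item₄)))) le))
                    (λ _ → refl) refl (λ _ → refl))))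
              (λ z → skip-rule≤ (keep (inj₂ (refl , λ (ne , _) → ne (trans (sym acc₄) z))) (λ _ → refl) refl (λ _ → refl))))
          λ {s₆} κ₆ N → block-rule (increment col ++ add row row rn ∷ [])
            ( record { agrees₁ = Next.agrees₁ N ; sp≡ = Next.sp≡ N ; col≡ = +-next P i (Next.col≡ N)
                     ; row≡ = trans (cong₂ _+_ (Next.row≡ N) (trans (κ₆ .regs rn) (trans (κ₄ .regs rn) rn′)))
                                (row-next A i)
                     ; bestRow≡ = Next.bestRow≡ N ; caps≡ = Next.caps≡ N ; budget≡ = Next.budget≡ N
                     ; money≡ = Next.money≡ N ; big≡ = Next.big≡ N ; answer = Next.answer N }
            , Next.counter≡ N )
          where
          record Next (i : ℕ) (s′ s₆ : State) : Set where
            field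
              agrees₁  : s₆ agrees s₁ below (P + m)
              sp≡      : reg s₆ sp ≡ P + m
              counter≡ : reg s₆ counter ≡ reg s′ counter
              col≡     : reg s₆ col ≡ P + i
              row≡     : reg s₆ row ≡ A + i * n
              bestRow≡ : reg s₆ bestRow ≡ A + jm * n
              caps≡    : reg s₆ caps ≡ reg s caps
              budget≡  : reg s₆ budget ≡ k
              money≡   : reg s₆ money ≡ t
              big≡     : reg s₆ big ≡ t + 1
              answer   : Ans (reg s out) (Found (suc i)) (reg s₆ out)
          rn′ : reg s′ rn ≡ n
          rn′ = trans (κ .regs rn) (trans (κ₁ .regs rn) (rn≡ M))
          matrix′ : reg s′ matrix ≡ A
          matrix′ = trans (κ .regs matrix) (κ₁ .regs matrix)
          cell : ∀ {j l b} → j < m → l < n → b ≡ A + j * n → mem s′ (b + l) ≡ a j l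
          cell {j} {l} j<m l<n refl =
            let l<P = <-≤-trans (+-monoʳ-< (A + j * n) l<n) (≤-trans (row-fits M j<m) L≤sp) in
            trans (I.agrees₁ J (<-≤-trans l<P (m≤m+n P m))) (trans (Fitted.unchanged φ l<P) (rows M j<m l<n))

-- The time of the branching search

rowwise : ∀ {n c a} m → Linear n c a → Linear (n * m) c (m * a)
rowwise {n} {c} m (lin h) = lin (≤-trans (*-monoʳ-≤ m h) (≤-reflexive (eq c n m)))
  where
  eq : ∀ c n m → m * (c * n) ≡ c * (n * m)
  eq = solve-∀

columnwise : ∀ {m c a} n → Linear m c a → Linear (n * m) c (n * a)
columnwise {m} {c} n (lin h) = lin (≤-trans (*-monoʳ-≤ n h) (≤-reflexive (eq c n m)))
  where
  eq : ∀ c n m → n * (c * m) ≡ c * (n * m)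
  eq = solve-∀

nodeCost : ℕ → ℕ → ℕ
nodeCost n m = 2 + (fittingCost n m + (8 + (suc (m * (scanCost n 0 + 4)) + 2)))

opaque

  fitting-linear : Σ[ c ∈ ℕ ] (∀ n m → 1 ≤ n → 1 ≤ n * m → Linear (n * m) c (fittingCost n m))
  fitting-linear = _ , λ n m p p′ → constant 11 p′ ⊕
    rowwise m ((constant 7 p ⊕ (constant 1 p ⊕ linear n 21 ≤-refl) ⊕ constant 22 p) ⊕ constant 4 p)

  node-linear : Σ[ c ∈ ℕ ] (∀ n m → 1 ≤ n → 1 ≤ n * m → Linear (n * m) c (nodeCost n m))
  node-linear = _ , λ n m p p′ → constant 2 p′ ⊕ proj₂ fitting-linear n m p p′ ⊕ constant 8 p′ ⊕ (constant 1 p′ ⊕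
    rowwise m ((constant 12 p ⊕ (constant 1 p ⊕ linear n 21 ≤-refl) ⊕
      (constant 3 p ⊕ ((constant 11 p ⊕ (constant 1 p ⊕ linear n 21 ≤-refl) ⊕ constant 86 p) ⊕ constant 4 p))) ⊕ constant 4 p)) ⊕ constant 2 p′

  -- A leaf takes 4 steps; the induction in `searchTime-bound` starts from it.
  4≤nodeRate : 4 ≤ proj₁ node-linear
  4≤nodeRate = ≤ᵇ⇒≤ 4 (proj₁ node-linear) tt

nodeRate : ℕ
nodeRate = proj₁ node-linear

module _ {n m : ℕ} (1≤n : 1 ≤ n) (1≤nm : 1 ≤ n * m) where

  private
    D : ℕ
    D = nodeRate * (n * m)

  -- The summand D on the left is what closes the induction: a node costs D + B X, and D + B X + D ≤
  -- B (X + D) as B ≥ 2.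
  searchTime-bound : ∀ {B} → 2 ≤ B → ∀ k → searchTime n m B k + D ≤ 2 * D * B ^ k
  searchTime-bound {B} 2≤B zero    = begin
    4 + D  ≤⟨ +-monoˡ-≤ D (≤-trans 4≤nodeRate (Linear.bound (constant nodeRate 1≤nm))) ⟩
    D + D  ≡⟨ eq D ⟩
    2 * D * 1  ∎
    where
    open ≤-Reasoning
    eq : ∀ d → d + d ≡ 2 * d * 1
    eq = solve-∀
  searchTime-bound {B} 2≤B (suc k) = begin
    searchTime n m B (suc k) + D  ≡⟨ cong (_+ D) (eq₁ (fittingCost n m) (m * (scanCost n 0 + 4)) (B * X)) ⟩
    (nodeCost n m + B * X) + D ≤⟨ +-monoˡ-≤ D (+-monoˡ-≤ (B * X) (Linear.bound (proj₂ node-linear n m 1≤n 1≤nm))) ⟩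
    (D + B * X) + D  ≡⟨ eq₂ D (B * X) ⟩
    2 * D + B * X  ≤⟨ +-monoˡ-≤ (B * X) (*-monoˡ-≤ D 2≤B) ⟩
    B * D + B * X  ≡⟨ eq₃ B D X ⟩
    B * (X + D)  ≤⟨ *-monoʳ-≤ B (searchTime-bound 2≤B k) ⟩
    B * (2 * D * B ^ k)  ≡⟨ eq₄ B D (B ^ k) ⟩
    2 * D * (B * B ^ k)  ∎
    where
    open ≤-Reasoning
    X = searchTime n m B k
    eq₁ : ∀ f s y → 2 + (f + (8 + (suc (s + y) + 2))) ≡ (2 + (f + (8 + (suc s + 2)))) + y
    eq₁ = solve-∀
    eq₂ : ∀ d y → (d + y) + d ≡ 2 * d + y
    eq₂ = solve-∀
    eq₃ : ∀ b d x → b * d + b * x ≡ b * (x + d)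
    eq₃ = solve-∀
    eq₄ : ∀ b d p → b * (2 * d * p) ≡ 2 * d * (b * p)
    eq₄ = solve-∀

-- Choosing the cheapest sets, and the complete solver

Decided : Set → State → Set
Decided A s = (reg s out ≡ 1 × A) ⊎ (reg s out ≡ 0 × ¬ A)

chooseCost : ℕ → ℕ → ℕ
chooseCost n m = 2 + suc (fittingCost n m + (10 + (loopCost m + (5 + (selectRate * m +
  (10 + (loopCost m + (8 + (loopCost m + 4)))))))))

module _ {n m : ℕ} {a : ℕ → ℕ → ℕ} where

  -- The comparison of k v with t plus the slacks is necessary by weak duality (`choice⇒bound`). It
  -- is sufficient by `bound⇒choice`, because v has rank k - 1 among the filtered prices.
  choose-rule : ∀ {L s k t c q} → 1 ≤ m → Matrix {n} {m} {a} L s → L ≤ reg s sp → Level {n} {m} {a} c q s →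
    reg s budget ≡ k → 1 ≤ k → reg s money ≡ t → (∀ {i} → i < n → Σ< m (λ j → a j i) ≤ 1) →
    Runs chooseCheapest (chooseCost n m) (Decided (Packing n m a k t c q)) s
  choose-rule {L} {s} {k} {t} {c} {q} 1≤m M L≤sp V ek 1≤k et col-sum with k ≤? m
  ... | no  k≰m = sub flag budget rm ∷ [] ∙ weaken (m≤m+n 3 _)
    (then-rule flag (m>n⇒m∸n≢0 (subst₂ _<_ (sym (Matrix.rm≡ M)) (sym ek) (≰⇒> k≰m)))
      (block-rule (set out 0 ∷ []) (inj₂ (refl , λ p → k≰m (≤-trans (≤-reflexive (sym (Packing.size p)))
        (≤-trans (Σ-mono m (λ {j} _ → bit-≤1 (Packing.S p j))) (≤-reflexive (Σ-one m))))))))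
  ... | yes k≤m = sub flag budget rm ∷ [] ∙ else-rule flag (m≤n⇒m∸n≡0 (subst₂ _≤_ (sym ek) (sym (Matrix.rm≡ M)) k≤m))
    (seq (fitting-rule 1≤m M′ L≤sp V′ et) λ {s₁} κ₁ φ →
    let sp₁ = κ₁ .regs sp
        rm₁ : reg s₁ rm ≡ m
        rm₁ = trans (κ₁ .regs rm) (Matrix.rm≡ M)
    in pointers sp sp rm ++ add sp sp rm ∷ set tmp 0 ∷ copy dest sp ∷ [] ∙
    seq (map-rule entry m rm₁ (+-monoʳ-≤ (reg s₁ sp) (≤-reflexive (sym rm₁))) (+-monoʳ-≤ (reg s₁ sp) (≤-reflexive (sym rm₁))))
    λ {s₂} κ₂ (ag₂ , copied) →
    let sp₂ : reg s₂ sp ≡ P + m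
        sp₂ = trans (κ₂ .regs sp) (cong₂ _+_ sp₁ rm₁)
        rm₂ = trans (κ₂ .regs rm) rm₁
        k₂ : reg s₂ budget ∸ 1 ≡ k ∸ 1
        k₂ = cong (_∸ 1) (trans (κ₂ .regs budget) (trans (κ₁ .regs budget) ek))
        q′ : ℕ → ℕ
        q′ j = mem s₁ (P + j)
        low₂ : ∀ {x} → x < P + m → mem s₂ x ≡ mem s₁ x
        low₂ {x} l = ag₂ (subst (x <_) (sym (cong₂ _+_ sp₁ rm₁)) l)
        copied₂ : ∀ {i} → i < m → mem s₂ (reg s₂ sp + i) ≡ q′ i
        copied₂ {i} i<m = trans (cong (λ x → mem s₂ (x + i)) (κ₂ .regs sp)) (trans (copied i<m) (cong (λ x → mem s₁ (x + i)) sp₁))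
    in set tmp 0 ∷ copy len rm ∷ set tmp 1 ∷ sub rank budget tmp ∷ [] ∙
    seq (weaken (≤-reflexive (cong (selectRate *_) rm₂)) (select-rule (reg s₂ rm) ≤-refl
          (subst₂ _<_ (sym k₂) (sym rm₂) (<-≤-trans (∸-monoʳ-< {k} {1} {0} (s≤s z≤n) 1≤k) k≤m))))
    λ {s₃} κ₃ (balanced p₃ st₃ r₃) →
    let v = reg s₃ out
        rank₃ : Rank q′ m (k ∸ 1) v
        rank₃ = Rank-cong copied₂ (subst₂ (λ l r → Rank (λ i → mem s₂ (reg s₂ sp + i)) l r v) rm₂ k₂ r₃)
        rm₃ = trans (κ₃ .regs rm) rm₂
        sp₃ : reg s₃ sp ∸ reg s₃ rm ≡ P
        sp₃ = trans (cong₂ _∸_ (trans p₃ sp₂) rm₃) (m+n∸n≡m P m)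
        cell₃ : ∀ {j} → j < m → mem s₃ (P + j) ≡ q′ j
        cell₃ {j} j<m = trans (st₃ (subst (P + j <_) (sym sp₂) (+-monoʳ-< P j<m))) (low₂ (+-monoʳ-< P j<m))
    in sub sp sp rm ∷ set tmp 0 ∷ copy rz out ∷ pointers sp sp rm ∙
    seq (sum-rule slack m rm₃ refl) λ {s₄} κ₄ e₄ →
    let k₄ : reg s₄ budget ≡ k
        k₄ = trans (κ₄ .regs budget) (trans (κ₃ .regs budget) (trans (κ₂ .regs budget) (trans (κ₁ .regs budget) ek)))
        t₄ : reg s₄ money ≡ t
        t₄ = trans (κ₄ .regs money) (trans (κ₃ .regs money) (trans (κ₂ .regs money) (trans (κ₁ .regs money) et)))
        slack₄ : reg s₄ acc ≡ Σ< m (λ j → v ∸ q′ j)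
        slack₄ = trans e₄ (Σ-cong m λ {j} j<m → cong (v ∸_) (trans (cong (λ x → mem s₃ (x + j)) sp₃) (cell₃ j<m)))
    in add lo acc money ∷ pointers sp sp budget ∙
    seq (weaken (s≤s (*-monoˡ-≤ 21 k≤m)) (sum-rule fixed k k₄ refl)) λ {s₅} κ₅ e₅ →
    let demand : reg s₅ acc ≡ k * v
        demand = trans e₅ (trans (Σ-const k (reg s₄ rz)) (cong (k *_) (κ₄ .regs rz)))
        supply : reg s₅ lo ≡ Σ< m (λ j → v ∸ q′ j) + t
        supply = trans (κ₅ .regs lo) (cong₂ _+_ slack₄ t₄)
        filtered : Filtered {n} {m} {a} t c q q′
        filtered = Fitted.filtered φ
        packs : reg s₅ acc ≤ reg s₅ lo → Packing n m a k t c q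
        packs le = unfilter-pack {k = k} {c = c} {q = q} {q′ = q′} filtered (choice-pack {k = k} {t} {c} {q} {q′} filtered col-sum
          (bound⇒choice {n} {m} {a} {k} {t} {v} {q′} (≤-trans (Rank.lower rank₃) (m∸n≤m k 1))
             (≤-trans (≤-reflexive (sym (m+[n∸m]≡n 1≤k))) (Rank.upper rank₃)) (subst₂ _≤_ demand supply le)))
        packs⁻ : Packing n m a k t c q → reg s₅ acc ≤ reg s₅ lo
        packs⁻ p = subst₂ _≤_ (sym demand) (sym supply) (choice⇒bound {n} {m} {a} {k} {t} {v} {q′}
          (let packing S sz pr _ = filter-pack {k = k} {c = c} {q = q} {q′ = q′} filtered p in S , sz , pr))
    in block-rule (sub acc acc lo ∷ set tmp 1 ∷ sub out tmp acc ∷ []) (case reg s₅ acc ≤? reg s₅ lo of λ where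
      (yes le) → inj₁ (cong (1 ∸_) (m≤n⇒m∸n≡0 le) , packs le)
      (no nle) → inj₂ (m≤n⇒m∸n≡0 (m<n⇒0<n∸m (≰⇒> nle)) , nle ∘ packs⁻)))
    where
    P : ℕ
    P = reg s sp
    M′ = matrix-transfer {s′ = exec (sub flag budget rm ∷ []) s} M refl refl refl (λ _ → refl)
    V′ : Level {n} {m} {a} c q (exec (sub flag budget rm ∷ []) s)
    V′ = record { Level V }

opaque

  choose-linear : Σ[ c ∈ ℕ ] (∀ n m → 1 ≤ n → 1 ≤ n * m → Linear (n * m) c (chooseCost n m))
  choose-linear = _ , λ n m p p′ →
    let m≤nm = m≤n*m m n {{>-nonZero p}}
        loop = constant 1 p′ ⊕ linear m 21 m≤nm
    in constant 3 p′ ⊕ proj₂ fitting-linear n m p p′ ⊕ constant 10 p′ ⊕ loop ⊕ constant 5 p′ ⊕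
       lin {_} {selectRate} (*-monoʳ-≤ selectRate m≤nm) ⊕ constant 10 p′ ⊕ loop ⊕ constant 8 p′ ⊕ loop ⊕ constant 4 p′

  columns-linear : Σ[ c ∈ ℕ ] (∀ n m → 1 ≤ m → 1 ≤ n * m → Linear (n * m) c (5 + suc (n * ((9 + (loopCost m + 6)) + 4))))
  columns-linear = _ , λ n m p p′ → constant 6 p′ ⊕
    columnwise n ((constant 9 p ⊕ (constant 1 p ⊕ linear m 21 ≤-refl) ⊕ constant 6 p) ⊕ constant 4 p)

stretch : ∀ {x c b} y → 1 ≤ y → Linear x c b → Linear (x * y) c b
stretch {x} {c} y p (lin h) = lin (≤-trans h (*-monoʳ-≤ c (m≤m*n x y {{>-nonZero p}})))

solveRate : ℕ
solveRate = proj₁ columns-linear + (1 + ((2 + 2 * nodeRate) + (1 + proj₁ choose-linear)))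

module _ {n m : ℕ} {a : ℕ → ℕ → ℕ} where

  private
    columnBody : Cmd 2
    columnBody = block (pointers col col rm ++ set tmp 0 ∷ copy stride rn ∷ []) ⨾ sumLoop entry
      ⨾ block (set tmp 1 ∷ sub acc acc tmp ∷ add lo lo acc ∷ increment col)

    prelude : Code
    prelude = set lo 0 ∷ set tmp 0 ∷ copy col matrix ∷ copy counter rn ∷ []

  columns-rule : ∀ {L s} → Matrix {n} {m} {a} L s →
    Runs (repeat counter columnBody) (suc (n * ((9 + (loopCost m + 6)) + 4)))
      (λ s′ → reg s′ lo ≡ Σ< n (λ i → Σ< m (λ j → a j i) ∸ 1)) (exec prelude s)
  columns-rule {L} {s} M = uniform n _ (consequence
    (repeat-rule I _ n (Matrix.rn≡ M) (sym (+-identityʳ A) , refl) step) λ _ → proj₂)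
    where
    A : ℕ
    A = reg s matrix
    I : ℕ → State → Set
    I i s′ = reg s′ col ≡ A + i × reg s′ lo ≡ Σ< i (λ i → Σ< m (λ j → a j i) ∸ 1)
    step : ∀ i {s′} → i < n → Keeps (repeat counter columnBody) (exec prelude s) s′ → I i s′ →
      Runs columnBody _ (λ s″ → I (suc i) (exec (decrement counter) s″)) s′
    step i {s′} i<n κ (ec , el) =
      pointers col col rm ++ set tmp 0 ∷ copy stride rn ∷ [] ∙
      seq (sum-strided entry m (trans (κ .regs rm) (Matrix.rm≡ M))) λ {s₁} κ₁ e₁ →
      block-rule (set tmp 1 ∷ sub acc acc tmp ∷ add lo lo acc ∷ increment col)
        ( +-next A i (trans (κ₁ .regs col) ec)
        , cong₂ _+_ (trans (κ₁ .regs lo) el) (cong (_∸ 1) (trans e₁ (Σ-cong m λ {j} j<m →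
            trans (cong₂ (λ h x → h x) (κ .memory) (trans (cong₂ (λ b d → b + j * d) ec (trans (κ .regs rn) (Matrix.rn≡ M))) (eq A i (j * n))))
              (Matrix.rows M j<m i<n)))) )
      where
      eq : ∀ a i b → a + i + b ≡ a + b + i
      eq = solve-∀

  solve-rule : ∀ {L s k t c q w o} → (∀ j i → a j i ≤ 1) → 1 ≤ n → 1 ≤ m →
    (∀ {j} → j < m → Σ< n (a j) ≤ w) → (∀ {i} → i < n → Σ< m (λ j → a j i) ≤ o) →
    Matrix {n} {m} {a} L s → L ≤ reg s sp → Level {n} {m} {a} c q s → reg s budget ≡ k → reg s money ≡ t →
    Runs solve (solveRate * (n * m * (1 ⊔ (w * o)) ^ k)) (Decided (Packing n m a k t c q)) s
  solve-rule {L} {s} {k} {t} {c} {q} {w} {o} a≤1 1≤n 1≤m row-sum col-sum M L≤sp V ek et =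
    weaken (Linear.bound (stretch (B ^ k) 1≤p (proj₂ columns-linear n m 1≤m 1≤nm) ⊕
             (constant 1 1≤X ⊕ lin {X} {(2 + 2 * nodeRate) + (1 + proj₁ choose-linear)} ≤-refl)))
      (prelude ∙ seq (columns-rule M) λ {s₁} κ₁ e₁ →
        let M₁ = matrix-transfer {s′ = s₁} M (κ₁ .regs rn) (κ₁ .regs rm) (κ₁ .regs matrix) (λ {x} _ → cong (λ h → h x) (κ₁ .memory))
            L₁ = subst (L ≤_) (sym (κ₁ .regs sp)) L≤sp
            ek₁ = trans (κ₁ .regs budget) ek
            et₁ = trans (κ₁ .regs money) et
            V₁ : Level {n} {m} {a} c q s₁
            V₁ = record
              { caps-top = subst₂ (λ x y → x + n ≤ y) (sym (κ₁ .regs caps)) (sym (κ₁ .regs sp)) (Level.caps-top V)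
              ; costs-top = subst₂ (λ x y → x + m ≤ y) (sym (κ₁ .regs costs)) (sym (κ₁ .regs sp)) (Level.costs-top V)
              ; caps-cell = λ {i} l → trans (cong₂ (λ h x → h (x + i)) (κ₁ .memory) (κ₁ .regs caps)) (Level.caps-cell V l)
              ; costs-cell = λ {i} l → trans (cong₂ (λ h x → h (x + i)) (κ₁ .memory) (κ₁ .regs costs)) (Level.costs-cell V l) }
        in if-same lo
          (λ nz → weaken (then-time (branching (λ z → nz (trans e₁ z)))) (set out 0 ∷ [] ∙ consequence
            (search-rule a≤1 1≤n 1≤m row-sum col-sum L k
              (matrix-transfer M₁ refl refl refl (λ _ → refl)) L₁ (record { Level V₁ }) ek₁ et₁)
            λ _ (balanced _ _ an) → case an of λ where
              (inj₁ (e , inj₂ p)) → inj₁ (e , p)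
              (inj₂ (e , np))     → inj₂ (e , np)))
          (λ z → weaken else-time (if-same budget
            (λ nz → choose-rule 1≤m M₁ L₁ V₁ ek₁ (n≢0⇒n>0 λ k0 → nz (trans ek₁ k0)) et₁
              λ {i} i<n → m∸n≡0⇒m≤n (n≤0⇒n≡0 (≤-trans (Σ-term n (λ i → Σ< m (λ j → a j i) ∸ 1) i<n) (≤-reflexive (trans (sym e₁) z)))))
            (λ z → weaken (m≤m+n 2 _) (block-rule (set out 1 ∷ []) (inj₁ (refl , empty (trans (sym ek₁) z))))))))
    where
    B X : ℕ
    B = 1 ⊔ (w * o)
    X = n * m * B ^ k
    1≤nm : 1 ≤ n * m
    1≤nm = *-mono-≤ 1≤n 1≤m
    1≤p : 1 ≤ B ^ k
    1≤p = ≤-trans (≤-reflexive (sym (^-zeroˡ k))) (^-monoˡ-≤ k (m≤m⊔n 1 (w * o)))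
    1≤X : 1 ≤ X
    1≤X = *-mono-≤ 1≤nm 1≤p
    empty : k ≡ 0 → Packing n m a k t c q
    empty refl = empty-pack
    else-time : suc (chooseCost n m) ≤ ((2 + 2 * nodeRate) + (1 + proj₁ choose-linear)) * X
    else-time = ≤-trans (Linear.bound (constant 1 1≤X ⊕ stretch (B ^ k) 1≤p (proj₂ choose-linear n m 1≤n 1≤nm)))
      (*-monoˡ-≤ X (m≤n+m _ (2 + 2 * nodeRate)))
    then-time : 2 ≤ B → 2 + searchTime n m B k ≤ ((2 + 2 * nodeRate) + (1 + proj₁ choose-linear)) * X
    then-time 2≤B = ≤-trans
      (Linear.bound (constant 2 1≤X ⊕ lin {X} {2 * nodeRate}
        (≤-trans (m≤m+n _ (nodeRate * (n * m))) (≤-trans (searchTime-bound 1≤n 1≤nm 2≤B k) (≤-reflexive (eq nodeRate (n * m) (B ^ k)))))))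
      (*-monoˡ-≤ X (m≤m+n (2 + 2 * nodeRate) _))
      where
      eq : ∀ c x y → 2 * (c * x) * y ≡ 2 * c * (x * y)
      eq = solve-∀
    -- A positive term comes from an element in at least two sets, so o ≥ 2, and any set containing
    -- it gives w ≥ 1.
    branching : Σ< n (λ i → Σ< m (λ j → a j i) ∸ 1) ≢ 0 → 2 ≤ B
    branching nz =
      let i , i<n , h = Σ-positive n (λ i → Σ< m (λ j → a j i) ∸ 1) (n≢0⇒n>0 nz)
          2≤col = 2≤-pred h
          j , j<m , h′ = Σ-positive m (λ j → a j i) (≤-trans (s≤s z≤n) 2≤col)
      in ≤-trans (*-mono-≤ {1} {w} {2} {o} (≤-trans h′ (≤-trans (Σ-term n (a j) i<n) (row-sum j<m))) (≤-trans 2≤col (col-sum i<n)))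
           (m≤n⊔m 1 (w * o))
      where
      2≤-pred : ∀ {v} → 0 < v ∸ 1 → 2 ≤ v
      2≤-pred {suc (suc v)} _ = s≤s (s≤s z≤n)

-- The encoding of instances

-- The programs are verified for total functions on the naturals; this carries the data of an
-- instance, indexed by `Fin`, over to them.
ext : ∀ {A : Set} {n} → A → (Fin n → A) → ℕ → A
ext {n = zero}  d f i       = d
ext {n = suc n} d f zero    = f zero
ext {n = suc n} d f (suc i) = ext d (f ∘ suc) i

ext-toℕ : ∀ {A : Set} {n} {d : A} (f : Fin n → A) i → ext d f (toℕ i) ≡ f i
ext-toℕ f zero    = refl
ext-toℕ f (suc i) = ext-toℕ (f ∘ suc) i

pointwise : ∀ {n} {P : ℕ → Set} → (∀ (i : Fin n) → P (toℕ i)) → ∀ {i} → i < n → P i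
pointwise {P = P} h i<n = subst P (toℕ-fromℕ< i<n) (h (fromℕ< i<n))

ext-≤ : ∀ {n b} (f : Fin n → ℕ) → (∀ i → f i ≤ b) → ∀ i → ext 0 f i ≤ b
ext-≤ {zero}  f h i       = z≤n
ext-≤ {suc n} f h zero    = h zero
ext-≤ {suc n} f h (suc i) = ext-≤ (f ∘ suc) (h ∘ suc) i

Σ-first : ∀ n (f : ℕ → ℕ) → Σ< (suc n) f ≡ f 0 + Σ< n (f ∘ suc)
Σ-first n f = Σ-split 1 n f

contents-++ˡ : ∀ xs {ys i} → i < length xs → contents (xs ++ ys) i ≡ contents xs i
contents-++ˡ (x ∷ xs) {i = zero}  _ = refl
contents-++ˡ (x ∷ xs) {i = suc i} l = contents-++ˡ xs (s≤s⁻¹ l)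

contents-++ʳ : ∀ xs {ys} i → contents (xs ++ ys) (length xs + i) ≡ contents ys i
contents-++ʳ []       i = refl
contents-++ʳ (x ∷ xs) i = contents-++ʳ xs i

contents-tabulate : ∀ {n} (f : Fin n → ℕ) i → contents (tabulate f) i ≡ ext 0 f i
contents-tabulate {zero}  f i       = refl
contents-tabulate {suc n} f zero    = refl
contents-tabulate {suc n} f (suc i) = contents-tabulate (f ∘ suc) i

contents-map : ∀ {n} (f : Fin n → ℕ) i → contents (map f (allFin n)) i ≡ ext 0 f i
contents-map f i = trans (cong (λ xs → contents xs i) (map-tabulate id f)) (contents-tabulate f i)

length-allFin : ∀ {A : Set} {n} (f : Fin n → A) → length (map f (allFin n)) ≡ n
length-allFin {n = n} f = trans (length-map f (allFin n)) (length-tabulate {n = n} id)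

contents-concatMap : ∀ {A : Set} {m n} (g : A → List ℕ) (h : Fin m → A) → (∀ x → length (g x) ≡ n) → ∀ {j i} → j < m → i < n →
  contents (concatMap g (tabulate h)) (j * n + i) ≡ ext 0 (λ j → contents (g (h j)) i) j
contents-concatMap {m = suc m} {n} g h len {zero}  {i} _ i<n =
  contents-++ˡ (g (h zero)) (subst (i <_) (sym (len (h zero))) i<n)
contents-concatMap {m = suc m} {n} g h len {suc j} {i} j<m i<n = begin
  contents (g (h zero) ++ rest) (n + j * n + i)  ≡⟨ cong (contents (g (h zero) ++ rest)) (+-assoc n (j * n) i) ⟩
  contents (g (h zero) ++ rest) (n + (j * n + i))  ≡⟨ cong (λ k → contents (g (h zero) ++ rest) (k + (j * n + i))) (sym (len (h zero))) ⟩
  contents (g (h zero) ++ rest) (length (g (h zero)) + (j * n + i)) ≡⟨ contents-++ʳ (g (h zero)) (j * n + i) ⟩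
  contents rest (j * n + i)  ≡⟨ contents-concatMap g (h ∘ suc) len (s≤s⁻¹ j<m) i<n ⟩
  ext 0 (λ j → contents (g (h (suc j))) i) j  ∎
  where
  open ≡-Reasoning
  rest = concatMap g (tabulate (h ∘ suc))

length-concatMap : ∀ {A : Set} {m n} (g : A → List ℕ) (h : Fin m → A) → (∀ x → length (g x) ≡ n) →
  length (concatMap g (tabulate h)) ≡ m * n
length-concatMap {m = zero}  g h len = refl
length-concatMap {m = suc m} g h len = trans (length-++ (g (h zero)))
  (cong₂ _+_ (len (h zero)) (length-concatMap g (h ∘ suc) len))

at : ∀ {m} → Subset m → ℕ → Bool
at S = ext false (lookup S)

size-Σ : ∀ {m} (S : Subset m) → ∣ S ∣ ≡ Σ< m (bit ∘ at S)
size-Σ Vec.[]            = refl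
size-Σ {suc m} (true Vec.∷ S)  = trans (cong suc (size-Σ S)) (sym (Σ-first m _))
size-Σ {suc m} (false Vec.∷ S) = trans (size-Σ S) (sym (Σ-first m _))

does-∈? : ∀ {m} (i : Fin m) S → does (i ∈? S) ≡ lookup S i
does-∈? zero    (true Vec.∷ S)  = refl
does-∈? zero    (false Vec.∷ S) = refl
does-∈? (suc i) (_ Vec.∷ S)     = does-∈? i S

price-Σ : ∀ {m l} (S : Subset m) (p : Fin m → ℕ) (h : Fin l → Fin m) →
  sum (map p (filter (_∈? S) (tabulate h))) ≡ Σ< l (λ j → bit (ext false (lookup S ∘ h) j) * ext 0 (p ∘ h) j)
price-Σ {l = zero}  S p h = refl
price-Σ {l = suc l} S p h = trans (step (does (h zero ∈? S)) refl) (sym (Σ-first l _))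
  where
  rest = price-Σ S p (h ∘ suc)
  step : ∀ b → does (h zero ∈? S) ≡ b →
    sum (map p (filter (_∈? S) (tabulate h))) ≡
    bit (lookup S (h zero)) * p (h zero) + Σ< l (λ j → bit (ext false (lookup S ∘ h ∘ suc) j) * ext 0 (p ∘ h ∘ suc) j)
  step b e with does (h zero ∈? S) | does-∈? (h zero) S
  ... | true  | e′ rewrite sym e′ = cong₂ _+_ (sym (+-identityʳ _)) rest
  ... | false | e′ rewrite sym e′ = rest

module _ (I : Instance) where
  open Instance I renaming (n to n′; m to m′)

  incidence : ℕ → ℕ → ℕ
  incidence j i = ext 0 (λ j → ext 0 (λ i → bit (does (i ∈? F j))) i) j

  incidence-≡ : ∀ j i → incidence (toℕ j) (toℕ i) ≡ bit (lookup (F j) i)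
  incidence-≡ j i = trans (ext-toℕ (λ j → ext 0 (λ i → bit (does (i ∈? F j))) (toℕ i)) j)
    (trans (ext-toℕ (λ i → bit (does (i ∈? F j))) i) (cong bit (does-∈? i (F j))))

  incidence-≤1 : ∀ j i → incidence j i ≤ 1
  incidence-≤1 j i = ext-≤ _ (λ j → ext-≤ _ (λ i → bit-≤1 (does (i ∈? F j))) i) j

  set-size : ∀ j → Σ< n′ (incidence (toℕ j)) ≡ ∣ F j ∣
  set-size j = sym (trans (size-Σ (F j)) (Σ-cong n′ (pointwise {P = λ i → bit (at (F j) i) ≡ incidence (toℕ j) i} λ i →
    trans (cong bit (ext-toℕ (lookup (F j)) i)) (sym (incidence-≡ j i)))))

  coverage-Σ : ∀ S i → coverage S i ≡ Σ< m′ (λ j → bit (at S j) * incidence j (toℕ i))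
  coverage-Σ S i = trans (size-Σ (S ∩ containing i)) (Σ-cong m′ (pointwise λ j → begin
    bit (at (S ∩ containing i) (toℕ j))  ≡⟨ cong bit (ext-toℕ (lookup (S ∩ containing i)) j) ⟩
    bit (lookup (S ∩ containing i) j)  ≡⟨ cong bit (lookup-zipWith _∧_ j S (containing i)) ⟩
    bit (lookup S j ∧ lookup (containing i) j)  ≡⟨ bit-∧ (lookup S j) _ ⟩
    bit (lookup S j) * bit (lookup (containing i) j) ≡⟨ cong₂ (λ b c → bit b * bit c) (sym (ext-toℕ (lookup S) j))
                                                         (trans (lookup∘tabulate _ j) (does-∈? i (F j))) ⟩
    bit (at S (toℕ j)) * bit (lookup (F j) i)  ≡⟨ cong (bit (at S (toℕ j)) *_) (sym (incidence-≡ j i)) ⟩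
    bit (at S (toℕ j)) * incidence (toℕ j) (toℕ i)  ∎))
    where
    open ≡-Reasoning
    bit-∧ : ∀ b c → bit (b ∧ c) ≡ bit b * bit c
    bit-∧ true  c = sym (+-identityʳ _)
    bit-∧ false c = refl

  occurrence : ∀ i → Σ< m′ (λ j → incidence j (toℕ i)) ≡ ∣ containing i ∣
  occurrence i = sym (trans (size-Σ (containing i)) (Σ-cong m′ (pointwise {P = λ j → bit (at (containing i) j) ≡ incidence j (toℕ i)} λ j →
    trans (cong bit (trans (ext-toℕ (lookup (containing i)) j) (trans (lookup∘tabulate _ j) (does-∈? i (F j)))))
          (sym (incidence-≡ j i)))))

  -- R is the requirement on the coverage, so that one translation serves capacities and demands.
  Selection : (ℕ → ℕ → Set) → Set
  Selection R = Σ[ S ∈ (ℕ → Bool) ] (Σ< m′ (bit ∘ S) ≡ k × Σ< m′ (λ j → bit (S j) * ext 0 price j) ≤ t ×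
    (∀ {i} → i < n′ → R i (Σ< m′ (λ j → bit (S j) * incidence j i))))

  module _ {R : ℕ → ℕ → Set} where

    Solution : Set
    Solution = Σ[ S ∈ Subset m′ ] (∣ S ∣ ≡ k × totalPrice S ≤ t × (∀ i → R (toℕ i) (coverage S i)))

    solution⇒selection : Solution → Selection R
    solution⇒selection (S , sz , pr , co) = at S , trans (sym (size-Σ S)) sz , subst (_≤ t) (price-Σ S price id) pr
      , pointwise (λ i → subst (R (toℕ i)) (coverage-Σ S i) (co i))

    selection⇒solution : Selection R → Solution
    selection⇒solution (S , sz , pr , co) = S′
      , trans (size-Σ S′) (trans (Σ-cong m′ λ l → cong bit (same l)) sz)
      , subst (_≤ t) (sym (trans (price-Σ S′ price id) (Σ-cong m′ λ {j} l → cong (λ b → bit b * ext 0 price j) (same l)))) pr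
      , λ i → subst (R (toℕ i)) (sym (trans (coverage-Σ S′ i) (Σ-cong m′ λ {j} l → cong (λ b → bit b * incidence j (toℕ i)) (same l)))) (co (toℕ<n i))
      where
      S′ : Subset m′
      S′ = Vec.tabulate (S ∘ toℕ)
      same : ∀ {j} → j < m′ → at S′ j ≡ S j
      same = pointwise {P = λ j → at S′ j ≡ S j} λ j → trans (ext-toℕ (lookup S′) j) (lookup∘tabulate (S ∘ toℕ) j)

  set-≤ : ∀ {j} → j < m′ → Σ< n′ (incidence j) ≤ s-max
  set-≤ = pointwise λ j → subst (_≤ s-max) (sym (set-size j)) (All-lookup (xs≤max 0 setSizes) (∈-map⁺ (λ j → ∣ F j ∣) (∈-allFin j)))

  set-≥ : ∀ {j} → j < m′ → s-min ≤ Σ< n′ (incidence j)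
  set-≥ = pointwise λ j → subst (s-min ≤_) (sym (set-size j)) (All-lookup (min≤xs n′ setSizes) (∈-map⁺ (λ j → ∣ F j ∣) (∈-allFin j)))

  occurrence-≤ : ∀ {i} → i < n′ → Σ< m′ (λ j → incidence j i) ≤ o-max
  occurrence-≤ = pointwise λ i → subst (_≤ o-max) (sym (occurrence i)) (All-lookup (xs≤max 0 occurrences) (∈-map⁺ (λ i → ∣ containing i ∣) (∈-allFin i)))

  occurrence-≥ : ∀ {i} → i < n′ → o-min ≤ Σ< m′ (λ j → incidence j i)
  occurrence-≥ = pointwise λ i → subst (o-min ≤_) (sym (occurrence i)) (All-lookup (min≤xs m′ occurrences) (∈-map⁺ (λ i → ∣ containing i ∣) (∈-allFin i)))

  encoded-bound : ∀ {i} → i < n′ → contents encoding (4 + i) ≡ ext 0 bound i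
  encoded-bound {i} i<n = trans (contents-++ˡ (map bound (allFin n′)) (subst (i <_) (sym (length-allFin bound)) i<n))
    (contents-map bound i)

  private
    matrixRow : Fin m′ → List ℕ
    matrixRow j = map (λ i → bit (does (i ∈? F j))) (allFin n′)

    length-matrixRow : ∀ j → length (matrixRow j) ≡ n′
    length-matrixRow j = length-allFin (λ i → bit (does (i ∈? F j)))

    skip-bounds : ∀ {ys} x → contents (map bound (allFin n′) ++ ys) (n′ + x) ≡ contents ys x
    skip-bounds {ys} x = trans (cong (λ l → contents (map bound (allFin n′) ++ ys) (l + x)) (sym (length-allFin bound)))
      (contents-++ʳ (map bound (allFin n′)) x)

    skip-prices : ∀ {ys} x → contents (map price (allFin m′) ++ ys) (m′ + x) ≡ contents ys x
    skip-prices {ys} x = trans (cong (λ l → contents (map price (allFin m′) ++ ys) (l + x)) (sym (length-allFin price)))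
      (contents-++ʳ (map price (allFin m′)) x)

  encoded-price : ∀ {j} → j < m′ → contents encoding (4 + n′ + j) ≡ ext 0 price j
  encoded-price {j} j<m = trans (skip-bounds j)
    (trans (contents-++ˡ (map price (allFin m′)) (subst (j <_) (sym (length-allFin price)) j<m)) (contents-map price j))

  encoded-incidence : ∀ {j i} → j < m′ → i < n′ → contents encoding (4 + n′ + m′ + (j * n′ + i)) ≡ incidence j i
  encoded-incidence {j} {i} j<m i<n = trans (cong (contents encoding) (cong (4 +_) (+-assoc n′ m′ (j * n′ + i))))
    (trans (skip-bounds (m′ + (j * n′ + i))) (trans (skip-prices (j * n′ + i))
      (trans (contents-concatMap matrixRow id length-matrixRow j<m i<n)
        (ext-cong {m′} {λ j → contents (matrixRow j) i} {λ j → ext 0 (λ i → bit (does (i ∈? F j))) i} j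
          λ j → contents-map (λ i → bit (does (i ∈? F j))) i))))
    where
    ext-cong : ∀ {m} {f g : Fin m → ℕ} j → (∀ j → f j ≡ g j) → ext 0 f j ≡ ext 0 g j
    ext-cong {zero}  j       h = refl
    ext-cong {suc m} zero    h = h zero
    ext-cong {suc m} (suc j) h = ext-cong j (h ∘ suc)

  cells-≤-encoding : n′ * m′ ≤ length encoding
  cells-≤-encoding = subst (n′ * m′ ≤_) (sym (cong (4 +_) (trans (length-++ (map bound (allFin n′)))
      (cong₂ _+_ (length-allFin bound) (trans (length-++ (map price (allFin m′)))
        (cong₂ _+_ (length-allFin price) (length-concatMap matrixRow id length-matrixRow)))))))
    (≤-trans (≤-reflexive (*-comm n′ m′)) (≤-trans (m≤n+m _ m′) (≤-trans (m≤n+m _ n′) (m≤n+m _ 4))))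

-- Encoded instances with capacities

parameterBound : ℕ → ℕ
parameterBound κ = suc (κ * κ) ^ κ

module _ (I : Instance) where
  open Instance I renaming (n to n′; m to m′)

  1≤n : 1 ≤ n′
  1≤n = n≢0⇒n>0 (≢-nonZero⁻¹ n′)

  1≤m : 1 ≤ m′
  1≤m = first n′ 1≤n bound-range
    where
    first : ∀ n {f : Fin n → ℕ} → 1 ≤ n → (∀ i → 1 ≤ f i × f i ≤ m′) → 1 ≤ m′
    first (suc n) _ h = ≤-trans (proj₁ (h zero)) (proj₂ (h zero))

  fixed-parameter : ∀ {u v} → (n′ * m′) * (1 ⊔ (u * v)) ^ k ≤ parameterBound (k + u + v) * length encoding ^ 1
  fixed-parameter {u} {v} = begin
    (n′ * m′) * (1 ⊔ (u * v)) ^ k  ≤⟨ *-mono-≤ (cells-≤-encoding I) (^-monoˡ-≤ k base) ⟩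
    length encoding * suc (κ * κ) ^ k  ≤⟨ *-monoʳ-≤ (length encoding) (^-monoʳ-≤ (suc (κ * κ)) (≤-trans (m≤m+n k u) (m≤m+n (k + u) v))) ⟩
    length encoding * suc (κ * κ) ^ κ  ≡⟨ *-comm (length encoding) (suc (κ * κ) ^ κ) ⟩
    suc (κ * κ) ^ κ * length encoding  ≡⟨ cong (suc (κ * κ) ^ κ *_) (sym (*-identityʳ (length encoding))) ⟩
    suc (κ * κ) ^ κ * length encoding ^ 1  ∎
    where
    open ≤-Reasoning
    κ : ℕ
    κ = k + u + v
    -- u and v are summands of κ, so u v ≤ κ²; the `suc` takes care of the 1.
    base : 1 ⊔ (u * v) ≤ suc (κ * κ)
    base = ⊔-lub {suc (κ * κ)} (s≤s z≤n) (m≤n⇒m≤1+n (*-mono-≤ (≤-trans (m≤n+m u k) (m≤m+n (k + u) v)) (m≤n+m v (k + u))))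

  record Ready (s : State) : Set where
    field
      rn≡     : reg s rn ≡ n′
      rm≡     : reg s rm ≡ m′
      budget≡ : reg s budget ≡ k
      money≡  : reg s money ≡ t
      caps≡   : reg s caps ≡ 4
      costs≡  : reg s costs ≡ 4 + n′
      matrix≡ : reg s matrix ≡ 4 + n′ + m′
      acc≡    : reg s acc ≡ m′ * n′
      sp≡     : reg s sp ≡ 4 + n′ + m′ + m′ * n′
      mem≡    : mem s ≡ contents encoding

  setup-rule : Runs setup (20 + (loopCost m′ + 2)) Ready (initial encoding)
  setup-rule = prelude ∙ seq (sum-rule fixed m′ refl refl) λ {s₁} κ₁ e₁ →
    let acc₁ : reg s₁ acc ≡ m′ * n′
        acc₁ = trans e₁ (Σ-const m′ n′)
    in block-rule (add sp matrix acc ∷ []) record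
      { rn≡ = κ₁ .regs rn ; rm≡ = κ₁ .regs rm ; budget≡ = κ₁ .regs budget ; money≡ = κ₁ .regs money
      ; caps≡ = κ₁ .regs caps ; costs≡ = κ₁ .regs costs ; matrix≡ = κ₁ .regs matrix ; acc≡ = acc₁
      ; sp≡ = cong₂ _+_ (κ₁ .regs matrix) acc₁ ; mem≡ = κ₁ .memory }
    where
    prelude = set tmp 0 ∷ load rn tmp ∷ set tmp 1 ∷ load rm tmp
      ∷ set tmp 2 ∷ load budget tmp ∷ set tmp 3 ∷ load money tmp
      ∷ set caps 4 ∷ add costs caps rn ∷ add matrix costs rm
      ∷ set tmp 0 ∷ copy rz rn ∷ pointers matrix matrix rm

  private
    c q : ℕ → ℕ
    c = ext 0 bound
    q = ext 0 price

  ready-matrix : ∀ {s} → Ready s → Matrix {n′} {m′} {incidence I} (4 + n′ + m′ + m′ * n′) s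
  ready-matrix {s} R = record { rn≡ = rn≡ ; rm≡ = rm≡ ; fits = ≤-reflexive (cong (_+ m′ * n′) matrix≡)
    ; rows = λ {j} {i} j<m i<n → trans (cong₂ (λ h b → h (b + j * n′ + i)) mem≡ matrix≡)
        (trans (cong (contents encoding) (+-assoc (4 + n′ + m′) (j * n′) i)) (encoded-incidence I j<m i<n)) }
    where open Ready R

  ready-level : ∀ {s} → Ready s → Level {n′} {m′} {incidence I} c q s
  ready-level {s} R = record
    { caps-top = ≤-trans (≤-reflexive (cong (_+ n′) caps≡)) (≤-trans (m≤m+n (4 + n′) m′) (≤-trans (m≤m+n (4 + n′ + m′) (m′ * n′)) (≤-reflexive (sym sp≡))))
    ; costs-top = ≤-trans (≤-reflexive (cong (_+ m′) costs≡)) (≤-trans (m≤m+n (4 + n′ + m′) (m′ * n′)) (≤-reflexive (sym sp≡)))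
    ; caps-cell = λ {i} i<n → trans (cong₂ (λ h b → h (b + i)) mem≡ caps≡) (encoded-bound I i<n)
    ; costs-cell = λ {j} j<m → trans (cong₂ (λ h b → h (b + j)) mem≡ costs≡) (encoded-price I j<m) }
    where open Ready R

opaque

  -- The power of the base enters as `suc X`, visibly positive, so that it can absorb the costs of
  -- the setup; `positive-power` brings it into this form.
  capacities-linear : Σ[ C ∈ ℕ ] (∀ n m X → 1 ≤ n → 1 ≤ m → Linear (n * m * suc X) C
    ((20 + (loopCost m + 2)) + solveRate * (n * m * suc X)))
  capacities-linear = _ , λ n m X p p′ →
    let 1≤nm = *-mono-≤ p p′
        m≤nm = m≤n*m m n {{>-nonZero p}}
    in stretch (suc X) (s≤s z≤n) (constant 20 1≤nm ⊕ (constant 1 1≤nm ⊕ linear m 21 m≤nm) ⊕ constant 2 1≤nm) ⊕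
       lin {_} {solveRate} ≤-refl

  demands-linear : Σ[ C ∈ ℕ ] (∀ n m X → 1 ≤ n → 1 ≤ m → Linear (n * m * suc X) C
    ((20 + (loopCost m + 2)) + (11 + (loopCost n + suc (10 + (loopCost n + (13 + (loopCost (m * n) + solveRate * (n * m * suc X)))))))))
  demands-linear = _ , λ n m X p p′ →
    let 1≤nm = *-mono-≤ p p′
        st = λ {c} {b} → stretch {n * m} {c} {b} (suc X) (s≤s z≤n)
        m≤nm = m≤n*m m n {{>-nonZero p}}
        n≤nm = m≤m*n n m {{>-nonZero p′}}
    in st (constant 20 1≤nm ⊕ (constant 1 1≤nm ⊕ linear m 21 m≤nm) ⊕ constant 2 1≤nm) ⊕
       st (constant 11 1≤nm) ⊕ st (constant 1 1≤nm ⊕ linear n 21 n≤nm) ⊕ st (constant 11 1≤nm) ⊕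
       st (constant 1 1≤nm ⊕ linear n 21 n≤nm) ⊕ st (constant 13 1≤nm) ⊕
       st (constant 1 1≤nm ⊕ linear (m * n) 21 (≤-reflexive (*-comm m n))) ⊕ lin {_} {solveRate} ≤-refl

positive-power : ∀ B k → ∃[ X ] ((1 ⊔ B) ^ k ≡ suc X)
positive-power B k with (1 ⊔ B) ^ k in e
... | suc X = X , refl
... | zero  = contradiction (subst (1 ≤_) e (≤-trans (≤-reflexive (sym (^-zeroˡ k))) (^-monoˡ-≤ k (m≤m⊔n 1 B)))) λ ()

runs⇒decides : ∀ {P J A b b′ c} → (A → DecisionProblem.Yes P J) → (DecisionProblem.Yes P J → A) → b ≤ b′ →
  Runs c b (Decided A) (initial (DecisionProblem.encode P J)) → DecidesWithin P (record { arity = 2 ; procs = procs ; main = c }) J b′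
runs⇒decides f g le (runs {s} {τ} e w (inj₁ (o , y)))  = s , τ , e , ≤-trans w le , inj₁ (o , f y)
runs⇒decides f g le (runs {s} {τ} e w (inj₂ (o , ny))) = s , τ , e , ≤-trans w le , inj₂ (o , ny ∘ g)

capacities-decides : ∀ I → let open Instance I in
  DecidesWithin SetCoverWithCapacitiesAndPrices capacities I (proj₁ capacities-linear * ((n * m) * (1 ⊔ (s-max * o-max)) ^ k))
capacities-decides I = runs⇒decides {SetCoverWithCapacitiesAndPrices} {I} yes⇐ yes⇒ time R
  where
  open Instance I renaming (n to n′; m to m′)
  B X : ℕ
  B = s-max * o-max
  X = n′ * m′ * (1 ⊔ B) ^ k
  Pack′ : Set
  Pack′ = Packing n′ m′ (incidence I) k t (ext 0 bound) (ext 0 price)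
  R : Runs (setup ⨾ solve) ((20 + (loopCost m′ + 2)) + solveRate * X) (Decided Pack′) (initial encoding)
  R = seq (setup-rule I) λ _ r → solve-rule (incidence-≤1 I) (1≤n I) (1≤m I) (set-≤ I) (occurrence-≤ I)
        (ready-matrix I r) (≤-reflexive (sym (Ready.sp≡ r))) (ready-level I r) (Ready.budget≡ r) (Ready.money≡ r)
  time : (20 + (loopCost m′ + 2)) + solveRate * X ≤ proj₁ capacities-linear * X
  time with Y , e ← positive-power B k rewrite e = Linear.bound (proj₂ capacities-linear n′ m′ Y (1≤n I) (1≤m I))
  Rel : ℕ → ℕ → Set
  Rel i v = v ≤ ext 0 bound i
  yes⇐ : Pack′ → DecisionProblem.Yes SetCoverWithCapacitiesAndPrices I
  yes⇐ (packing S sz pr co) = let S , sz , pr , co = selection⇒solution I {Rel} (S , sz , pr , co)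
    in S , sz , pr , λ i → subst (coverage S i ≤_) (ext-toℕ bound i) (co i)
  yes⇒ : DecisionProblem.Yes SetCoverWithCapacitiesAndPrices I → Pack′
  yes⇒ (S , sz , pr , co) = let S , sz , pr , co = solution⇒selection I {Rel}
                                    (S , sz , pr , λ i → subst (coverage S i ≤_) (sym (ext-toℕ bound i)) (co i))
    in packing S sz pr co

-- Demands by complementation

complement : (ℕ → ℕ → ℕ) → ℕ → ℕ → ℕ
complement a j i = 1 ∸ a j i

Σ-complement : ∀ m (f : ℕ → ℕ) → (∀ j → f j ≤ 1) → Σ< m (λ j → 1 ∸ f j) ≡ m ∸ Σ< m f
Σ-complement m f f≤1 = sym (trans (cong (_∸ Σ< m f) (sym whole)) (m+n∸n≡m _ (Σ< m f)))
  where
  whole : Σ< m (λ j → 1 ∸ f j) + Σ< m f ≡ m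
  whole = trans (sym (Σ-+ m _ f)) (trans (Σ-cong m λ {j} _ → m∸n+n≡m (f≤1 j)) (Σ-one m))

module _ (I : Instance) where
  open Instance I renaming (n to n′; m to m′)

  private
    a a′ : ℕ → ℕ → ℕ
    a = incidence I
    a′ = complement a
    d d′ q : ℕ → ℕ
    d = ext 0 bound
    d′ i = k ∸ d i
    q = ext 0 price
    B X : ℕ
    B = (n′ ∸ s-min) * (m′ ∸ o-min)
    X = n′ * m′ * (1 ⊔ B) ^ k
    Pack′ : Set
    Pack′ = Packing n′ m′ a′ k t d′ q

  -- A selection of k sets covers i at least d i times iff the complements of the sets cover i at most k ∸ d i times.
  uncovered : ∀ S i → Σ< m′ (bit ∘ S) ≡ k → Σ< m′ (λ j → bit (S j) * a′ j i) + Σ< m′ (λ j → bit (S j) * a j i) ≡ k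
  uncovered S i sz = trans (sym (Σ-+ m′ _ _)) (trans (Σ-cong m′ λ {j} _ → term (S j) (incidence-≤1 I j i)) sz)
    where
    term : ∀ b {v} → v ≤ 1 → bit b * (1 ∸ v) + bit b * v ≡ bit b
    term true  {v} h rewrite +-identityʳ (1 ∸ v) | +-identityʳ v = m∸n+n≡m h
    term false h = refl

  private
    Rel : ℕ → ℕ → Set
    Rel i v = d i ≤ v

  -- For d i > k the capacity k ∸ d i would be truncated to 0 and express only that all k sets
  -- contain i.
  pack⇒yes : (∀ {i} → i < n′ → d i ≤ k) → Pack′ → DecisionProblem.Yes SetCoverWithDemandsAndPrices I
  pack⇒yes d≤k (packing S sz pr co) = let S , sz , pr , co = selection⇒solution I {Rel} (S , sz , pr , covered)
    in S , sz , pr , λ i → subst (_≤ coverage S i) (ext-toℕ bound i) (co i)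
    where
    covered : ∀ {i} → i < n′ → d i ≤ Σ< m′ (λ j → bit (S j) * a j i)
    covered {i} i<n = +-cancelˡ-≤ (k ∸ d i) _ _ (≤-trans (≤-reflexive (trans (m∸n+n≡m (d≤k i<n)) (sym (uncovered S i sz))))
                        (+-monoˡ-≤ _ (co i<n)))

  yes⇒pack : DecisionProblem.Yes SetCoverWithDemandsAndPrices I → Pack′ × (∀ {i} → i < n′ → d i ≤ k)
  yes⇒pack (S , sz , pr , co) = let S , sz , pr , co = solution⇒selection I {Rel}
                                      (S , sz , pr , λ i → subst (_≤ coverage S i) (sym (ext-toℕ bound i)) (co i))
    in packing S sz pr (λ {i} i<n → m+n≤o⇒m≤o∸n _ (≤-trans (+-monoʳ-≤ _ (co i<n)) (≤-reflexive (uncovered S i sz))))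
     , λ {i} i<n → ≤-trans (co i<n) (≤-trans (m≤n+m _ _) (≤-reflexive (uncovered S i sz)))

  demands-run : Runs (Program.main demands)
    ((20 + (loopCost m′ + 2)) + (11 + (loopCost n′ + suc (10 + (loopCost n′ + (13 + (loopCost (m′ * n′) + solveRate * X)))))))
    (Decided (DecisionProblem.Yes SetCoverWithDemandsAndPrices I)) (initial encoding)
  demands-run = seq (setup-rule I) λ {s₁} _ r →
    let open Ready r
        L = 4 + n′ + m′ + m′ * n′
        L₁ : reg s₁ sp ≡ L
        L₁ = sp≡
    in set tmp 0 ∷ copy rz budget ∷ set tmp 0 ∷ copy flag acc ∷ pointers caps caps rn ∙
    seq (sum-rule excess n′ rn≡ refl) λ {s₂} κ₂ e₂ →
    let lack : reg s₂ acc ≡ Σ< n′ (λ i → d i ∸ k)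
        lack = trans e₂ (Σ-cong n′ λ i<n → cong₂ _∸_ (Level.caps-cell (ready-level I r) i<n) budget≡)
        rn₂ = trans (κ₂ .regs rn) rn≡
        rm₂ = trans (κ₂ .regs rm) rm≡
        caps₂ = trans (κ₂ .regs caps) caps≡
        sp₂ : reg s₂ sp ≡ L
        sp₂ = trans (κ₂ .regs sp) sp≡
        mem₂ = trans (κ₂ .memory) mem≡
        z₂ : reg s₂ rz ≡ k
        z₂ = trans (κ₂ .regs rz) budget≡
        flag₂ = trans (κ₂ .regs flag) acc≡
        caps-fit : 4 + n′ ≤ L
        caps-fit = ≤-trans (m≤m+n (4 + n′) m′) (m≤m+n (4 + n′ + m′) (m′ * n′))
        fit₂ : reg s₂ caps + n′ ≤ reg s₂ sp
        fit₂ = subst₂ (λ x y → x + n′ ≤ y) (sym caps₂) (sym sp₂) caps-fit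
    in if-same acc
      (λ nz → weaken (m≤m+n 2 _) (block-rule (set out 0 ∷ []) (inj₂ (refl , λ y → nz (trans lack
        (Σ-zero n′ λ i<n → m≤n⇒m∸n≡0 (proj₂ (yes⇒pack y) i<n)))))))
      (λ z → pointers caps caps rn ++ set tmp 0 ∷ copy dest sp ∷ copy caps sp ∷ [] ∙
        seq (map-rule slack n′ rn₂ fit₂ fit₂) λ {s₃} κ₃ (ag₃ , new₃) →
        let d≤k : ∀ {i} → i < n′ → d i ≤ k
            d≤k {i} i<n = m∸n≡0⇒m≤n (n≤0⇒n≡0 (≤-trans (Σ-term n′ (λ i → d i ∸ k) i<n) (≤-reflexive (trans (sym lack) z))))
            sp₃ : reg s₃ sp ≡ L
            sp₃ = trans (κ₃ .regs sp) sp₂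
            rn₃ = trans (κ₃ .regs rn) rn₂
            matrix₃ = trans (κ₃ .regs matrix) (trans (κ₂ .regs matrix) matrix≡)
            flag₃ = trans (κ₃ .regs flag) flag₂
            top₃ : reg s₃ sp + reg s₃ rn ≡ L + n′
            top₃ = cong₂ _+_ sp₃ rn₃
            fit₃ : reg s₃ matrix + m′ * n′ ≤ reg s₃ sp + reg s₃ rn
            fit₃ = subst₂ (λ x y → x + m′ * n′ ≤ y) (sym matrix₃) (sym top₃) (m≤m+n L n′)
            low₃ : ∀ {x} → x < L → mem s₃ x ≡ contents encoding x
            low₃ {x} l = trans (ag₃ (subst (x <_) (sym sp₂) l)) (cong (λ h → h x) mem₂)
        in set rz 1 ∷ pointers matrix matrix flag
             ++ set tmp 0 ∷ add sp sp rn ∷ copy dest sp ∷ copy matrix sp ∷ add sp sp flag ∷ [] ∙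
        seq (map-rule slack (m′ * n′) flag₃ fit₃ fit₃) λ {s₄} κ₄ (ag₄ , new₄) →
        let matrix₄ : reg s₄ matrix ≡ L + n′
            matrix₄ = trans (κ₄ .regs matrix) top₃
            sp₄ : reg s₄ sp ≡ L + n′ + m′ * n′
            sp₄ = trans (κ₄ .regs sp) (cong₂ _+_ top₃ flag₃)
            caps₄ : reg s₄ caps ≡ L
            caps₄ = trans (κ₄ .regs caps) (trans (κ₃ .regs caps) sp₂)
            costs₄ : reg s₄ costs ≡ 4 + n′
            costs₄ = trans (κ₄ .regs costs) (trans (κ₃ .regs costs) (trans (κ₂ .regs costs) costs≡))
            low₄ : ∀ {x} → x < L + n′ → mem s₄ x ≡ mem s₃ x
            low₄ {x} l = ag₄ (subst (x <_) (sym top₃) l)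
            entry₄ : ∀ {j i} → j < m′ → i < n′ → j * n′ + i < m′ * n′
            entry₄ {j} {i} j<m i<n = <-≤-trans (+-monoʳ-< (j * n′) i<n) (≤-trans (≤-reflexive (+-comm (j * n′) n′)) (*-monoˡ-≤ n′ j<m))
            M₄ : Matrix {n′} {m′} {a′} (L + n′ + m′ * n′) s₄
            M₄ = record
              { rn≡ = trans (κ₄ .regs rn) rn₃ ; rm≡ = trans (κ₄ .regs rm) (trans (κ₃ .regs rm) rm₂)
              ; fits = ≤-reflexive (cong (_+ m′ * n′) matrix₄)
              ; rows = λ {j} {i} j<m i<n → trans (cong (mem s₄) (trans (cong (λ x → x + j * n′ + i) (trans matrix₄ (sym top₃))) (+-assoc _ (j * n′) i)))
                  (trans (new₄ (entry₄ j<m i<n)) (cong (1 ∸_)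
                    (trans (cong (λ x → mem s₃ (x + (j * n′ + i))) matrix₃)
                      (trans (low₃ (+-monoʳ-< (4 + n′ + m′) (entry₄ j<m i<n))) (encoded-incidence I j<m i<n))))) }
            V₄ : Level {n′} {m′} {a′} d′ q s₄
            V₄ = record
              { caps-top = subst₂ (λ x y → x + n′ ≤ y) (sym caps₄) (sym sp₄) (m≤m+n (L + n′) (m′ * n′))
              ; costs-top = subst₂ (λ x y → x + m′ ≤ y) (sym costs₄) (sym sp₄)
                  (≤-trans (m≤m+n (4 + n′ + m′) (m′ * n′)) (≤-trans (m≤m+n L n′) (m≤m+n (L + n′) (m′ * n′))))
              ; caps-cell = λ {i} i<n → trans (cong (λ x → mem s₄ (x + i)) caps₄) (trans (low₄ (+-monoʳ-< L i<n))
                  (trans (cong (λ x → mem s₃ (x + i)) (sym sp₂)) (trans (new₃ i<n)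
                    (cong₂ _∸_ z₂ (trans (cong₂ (λ h x → h (x + i)) mem₂ caps₂) (encoded-bound I i<n))))))
              ; costs-cell = λ {j} j<m → let l = <-≤-trans (+-monoʳ-< (4 + n′) j<m) (m≤m+n (4 + n′ + m′) (m′ * n′)) in
                  trans (cong (λ x → mem s₄ (x + j)) costs₄)
                  (trans (low₄ (<-≤-trans l (m≤m+n L n′))) (trans (low₃ l) (encoded-price I j<m))) }
        in consequence (solve-rule (λ j i → m∸n≤m 1 (a j i)) (1≤n I) (1≤m I)
             -- The largest complement belongs to a smallest set, and the element in most
             -- complements to one with fewest occurrences.
             (λ {j} j<m → ≤-trans (≤-reflexive (Σ-complement n′ (a j) (incidence-≤1 I j))) (∸-monoʳ-≤ n′ (set-≥ I j<m)))
             (λ {i} i<n → ≤-trans (≤-reflexive (Σ-complement m′ (λ j → a j i) (λ j → incidence-≤1 I j i))) (∸-monoʳ-≤ m′ (occurrence-≥ I i<n)))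
             M₄ (≤-reflexive (sym sp₄)) V₄
             (trans (κ₄ .regs budget) (trans (κ₃ .regs budget) (trans (κ₂ .regs budget) budget≡)))
             (trans (κ₄ .regs money) (trans (κ₃ .regs money) (trans (κ₂ .regs money) money≡))))
           λ _ → λ where
             (inj₁ (e , p))  → inj₁ (e , pack⇒yes d≤k p)
             (inj₂ (e , np)) → inj₂ (e , λ y → np (proj₁ (yes⇒pack y))))

  demands-decides : DecidesWithin SetCoverWithDemandsAndPrices demands I
    (proj₁ demands-linear * ((n′ * m′) * (1 ⊔ ((n′ ∸ s-min) * (m′ ∸ o-min))) ^ k))
  demands-decides = runs⇒decides {SetCoverWithDemandsAndPrices} {I} id id time demands-run
    where
    time : (20 + (loopCost m′ + 2)) + (11 + (loopCost n′ + suc (10 + (loopCost n′ + (13 + (loopCost (m′ * n′) + solveRate * X))))))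
           ≤ proj₁ demands-linear * X
    time with Y , e ← positive-power B k rewrite e = Linear.bound (proj₂ demands-linear n′ m′ Y (1≤n I) (1≤m I))

open Instance using (n; m; k; s-max; s-min; o-max; o-min)

corollary3 : (Parameterized SetCoverWithCapacitiesAndPrices
    By (λ I → k I + s-max I + o-max I)
    SolvableInO (λ I → (n I * m I) * (1 ⊔ (s-max I * o-max I)) ^ k I))
    ×
    (Parameterized SetCoverWithDemandsAndPrices
    By (λ I → k I + (n I ∸ s-min I) + (m I ∸ o-min I))
    SolvableInO (λ I → (n I * m I) * (1 ⊔ ((n I ∸ s-min I) * (m I ∸ o-min I))) ^ k I))
corollary3 =
  ( (parameterBound , 1 , λ I → fixed-parameter I {s-max I} {o-max I})
  , (capacities , proj₁ capacities-linear , capacities-decides) ) ,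
  ( (parameterBound , 1 , λ I → fixed-parameter I {n I ∸ s-min I} {m I ∸ o-min I})
  , (demands , proj₁ demands-linear , demands-decides) )
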